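{- Let $n,k$ be positive integers with $n\ge 2k$, and let $\mathcal F\subset\binom{[n]}{k}$ be an intersecting family with $|\mathcal F|\ge 36\binom{n-3}{k-3}$. Then $\varrho(\mathcal F)>\frac12$.
   Context: $[n]=\{1,\dots,n\}$; $\binom{[n]}{k}$ is the set of $k$-subsets of $[n]$. $\mathcal F$ is intersecting if $F\cap F'\ne\emptyset$ for all $F,F'\in\mathcal F$. For $i\in[n]$, $\mathcal F(i)=\{F\setminus\{i\}: i\in F\in\mathcal F\}$, and $\varrho(\mathcal F)=\max_{i\in[n]}|\mathcal F(i)|/|\mathcal F|$. Binomial coefficients $\binom{m}{j}$ are $0$ when $j<0$ or $j>m$. -}

module Defs where

open import Data.Nat using (ℕ; zero; suc; _∸_)
open import Data.Nat.Combinatorics using (_C_)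
open import Data.Fin using (Fin)
open import Data.Fin.Subset using (Subset; _∈_; _∩_; _-_; Nonempty)
open import Data.Fin.Subset.Properties using (_∈?_)
open import Data.List using (List; map; filter)
open import Data.List.Membership.Propositional renaming (_∈_ to _∈ₗ_)

-- A family of subsets of [n] = Fin n, given as a list (distinctness imposed
-- separately via Unique in the statement).
Family : ℕ → Set
Family n = List (Subset n)

Uniform : ∀ {n} → ℕ → Family n → Set
Uniform {n} k 𝓕 = ∀ F → F ∈ₗ 𝓕 → Data.Fin.Subset.∣ F ∣ ≡ k
  where open import Relation.Binary.PropositionalEquality using (_≡_)

Intersecting : ∀ {n} → Family n → Set
Intersecting 𝓕 = ∀ F F′ → F ∈ₗ 𝓕 → F′ ∈ₗ 𝓕 → Nonempty (F ∩ F′)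

link : ∀ {n} → Family n → Fin n → Family n
link 𝓕 i = map (λ F → F - i) (filter (i ∈?_) 𝓕)

-- binom(n-3, k-3) with the convention binom(m,j) = 0 for j < 0 or j > m
-- (with m = n-3, j = k-3 possibly negative integers).
binom-3 : ℕ → ℕ → ℕ
binom-3 (suc (suc (suc m))) (suc (suc (suc j))) = m C j
binom-3 _ _ = 0

{-# OPTIONS --safe #-}
module Submission where

-- A Hoffman-type spectral argument on the Johnson scheme.  Let f be the indicator function of 𝓕, N = |𝓕| and
-- let K be the form counting disjoint pairs, so that K(f, f) = 0.  On level l of the scheme K acts as
-- (−1)^l C(n−k−l, k−l); hence K + C(n−k−3, k−3)·I is nonnegative except on level 1.  Put wᵢ = n·deg(i) − kN,
-- s = ∑ wᵢ² and X(F) = ∑_{i ∈ F} wᵢ.  The level 1 part of f is proportional to X, and its contribution is linear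
-- in s.  The level 2 part is bounded from below by testing f against the level 2 part of X²: by Cauchy–Schwarz
-- ∑_{F ∈ 𝓕} X(F)² ≥ (∑_{F ∈ 𝓕} X(F))²/N, which is quadratic in s, and the error terms ∑ wᵢ³ and ∑ wᵢ⁴ are
-- controlled by 2wᵢ ≤ (n−2k)N if no degree exceeds N/2.  With N ≥ 36 C(n−3, k−3) the resulting quadratic
-- inequality in s has no solution, by a polynomial inequality in n and k which holds unless k ≤ 3 and n is small;
-- in that case points of degree 0 are added first.

open import Defs
open import Data.Nat as ℕ using (ℕ; zero; suc; _!)
import Data.Nat.Properties as ℕ
open import Data.Nat.Combinatorics using (_C_; nCk+nC[k+1]≡[n+1]C[k+1]; nCk≡nC[n∸k]; nCn≡1; nC1≡n)
open import Data.Nat.Tactic.RingSolver using () renaming (solve-∀ to solveℕ-∀)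
open import Data.Bool using (true; false)
open import Data.Empty using (⊥; ⊥-elim)
open import Data.Fin using (Fin; zero; suc)
open import Data.Fin.Properties using (any?) renaming (_≟_ to _≟ᶠ_)
open import Data.Fin.Subset using (Subset; ∣_∣; _∩_; _∈_; Nonempty; outside) renaming (⊥ to ∅; _-_ to _∖_)
open import Data.Fin.Subset.Properties using (_∈?_; x∈p∩q⁻; x∈p∧x≢y⇒x∈p-y; x∈p⇒∣p-x∣<∣p∣)
open import Data.List using (List; []; _∷_; length; map; filter)
open import Data.List.Membership.Propositional using () renaming (_∈_ to _∈ₗ_)
open import Data.List.Membership.Propositional.Properties using (∈-map⁻)
open import Data.List.Properties using (length-map; filter-all)
open import Data.List.Relation.Unary.All as All using (All; []; _∷_)
open import Data.List.Relation.Unary.AllPairs using ([]; _∷_)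
open import Data.List.Relation.Unary.Any using (here; there)
open import Data.List.Relation.Unary.Unique.Propositional using (Unique)
open import Data.List.Relation.Unary.Unique.Propositional.Properties using (map⁺)
open import Data.Product using (∃; Σ-syntax; _×_; _,_; proj₁)
open import Data.Sum using (_⊎_; inj₁; inj₂)
open import Data.Vec using ([]; _∷_; here; there)
open import Data.Vec.Properties using (∷-injectiveʳ)
open import Function using (_∘_)
open import Relation.Binary.PropositionalEquality using (_≡_; _≢_; refl; sym; trans; cong; cong₂; subst; subst₂)
open import Relation.Nullary using (yes; no; does; contradiction)

-- The obstacle is the negative eigenvalue on level 1: its term can cancel the positive level 0
-- term, as happens for a star, whose indicator lives in levels 0 and 1. With degrees at most N/2
-- the level 1 term still grows with `s`, so it has to be beaten by something that grows faster,
-- which is why level 2 is needed. The shift C(n-k-3, k-3) is the modulus of the eigenvalue on level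
-- 3, the largest among the levels from 3 on. It costs C(n-k-3, k-3)·N in the value of the form at
-- f. Since n(n-1)(n-2)·C(n-3, k-3) = k(k-1)(k-2)·C(n, k), the lower bound on N turns this linear
-- cost into a small part of the level 0 term, which is quadratic in N. Everything stays in ℤ. No
-- spectral decomposition is formed: levels are split off one at a time up to a positive integer
-- factor, and a projection appears as an integer combination α f - β₀ - β₁ X - β₂ y. This is why
-- most identities are cross-multiplied and why factorials and polynomials in n are cancelled only
-- at the end.

module Naturals where

  -- Polynomial inequalities in n and k

  open import Data.Nat using (_+_; _*_; _<_)

  -- With ν = n − 5, m = k − 2 and d = n − 2k no subtraction is left in discr n k = upper − lower.
  slopeℕ : ℕ → ℕ → ℕ → ℕ
  slopeℕ ν m d = (ν + 5) * (ν + 4) * (m + d + 1) * d * 128 +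
    (ν + 1) * ((ν + 4) * (d * d * 13 + d * (m + 2) * 32) + (ν + 5) * ((m + 2) * (m + 1)) * 32) * 3

  upper lower : ℕ → ℕ → ℕ → ℕ
  upper ν m d = (ν + 1) * ((ν + 5) * (ν + 2) * 5 + 7) * (ν + 5) * ((m + d + 2) * (m + d + 1)) * (ν + 3) *
    ((ν + 5) * (ν * 8 + 5) + d * d * 27) * 512
  lower ν m d = (ν + 2) * (slopeℕ ν m d * slopeℕ ν m d) * 3

  -- Turns each inequality below into a polynomial identity: the witness `c` is a polynomial in
  -- Horner form with natural coefficients, so its sign is evident, and the final 1 gives
  -- strictness.
  exceeds : ∀ {a b} c → a ≡ b + c + 1 → b < a
  exceeds {_} {b} c refl = subst (b <_) (ℕ.+-comm 1 (b + c)) (ℕ.s≤s (ℕ.m≤m+n b c))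

  -- The arguments encode n = x + 33, hence d = n - 4 = x + 29; likewise d = n - 6 = x + 27 in
  -- `k=3`.
  k=2 : ∀ x → lower (x + 28) 0 (x + 29) < upper (x + 28) 0 (x + 29)
  k=2 x = exceeds {upper (x + 28) 0 (x + 29)} {lower (x + 28) 0 (x + 29)} _ (expand x)
    where
    expand : ∀ x →
      ((x + 28) + 1) * (((x + 28) + 5) * ((x + 28) + 2) * 5 + 7) * ((x + 28) + 5) * ((0 + (x + 29) + 2) * (0 + (x +
      29) + 1)) * ((x + 28) + 3) * (((x + 28) + 5) * ((x + 28) * 8 + 5) + (x + 29) * (x + 29) * 27) * 512 ≡
      ((x + 28) + 2) * ((((x + 28) + 5) * ((x + 28) + 4) * (0 + (x + 29) + 1) * (x + 29) * 128 + ((x + 28) + 1) *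
      (((x + 28) + 4) * ((x + 29) * (x + 29) * 13 + (x + 29) * (0 + 2) * 32) + ((x + 28) + 5) * ((0 + 2) * (0 + 1)) *
      32) * 3) * (((x + 28) + 5) * ((x + 28) + 4) * (0 + (x + 29) + 1) * (x + 29) * 128 + ((x + 28) + 1) * (((x + 28)
      + 4) * ((x + 29) * (x + 29) * 13 + (x + 29) * (0 + 2) * 32) + ((x + 28) + 5) * ((0 + 2) * (0 + 1)) * 32) * 3))
      * 3 +
      (x * (x * (x * (x * (x * (x * (x * (x * (x * 5933 + 1457820) + 156747279) + 9634822206) + 370447355883) +
      9130449521136) + 141134639095993) + 1257670583140758) + 5075594783448192) + 1787350661314559) + 1
    expand = solveℕ-∀

  k=3 : ∀ x → lower (x + 28) 1 (x + 27) < upper (x + 28) 1 (x + 27)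
  k=3 x = exceeds {upper (x + 28) 1 (x + 27)} {lower (x + 28) 1 (x + 27)} _ (expand x)
    where
    expand : ∀ x →
      ((x + 28) + 1) * (((x + 28) + 5) * ((x + 28) + 2) * 5 + 7) * ((x + 28) + 5) * ((1 + (x + 27) + 2) * (1 + (x +
      27) + 1)) * ((x + 28) + 3) * (((x + 28) + 5) * ((x + 28) * 8 + 5) + (x + 27) * (x + 27) * 27) * 512 ≡
      ((x + 28) + 2) * ((((x + 28) + 5) * ((x + 28) + 4) * (1 + (x + 27) + 1) * (x + 27) * 128 + ((x + 28) + 1) *
      (((x + 28) + 4) * ((x + 27) * (x + 27) * 13 + (x + 27) * (1 + 2) * 32) + ((x + 28) + 5) * ((1 + 2) * (1 + 1)) *
      32) * 3) * (((x + 28) + 5) * ((x + 28) + 4) * (1 + (x + 27) + 1) * (x + 27) * 128 + ((x + 28) + 1) * (((x + 28)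
      + 4) * ((x + 27) * (x + 27) * 13 + (x + 27) * (1 + 2) * 32) + ((x + 28) + 5) * ((1 + 2) * (1 + 1)) * 32) * 3))
      * 3 +
      (x * (x * (x * (x * (x * (x * (x * (x * (x * 5933 + 1447028) + 155217775) + 9589496270) + 374876662267) +
      9573259459688) + 158607759099497) + 1625480982429654) + 9159946357650048) + 20691859590051839) + 1
    expand = solveℕ-∀

  k=4 : ∀ x → lower (x + 6) 2 (x + 3) < upper (x + 6) 2 (x + 3)
  k=4 x = exceeds {upper (x + 6) 2 (x + 3)} {lower (x + 6) 2 (x + 3)} _ (expand x)
    where
    expand : ∀ x →
      ((x + 6) + 1) * (((x + 6) + 5) * ((x + 6) + 2) * 5 + 7) * ((x + 6) + 5) * ((2 + (x + 3) + 2) * (2 + (x + 3) +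
      1)) * ((x + 6) + 3) * (((x + 6) + 5) * ((x + 6) * 8 + 5) + (x + 3) * (x + 3) * 27) * 512 ≡
      ((x + 6) + 2) * ((((x + 6) + 5) * ((x + 6) + 4) * (2 + (x + 3) + 1) * (x + 3) * 128 + ((x + 6) + 1) * (((x + 6)
      + 4) * ((x + 3) * (x + 3) * 13 + (x + 3) * (2 + 2) * 32) + ((x + 6) + 5) * ((2 + 2) * (2 + 1)) * 32) * 3) *
      (((x + 6) + 5) * ((x + 6) + 4) * (2 + (x + 3) + 1) * (x + 3) * 128 + ((x + 6) + 1) * (((x + 6) + 4) * ((x + 3)
      * (x + 3) * 13 + (x + 3) * (2 + 2) * 32) + ((x + 6) + 5) * ((2 + 2) * (2 + 1)) * 32) * 3)) * 3 +
      (x * (x * (x * (x * (x * (x * (x * (x * (x * 5933 + 261502) + 4309327) + 30047992) + 69671551) + 686851510) +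
      16582853297) + 138624477588) + 505210870260) + 699232240799) + 1
    expand = solveℕ-∀

  -- Here k = x + 5 and n = 2k + y, so the whole range n ≥ 2k is covered by natural x and y. The
  -- coefficient of the ninth power of y is 5933 = 5·35·512 - 3·(128 + 39)², the comparison of
  -- leading terms for k/n → 0.
  k≥5 : ∀ x y → lower (x + x + y + 5) (x + 3) (y) < upper (x + x + y + 5) (x + 3) (y)
  k≥5 x y = exceeds {upper (x + x + y + 5) (x + 3) (y)} {lower (x + x + y + 5) (x + 3) (y)} _ (expand x y)
    where
    expand : ∀ x y →
      ((x + x + y + 5) + 1) * (((x + x + y + 5) + 5) * ((x + x + y + 5) + 2) * 5 + 7) * ((x + x + y + 5) + 5) * (((x
      + 3) + (y) + 2) * ((x + 3) + (y) + 1)) * ((x + x + y + 5) + 3) * (((x + x + y + 5) + 5) * ((x + x + y + 5) * 8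
      + 5) + (y) * (y) * 27) * 512 ≡
      ((x + x + y + 5) + 2) * ((((x + x + y + 5) + 5) * ((x + x + y + 5) + 4) * ((x + 3) + (y) + 1) * (y) * 128 + ((x
      + x + y + 5) + 1) * (((x + x + y + 5) + 4) * ((y) * (y) * 13 + (y) * ((x + 3) + 2) * 32) + ((x + x + y + 5) +
      5) * (((x + 3) + 2) * ((x + 3) + 1)) * 32) * 3) * (((x + x + y + 5) + 5) * ((x + x + y + 5) + 4) * ((x + 3) +
      (y) + 1) * (y) * 128 + ((x + x + y + 5) + 1) * (((x + x + y + 5) + 4) * ((y) * (y) * 13 + (y) * ((x + 3) + 2) *
      32) + ((x + x + y + 5) + 5) * (((x + 3) + 2) * ((x + 3) + 1)) * 32) * 3)) * 3 +
      (y * (y * (y * (y * (y * (y * (y * (y * (y * 5933 + (x * 96002 + 197313)) + (x * (x * 692680 + 3668232) +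
      2931123)) + (x * (x * (x * 2944656 + 27586584) + 73525490) + 40878147)) + (x * (x * (x * (x * 8175632 +
      113975328) + 561403556) + 1111013388) + 663841200)) + (x * (x * (x * (x * (x * 15426976 + 288800784) +
      2109294872) + 7451943180) + 12560768864) + 7871749644)) + (x * (x * (x * (x * (x * (x * 19774464 + 464621568) +
      4493677312) + 22854921216) + 64302214656) + 94545475584) + 56456247040)) + (x * (x * (x * (x * (x * (x * (x *
      16517120 + 465223680) + 5574868480) + 36821501952) + 144673035264) + 337862221824) + 433820567040) +
      235981977600)) + (x * (x * (x * (x * (x * (x * (x * (x * 8077312 + 264339456) + 3764248576) + 30456668160) +
      153096663040) + 489431126016) + 971433062400) + 1094092492800) + 535136256000)) + (x * (x * (x * (x * (x * (x *
      (x * (x * (x * 1736704 + 64634880) + 1064189952) + 10171834368) + 62189518848) + 252158558208) + 677906186240)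
      + 1164946022400) + 1160847360000) + 510935039999)) + 1
    expand = solveℕ-∀


-- Integer functions on the subsets, their operators and bilinear forms

module Spectral where

  open import Data.Integer using (ℤ; +_; -[1+_]; 0ℤ; 1ℤ; _+_; _*_; _-_; -_; _≤_; _<_; +≤+; +<+)
  open import Data.Integer.Base using (positive; nonNegative; ≢-nonZero; >-nonZero)
  import Data.Integer.Properties as ℤ
  open import Data.Integer.Tactic.RingSolver using (solve-∀)

  private variable
    n : ℕ

  Fun : ℕ → Set
  Fun n = Subset n → ℤ


  infix 4 _≈_
  _≈_ : Fun n → Fun n → Set
  f ≈ g = ∀ S → f S ≡ g S

  𝟎 : Fun n
  𝟎 _ = 0ℤ

  infixl 6 _⊕_
  infixr 7 _⊙_
  _⊕_ : Fun n → Fun n → Fun n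
  (f ⊕ g) S = f S + g S

  _⊙_ : ℤ → Fun n → Fun n
  (c ⊙ f) S = c * f S

  lo hi : Fun (suc n) → Fun n
  lo f S = f (false ∷ S)
  hi f S = f (true ∷ S)

  -- U f S = ∑_{i ∈ S} f (S ∖ i),  D f S = ∑_{i ∉ S} f (S ∪ i),  Y f R = ∑_{S ⊇ R} f S,  sg f S = (−1)^|S| f S.
  U D Y rk sg : Fun n → Fun n
  U f []          = 0ℤ
  U f (false ∷ S) = U (lo f) S
  U f (true ∷ S)  = U (hi f) S + lo f S

  D f []          = 0ℤ
  D f (false ∷ S) = D (lo f) S + hi f S
  D f (true ∷ S)  = D (hi f) S

  Y f []          = f []
  Y f (false ∷ S) = Y (lo f) S + Y (hi f) S
  Y f (true ∷ S)  = Y (hi f) S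

  rk f S = + ∣ S ∣ * f S

  sg f []          = f []
  sg f (false ∷ S) = sg (lo f) S
  sg f (true ∷ S)  = - sg (hi f) S

  -- I f g = ∑ f S · g S over all S, and K f g = ∑ f S · g T over all pairs with S ∩ T = ∅.
  I K : Fun n → Fun n → ℤ
  I {zero}  f g = f [] * g []
  I {suc n} f g = I (lo f) (lo g) + I (hi f) (hi g)

  K {zero}  f g = f [] * g []
  K {suc n} f g = K (lo f) (lo g) + K (lo f) (hi g) + K (hi f) (lo g)

  U-cong : {f g : Fun n} → f ≈ g → U f ≈ U g
  U-cong e []          = refl
  U-cong e (false ∷ S) = U-cong (λ T → e (false ∷ T)) S
  U-cong e (true ∷ S)  = cong₂ _+_ (U-cong (λ T → e (true ∷ T)) S) (e (false ∷ S))

  D-cong : {f g : Fun n} → f ≈ g → D f ≈ D g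
  D-cong e []          = refl
  D-cong e (false ∷ S) = cong₂ _+_ (D-cong (λ T → e (false ∷ T)) S) (e (true ∷ S))
  D-cong e (true ∷ S)  = D-cong (λ T → e (true ∷ T)) S

  Y-cong : {f g : Fun n} → f ≈ g → Y f ≈ Y g
  Y-cong e []          = e []
  Y-cong e (false ∷ S) = cong₂ _+_ (Y-cong (λ T → e (false ∷ T)) S) (Y-cong (λ T → e (true ∷ T)) S)
  Y-cong e (true ∷ S)  = Y-cong (λ T → e (true ∷ T)) S

  I-cong : {f f′ g g′ : Fun n} → f ≈ f′ → g ≈ g′ → I f g ≡ I f′ g′
  I-cong {zero}  p q = cong₂ _*_ (p []) (q [])
  I-cong {suc n} p q = cong₂ _+_ (I-cong (λ T → p (false ∷ T)) (λ T → q (false ∷ T)))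
                                 (I-cong (λ T → p (true ∷ T)) (λ T → q (true ∷ T)))

  K-cong : {f f′ g g′ : Fun n} → f ≈ f′ → g ≈ g′ → K f g ≡ K f′ g′
  K-cong {zero}  p q = cong₂ _*_ (p []) (q [])
  K-cong {suc n} p q = cong₂ _+_ (cong₂ _+_
    (K-cong (λ T → p (false ∷ T)) (λ T → q (false ∷ T)))
    (K-cong (λ T → p (false ∷ T)) (λ T → q (true ∷ T))))
    (K-cong (λ T → p (true ∷ T)) (λ T → q (false ∷ T)))

  private
    mid4 : ∀ a b c d → (a + b) + (c + d) ≡ (a + c) + (b + d)
    mid4 = solve-∀
    dist2 : ∀ c a b → c * a + c * b ≡ c * (a + b)
    dist2 = solve-∀
    mid6 : ∀ a b c d e f → (a + b) + (c + d) + (e + f) ≡ (a + c + e) + (b + d + f)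
    mid6 = solve-∀
    dist3 : ∀ c a b d → c * a + c * b + c * d ≡ c * (a + b + d)
    dist3 = solve-∀

  U-⊕ : (f g : Fun n) → U (f ⊕ g) ≈ U f ⊕ U g
  U-⊕ f g []          = refl
  U-⊕ f g (false ∷ S) = U-⊕ (lo f) (lo g) S
  U-⊕ f g (true ∷ S)  = trans (cong (_+ (lo f ⊕ lo g) S) (U-⊕ (hi f) (hi g) S))
                              (mid4 (U (hi f) S) (U (hi g) S) (lo f S) (lo g S))

  U-⊙ : (c : ℤ) (f : Fun n) → U (c ⊙ f) ≈ c ⊙ U f
  U-⊙ c f []          = sym (ℤ.*-zeroʳ c)
  U-⊙ c f (false ∷ S) = U-⊙ c (lo f) S
  U-⊙ c f (true ∷ S)  = trans (cong (_+ c * lo f S) (U-⊙ c (hi f) S)) (dist2 c (U (hi f) S) (lo f S))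

  D-⊕ : (f g : Fun n) → D (f ⊕ g) ≈ D f ⊕ D g
  D-⊕ f g []          = refl
  D-⊕ f g (false ∷ S) = trans (cong (_+ (hi f ⊕ hi g) S) (D-⊕ (lo f) (lo g) S))
                              (mid4 (D (lo f) S) (D (lo g) S) (hi f S) (hi g S))
  D-⊕ f g (true ∷ S)  = D-⊕ (hi f) (hi g) S

  D-⊙ : (c : ℤ) (f : Fun n) → D (c ⊙ f) ≈ c ⊙ D f
  D-⊙ c f []          = sym (ℤ.*-zeroʳ c)
  D-⊙ c f (false ∷ S) = trans (cong (_+ c * hi f S) (D-⊙ c (lo f) S)) (dist2 c (D (lo f) S) (hi f S))
  D-⊙ c f (true ∷ S)  = D-⊙ c (hi f) S

  Y-⊕ : (f g : Fun n) → Y (f ⊕ g) ≈ Y f ⊕ Y g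
  Y-⊕ f g []          = refl
  Y-⊕ f g (false ∷ S) = trans (cong₂ _+_ (Y-⊕ (lo f) (lo g) S) (Y-⊕ (hi f) (hi g) S))
                              (mid4 (Y (lo f) S) (Y (lo g) S) (Y (hi f) S) (Y (hi g) S))
  Y-⊕ f g (true ∷ S)  = Y-⊕ (hi f) (hi g) S

  Y-⊙ : (c : ℤ) (f : Fun n) → Y (c ⊙ f) ≈ c ⊙ Y f
  Y-⊙ c f []          = refl
  Y-⊙ c f (false ∷ S) = trans (cong₂ _+_ (Y-⊙ c (lo f) S) (Y-⊙ c (hi f) S)) (dist2 c (Y (lo f) S) (Y (hi f) S))
  Y-⊙ c f (true ∷ S)  = Y-⊙ c (hi f) S

  I-comm : (f g : Fun n) → I f g ≡ I g f
  I-comm {zero} f g = com (f []) (g [])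
    where com : ∀ a b → a * b ≡ b * a
          com = solve-∀
  I-comm {suc n} f g = cong₂ _+_ (I-comm (lo f) (lo g)) (I-comm (hi f) (hi g))

  K-comm : (f g : Fun n) → K f g ≡ K g f
  K-comm {zero} f g = com (f []) (g [])
    where com : ∀ a b → a * b ≡ b * a
          com = solve-∀
  K-comm {suc n} f g =
    trans (cong₂ _+_ (cong₂ _+_ (K-comm (lo f) (lo g)) (K-comm (lo f) (hi g))) (K-comm (hi f) (lo g)))
          (swap (K (lo g) (lo f)) (K (hi g) (lo f)) (K (lo g) (hi f)))
    where swap : ∀ a b c → a + b + c ≡ a + c + b
          swap = solve-∀

  I-⊕ : (f g h : Fun n) → I (f ⊕ g) h ≡ I f h + I g h
  I-⊕ {zero} f g h = dist (f []) (g []) (h [])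
    where dist : ∀ a b c → (a + b) * c ≡ a * c + b * c
          dist = solve-∀
  I-⊕ {suc n} f g h = trans (cong₂ _+_ (I-⊕ (lo f) (lo g) (lo h)) (I-⊕ (hi f) (hi g) (hi h)))
                            (mid4 (I (lo f) (lo h)) (I (lo g) (lo h)) (I (hi f) (hi h)) (I (hi g) (hi h)))

  I-⊙ : (c : ℤ) (f g : Fun n) → I (c ⊙ f) g ≡ c * I f g
  I-⊙ {zero} c f g = assoc c (f []) (g [])
    where assoc : ∀ a b c → (a * b) * c ≡ a * (b * c)
          assoc = solve-∀
  I-⊙ {suc n} c f g = trans (cong₂ _+_ (I-⊙ c (lo f) (lo g)) (I-⊙ c (hi f) (hi g)))
                            (dist2 c (I (lo f) (lo g)) (I (hi f) (hi g)))

  K-⊕ : (f g h : Fun n) → K (f ⊕ g) h ≡ K f h + K g h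
  K-⊕ {zero} f g h = dist (f []) (g []) (h [])
    where dist : ∀ a b c → (a + b) * c ≡ a * c + b * c
          dist = solve-∀
  K-⊕ {suc n} f g h =
    trans (cong₂ _+_ (cong₂ _+_ (K-⊕ (lo f) (lo g) (lo h)) (K-⊕ (lo f) (lo g) (hi h))) (K-⊕ (hi f) (hi g) (lo h)))
          (mid6 (K (lo f) (lo h)) (K (lo g) (lo h)) (K (lo f) (hi h)) (K (lo g) (hi h)) (K (hi f) (lo h)) (K (hi g) (lo h)))

  K-⊙ : (c : ℤ) (f g : Fun n) → K (c ⊙ f) g ≡ c * K f g
  K-⊙ {zero} c f g = assoc c (f []) (g [])
    where assoc : ∀ a b c → (a * b) * c ≡ a * (b * c)
          assoc = solve-∀
  K-⊙ {suc n} c f g =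
    trans (cong₂ _+_ (cong₂ _+_ (K-⊙ c (lo f) (lo g)) (K-⊙ c (lo f) (hi g))) (K-⊙ c (hi f) (lo g)))
          (dist3 c (K (lo f) (lo g)) (K (lo f) (hi g)) (K (hi f) (lo g)))

  U-𝟎 : U {n} 𝟎 ≈ 𝟎
  U-𝟎 []          = refl
  U-𝟎 (false ∷ S) = U-𝟎 S
  U-𝟎 (true ∷ S)  = trans (ℤ.+-identityʳ _) (U-𝟎 S)

  D-𝟎 : D {n} 𝟎 ≈ 𝟎
  D-𝟎 []          = refl
  D-𝟎 (false ∷ S) = trans (ℤ.+-identityʳ _) (D-𝟎 S)
  D-𝟎 (true ∷ S)  = D-𝟎 S

  -- Commutation relations

  adjoint : (f g : Fun n) → I (U f) g ≡ I f (D g)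
  adjoint {zero}  f g = sym (ℤ.*-zeroʳ (f []))
  adjoint {suc n} f g =
    trans (cong₂ _+_ (adjoint (lo f) (lo g)) (trans (I-⊕ (U (hi f)) (lo f) (hi g)) (cong (_+ I (lo f) (hi g)) (adjoint (hi f) (hi g)))))
    (trans (re (I (lo f) (D (lo g))) (I (hi f) (D (hi g))) (I (lo f) (hi g)))
           (cong (_+ I (hi f) (D (hi g)))
             (trans (cong₂ _+_ (I-comm (lo f) (D (lo g))) (I-comm (lo f) (hi g)))
             (trans (sym (I-⊕ (D (lo g)) (hi g) (lo f))) (I-comm (D (lo g) ⊕ hi g) (lo f))))))
    where re : ∀ a b c → a + (b + c) ≡ (a + c) + b
          re = solve-∀

  -- Adding one point and removing another commute; if the two points coincide, S itself is returned
  -- n - |S| times in one order and |S| times in the other. This is the sl₂ relation of the Boolean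
  -- lattice.
  DU-UD : (f : Fun n) (S : Subset n) → D (U f) S ≡ U (D f) S + (+ n - + 2 * + ∣ S ∣) * f S
  DU-UD f [] = refl
  DU-UD {suc n} f (false ∷ S) =
    trans (cong (_+ (U (hi f) S + lo f S)) (DU-UD (lo f) S))
    (trans (re (U (D (lo f)) S) (U (hi f) S) (lo f S) (+ n) (+ ∣ S ∣))
           (cong (_+ (+ suc n - + 2 * + ∣ S ∣) * lo f S) (sym (U-⊕ (D (lo f)) (hi f) S))))
    where re : ∀ a b c n s → (a + (n - + 2 * s) * c) + (b + c) ≡ (a + b) + ((+ 1 + n) - + 2 * s) * c
          re = solve-∀
  DU-UD {suc n} f (true ∷ S) =
    trans (D-⊕ (U (hi f)) (lo f) S)
    (trans (cong (_+ D (lo f) S) (DU-UD (hi f) S))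
           (re (U (D (hi f)) S) (D (lo f) S) (hi f S) (+ n) (+ ∣ S ∣)))
    where re : ∀ a b c n s → (a + (n - + 2 * s) * c) + b ≡ (a + (b + c)) + ((+ 1 + n) - + 2 * (+ 1 + s)) * c
          re = solve-∀

  rk-U : (f : Fun n) → rk (U f) ≈ U (rk f) ⊕ U f
  rk-U f [] = refl
  rk-U f (false ∷ S) = rk-U (lo f) S
  rk-U f (true ∷ S) =
    trans (ex (+ ∣ S ∣) (U (hi f) S) (lo f S))
    (trans (cong (λ z → z + U (hi f) S + (lo f S + + ∣ S ∣ * lo f S)) (rk-U (hi f) S))
    (trans (re (U (rk (hi f)) S) (U (hi f) S) (lo f S) (+ ∣ S ∣ * lo f S))
           (cong (λ z → z + + ∣ S ∣ * lo f S + (U (hi f) S + lo f S))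
                 (trans (sym (U-⊕ (rk (hi f)) (hi f) S)) (U-cong (λ T → sucmul (+ ∣ T ∣) (hi f T)) S)))))
    where
    ex : ∀ s a b → (+ 1 + s) * (a + b) ≡ s * a + a + (b + s * b)
    ex = solve-∀
    re : ∀ r a b c → (r + a) + a + (b + c) ≡ (r + a) + c + (a + b)
    re = solve-∀
    sucmul : ∀ t x → t * x + x ≡ (+ 1 + t) * x
    sucmul = solve-∀

  rk-D : (f : Fun n) → D (rk f) ≈ rk (D f) ⊕ D f
  rk-D f [] = refl
  rk-D f (false ∷ S) =
    trans (cong (_+ (+ 1 + + ∣ S ∣) * hi f S) (rk-D (lo f) S))
          (re (+ ∣ S ∣) (D (lo f) S) (hi f S))
    where re : ∀ s a b → (s * a + a) + (+ 1 + s) * b ≡ s * (a + b) + (a + b)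
          re = solve-∀
  rk-D f (true ∷ S) =
    trans (D-cong (λ T → sucmul (+ ∣ T ∣) (hi f T)) S)
    (trans (D-⊕ (rk (hi f)) (hi f) S)
    (trans (cong (_+ D (hi f) S) (rk-D (hi f) S)) (re (+ ∣ S ∣) (D (hi f) S))))
    where
    re : ∀ s a → (s * a + a) + a ≡ (+ 1 + s) * a + a
    re = solve-∀
    sucmul : ∀ t x → (+ 1 + t) * x ≡ t * x + x
    sucmul = solve-∀

  -- The points of each S ⊇ R are counted according to whether they lie outside R or in R.
  Y-D : (f : Fun n) → Y (rk f) ≈ Y (D f) ⊕ rk (Y f)
  Y-D f [] = refl
  Y-D f (false ∷ S) =
    trans (cong₂ _+_ (Y-D (lo f) S)
            (trans (Y-cong (λ T → sucmul (+ ∣ T ∣) (hi f T)) S)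
            (trans (Y-⊕ (rk (hi f)) (hi f) S) (cong (_+ Y (hi f) S) (Y-D (hi f) S)))))
    (trans (re (Y (D (lo f)) S) (Y (D (hi f)) S) (Y (lo f) S) (Y (hi f) S) (+ ∣ S ∣))
           (cong (λ z → z + Y (D (hi f)) S + + ∣ S ∣ * (Y (lo f) S + Y (hi f) S)) (sym (Y-⊕ (D (lo f)) (hi f) S))))
    where
    re : ∀ a b c d s → (a + s * c) + ((b + s * d) + d) ≡ (a + d) + b + s * (c + d)
    re = solve-∀
    sucmul : ∀ t x → (+ 1 + t) * x ≡ t * x + x
    sucmul = solve-∀
  Y-D f (true ∷ S) =
    trans (Y-cong (λ T → sucmul (+ ∣ T ∣) (hi f T)) S)
    (trans (Y-⊕ (rk (hi f)) (hi f) S)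
    (trans (cong (_+ Y (hi f) S) (Y-D (hi f) S)) (re (Y (D (hi f)) S) (Y (hi f) S) (+ ∣ S ∣))))
    where
    re : ∀ a b s → (a + s * b) + b ≡ a + (+ 1 + s) * b
    re = solve-∀
    sucmul : ∀ t x → (+ 1 + t) * x ≡ t * x + x
    sucmul = solve-∀

  rk-hi : (f : Fun (suc n)) → hi (rk f) ≈ rk (hi f) ⊕ hi f
  rk-hi f S = sucmul (+ ∣ S ∣) (hi f S)
    where sucmul : ∀ t x → (+ 1 + t) * x ≡ t * x + x
          sucmul = solve-∀

  K-⊕ʳ : (f g h : Fun n) → K f (g ⊕ h) ≡ K f g + K f h
  K-⊕ʳ f g h = trans (K-comm f (g ⊕ h)) (trans (K-⊕ g h f) (cong₂ _+_ (K-comm g f) (K-comm h f)))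

  I-⊕ʳ : (f g h : Fun n) → I f (g ⊕ h) ≡ I f g + I f h
  I-⊕ʳ f g h = trans (I-comm f (g ⊕ h)) (trans (I-⊕ g h f) (cong₂ _+_ (I-comm g f) (I-comm h f)))

  K-⊙ʳ : (c : ℤ) (f g : Fun n) → K f (c ⊙ g) ≡ c * K f g
  K-⊙ʳ c f g = trans (K-comm f (c ⊙ g)) (trans (K-⊙ c g f) (cong (c *_) (K-comm g f)))

  I-⊙ʳ : (c : ℤ) (f g : Fun n) → I f (c ⊙ g) ≡ c * I f g
  I-⊙ʳ c f g = trans (I-comm f (c ⊙ g)) (trans (I-⊙ c g f) (cong (c *_) (I-comm g f)))

  sg-⊕ : (f g : Fun n) → sg (f ⊕ g) ≈ sg f ⊕ sg g
  sg-⊕ f g []          = refl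
  sg-⊕ f g (false ∷ S) = sg-⊕ (lo f) (lo g) S
  sg-⊕ f g (true ∷ S)  = trans (cong -_ (sg-⊕ (hi f) (hi g) S)) (neg (sg (hi f) S) (sg (hi g) S))
    where neg : ∀ a b → - (a + b) ≡ - a + - b
          neg = solve-∀

  -- The first set of a disjoint pair S, T can be enlarged, keeping the pair disjoint, by exactly
  -- the n - |S| - |T| points outside both.
  K-U : (f g : Fun n) → K (U f) g + K (rk f) g + K f (rk g) ≡ + n * K f g
  K-U {zero} f g = re (f []) (g [])
    where re : ∀ a b → + 0 * b + (+ 0 * a) * b + a * (+ 0 * b) ≡ + 0 * (a * b)
          re = solve-∀
  K-U {suc n} f g =
    trans (cong₂ _+_ (cong₂ _+_
             (cong (λ z → K (U a) c + K (U a) d + z) (K-⊕ (U b) a c))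
             (cong (λ z → K (rk a) c + K (rk a) d + z)
                   (trans (K-cong (rk-hi f) (λ _ → refl)) (K-⊕ (rk b) b c))))
             (cong (λ z → K a (rk c) + z + K b (rk c))
                   (trans (K-cong (λ _ → refl) (rk-hi g)) (K-⊕ʳ a (rk d) d))))
    (trans (re (K (U a) c) (K (U a) d) (K (U b) c) (K a c)
               (K (rk a) c) (K (rk a) d) (K (rk b) c) (K b c)
               (K a (rk c)) (K a (rk d)) (K a d) (K b (rk c)))
    (trans (cong (_+ (K a c + K a d + K b c)) (cong₂ _+_ (cong₂ _+_ (K-U a c) (K-U a d)) (K-U b c)))
           (fin (+ n) (K a c) (K a d) (K b c))))
    where
    a = lo f
    b = hi f
    c = lo g
    d = hi g
    re : ∀ u₁ u₂ u₃ x r₁ r₂ r₃ z s₁ s₂ y s₃ →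
         (u₁ + u₂ + (u₃ + x)) + (r₁ + r₂ + (r₃ + z)) + (s₁ + (s₂ + y) + s₃)
         ≡ ((u₁ + r₁ + s₁) + (u₂ + r₂ + s₂) + (u₃ + r₃ + s₃)) + (x + y + z)
    re = solve-∀
    fin : ∀ m x y z → (m * x + m * y + m * z) + (x + y + z) ≡ (+ 1 + m) * (x + y + z)
    fin = solve-∀

  -- Inclusion-exclusion: the sum of (-1)^|R| over R ⊆ S ∩ T is 1 if S ∩ T is empty and 0 otherwise.
  K-Y : (f g : Fun n) → K f g ≡ I (sg (Y f)) (Y g)
  K-Y {zero}  f g = refl
  K-Y {suc n} f g = sym
    (trans (cong₂ _+_
      (trans (I-cong (sg-⊕ (Y a) (Y b)) (λ _ → refl))
      (trans (I-⊕ (sg (Y a)) (sg (Y b)) (Y c ⊕ Y d))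
             (cong₂ _+_ (I-⊕ʳ (sg (Y a)) (Y c) (Y d)) (I-⊕ʳ (sg (Y b)) (Y c) (Y d)))))
      (trans (I-cong (λ S → minus (sg (Y b) S)) (λ _ → refl)) (I-⊙ (- 1ℤ) (sg (Y b)) (Y d))))
    (trans (re (I (sg (Y a)) (Y c)) (I (sg (Y a)) (Y d)) (I (sg (Y b)) (Y c)) (I (sg (Y b)) (Y d)))
           (sym (cong₂ _+_ (cong₂ _+_ (K-Y a c) (K-Y a d)) (K-Y b c)))))
    where
    a = lo f
    b = hi f
    c = lo g
    d = hi g
    minus : ∀ x → - x ≡ (- + 1) * x
    minus = solve-∀
    re : ∀ w x y z → ((w + x) + (y + z)) + (- + 1) * z ≡ w + x + y
    re = solve-∀

  -- Support on the sets of size l, as an equation so that it is preserved by linear operators.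
  Rk : ℤ → Fun n → Set
  Rk l f = rk f ≈ l ⊙ f

  private
    sucmul : ∀ t x → (+ 1 + t) * x ≡ t * x + x
    sucmul = solve-∀
    +-cancelʳ : ∀ c a b → a + c ≡ b + c → a ≡ b
    +-cancelʳ c a b e = trans (iso a c) (trans (cong (_- c) e) (sym (iso b c)))
      where iso : ∀ a c → a ≡ (a + c) - c
            iso = solve-∀

  Rk-U : ∀ l {f : Fun n} → Rk l f → Rk (+ 1 + l) (U f)
  Rk-U l {f} r S = trans (rk-U f S)
    (trans (cong (_+ U f S) (trans (U-cong r S) (U-⊙ l f S))) (sym (sucmul l (U f S))))

  Rk-D : ∀ l {f : Fun n} → Rk (+ 1 + l) f → Rk l (D f)
  Rk-D l {f} r S = +-cancelʳ (D f S) _ _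
    (trans (sym (rk-D f S)) (trans (D-cong r S) (trans (D-⊙ (+ 1 + l) f S) (sucmul l (D f S)))))

  Rk-⊕ : ∀ l {f g : Fun n} → Rk l f → Rk l g → Rk l (f ⊕ g)
  Rk-⊕ l {f} {g} p q S = trans (d (+ ∣ S ∣) (f S) (g S)) (trans (cong₂ _+_ (p S) (q S)) (sym (d l (f S) (g S))))
    where d : ∀ c a b → c * (a + b) ≡ c * a + c * b
          d = solve-∀

  Rk-⊙ : ∀ l c {f : Fun n} → Rk l f → Rk l (c ⊙ f)
  Rk-⊙ l c {f} p S = trans (d (+ ∣ S ∣) c (f S)) (trans (cong (c *_) (p S)) (sym (d l c (f S))))
    where d : ∀ s c a → s * (c * a) ≡ c * (s * a)
          d = solve-∀

  Rk-support : ∀ l {f : Fun n} → Rk (+ l) f → ∀ S → f S ≡ 0ℤ ⊎ ∣ S ∣ ≡ l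
  Rk-support l {f} r S with f S Data.Integer.≟ 0ℤ
  ... | yes z = inj₁ z
  ... | no nz = inj₂ (ℤ.+-injective (ℤ.*-cancelʳ-≡ (+ ∣ S ∣) (+ l) (f S) {{≢-nonZero nz}} (r S)))

  -- The two powers are nested in opposite order, so that `adjoint^` moves the outermost U to the
  -- innermost D.
  U^ D^ : ℕ → Fun n → Fun n
  U^ zero    f = f
  U^ (suc m) f = U (U^ m f)
  D^ zero    f = f
  D^ (suc m) f = D^ m (D f)

  U^-cong : ∀ m {f g : Fun n} → f ≈ g → U^ m f ≈ U^ m g
  U^-cong zero    e = e
  U^-cong (suc m) e = U-cong (U^-cong m e)

  U^-⊕ : ∀ m (f g : Fun n) → U^ m (f ⊕ g) ≈ U^ m f ⊕ U^ m g
  U^-⊕ zero    f g S = refl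
  U^-⊕ (suc m) f g S = trans (U-cong (U^-⊕ m f g) S) (U-⊕ (U^ m f) (U^ m g) S)

  U^-⊙ : ∀ m c (f : Fun n) → U^ m (c ⊙ f) ≈ c ⊙ U^ m f
  U^-⊙ zero    c f S = refl
  U^-⊙ (suc m) c f S = trans (U-cong (U^-⊙ m c f) S) (U-⊙ c (U^ m f) S)

  U^-suc : ∀ m (f : Fun n) → U^ m (U f) ≈ U (U^ m f)
  U^-suc zero    f S = refl
  U^-suc (suc m) f S = U-cong (U^-suc m f) S

  U^-𝟎 : ∀ m → U^ {n} m 𝟎 ≈ 𝟎
  U^-𝟎 zero    S = refl
  U^-𝟎 (suc m) S = trans (U-cong (U^-𝟎 m) S) (U-𝟎 S)

  D^-cong : ∀ m {f g : Fun n} → f ≈ g → D^ m f ≈ D^ m g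
  D^-cong zero    e = e
  D^-cong (suc m) e = D^-cong m (D-cong e)

  D^-⊕ : ∀ m (f g : Fun n) → D^ m (f ⊕ g) ≈ D^ m f ⊕ D^ m g
  D^-⊕ zero    f g S = refl
  D^-⊕ (suc m) f g S = trans (D^-cong m (D-⊕ f g) S) (D^-⊕ m (D f) (D g) S)

  D^-⊙ : ∀ m c (f : Fun n) → D^ m (c ⊙ f) ≈ c ⊙ D^ m f
  D^-⊙ zero    c f S = refl
  D^-⊙ (suc m) c f S = trans (D^-cong m (D-⊙ c f) S) (D^-⊙ m c (D f) S)

  Rk-U^ : ∀ m l {f : Fun n} → Rk (+ l) f → Rk (+ (m ℕ.+ l)) (U^ m f)
  Rk-U^ zero    l r = r
  Rk-U^ (suc m) l r = Rk-U (+ (m ℕ.+ l)) (Rk-U^ m l r)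

  Rk-D^ : ∀ m l {f : Fun n} → Rk (+ (m ℕ.+ l)) f → Rk (+ l) (D^ m f)
  Rk-D^ zero    l r = r
  Rk-D^ (suc m) l r = Rk-D^ m l (Rk-D (+ (m ℕ.+ l)) r)

  adjoint^ : ∀ m (f g : Fun n) → I (U^ m f) g ≡ I f (D^ m g)
  adjoint^ zero    f g = refl
  adjoint^ (suc m) f g = trans (adjoint (U^ m f) g) (adjoint^ m f (D g))

  DU-rank : ∀ i {f : Fun n} → Rk i f → D (U f) ≈ U (D f) ⊕ (+ n - + 2 * i) ⊙ f
  DU-rank {n} i {f} r S = trans (DU-UD f S) (cong (_+_ (U (D f) S))
    (trans (e (+ n) (+ ∣ S ∣) (f S)) (trans (cong (λ z → + n * f S - + 2 * z) (r S)) (sym (e (+ n) i (f S))))))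
    where e : ∀ n s x → (n - + 2 * s) * x ≡ n * x - + 2 * (s * x)
          e = solve-∀

  -- Harmonic functions

  Harmonic : Fun n → Set
  Harmonic h = D h ≈ 𝟎

  -- `D f` would have rank -1: by `rk-D` it is annihilated by |S| + 1.
  Rk0-harmonic : {f : Fun n} → Rk 0ℤ f → Harmonic f
  Rk0-harmonic {f = f} r S = ℤ.*-cancelˡ-≡ (+ suc ∣ S ∣) _ _
    (trans (sucmul (+ ∣ S ∣) (D f S))
    (trans (sym (rk-D f S)) (trans (D-cong r S) (trans (D-⊙ 0ℤ f S) (sym (ℤ.*-zeroʳ (+ suc ∣ S ∣)))))))

  I-ext : {f f′ g g′ : Fun n} → (∀ S → f S * g S ≡ f′ S * g′ S) → I f g ≡ I f′ g′
  I-ext {zero}  e = e []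
  I-ext {suc n} e = cong₂ _+_ (I-ext (λ S → e (false ∷ S))) (I-ext (λ S → e (true ∷ S)))

  I-𝟎 : (g : Fun n) → I 𝟎 g ≡ 0ℤ
  I-𝟎 {zero}  g = refl
  I-𝟎 {suc n} g = cong₂ _+_ (I-𝟎 (lo g)) (I-𝟎 (hi g))

  K-𝟎 : (g : Fun n) → K 𝟎 g ≡ 0ℤ
  K-𝟎 {zero}  g = refl
  K-𝟎 {suc n} g = cong₂ _+_ (cong₂ _+_ (K-𝟎 (lo g)) (K-𝟎 (hi g))) (K-𝟎 (lo g))

  -- Eigenvalues of the Kneser form

  Y-vanish : (f : Fun n) (R : Subset n) → (∀ S → ∣ R ∣ ℕ.≤ ∣ S ∣ → f S ≡ 0ℤ) → Y f R ≡ 0ℤ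
  Y-vanish f []          z = z [] ℕ.z≤n
  Y-vanish f (false ∷ R) z = cong₂ _+_ (Y-vanish (lo f) R (λ S → z (false ∷ S)))
                                       (Y-vanish (hi f) R (λ S → z (true ∷ S) ∘ ℕ.m≤n⇒m≤1+n))
  Y-vanish f (true ∷ R)  z = Y-vanish (hi f) R (λ S → z (true ∷ S) ∘ ℕ.s≤s)

  Y-top : (f : Fun n) (R : Subset n) → (∀ S → ∣ R ∣ ℕ.< ∣ S ∣ → f S ≡ 0ℤ) → Y f R ≡ f R
  Y-top f []          z = refl
  Y-top f (false ∷ R) z = trans (cong₂ _+_ (Y-top (lo f) R (λ S → z (false ∷ S)))
                                           (Y-vanish (hi f) R (λ S → z (true ∷ S) ∘ ℕ.s≤s)))
                                (ℤ.+-identityʳ _)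
  Y-top f (true ∷ R)  z = Y-top (hi f) R (λ S → z (true ∷ S) ∘ ℕ.s≤s)

  Y-rank : {g : Fun n} (R : Subset n) → Rk (+ ∣ R ∣) g → Y g R ≡ g R
  Y-rank {g = g} R r = Y-top g R λ S lt → case′ S lt (Rk-support ∣ R ∣ r S)
    where
    case′ : ∀ S → ∣ R ∣ ℕ.< ∣ S ∣ → g S ≡ 0ℤ ⊎ ∣ S ∣ ≡ ∣ R ∣ → g S ≡ 0ℤ
    case′ S lt (inj₁ z) = z
    case′ S lt (inj₂ e) = contradiction (sym e) (ℕ.<⇒≢ lt)

  -- Each S ⊇ R with m further points is reached from R by m! chains of one-point extensions.
  Y-D^ : ∀ m {g : Fun n} (R : Subset n) → Rk (+ (m ℕ.+ ∣ R ∣)) g → + (m !) * Y g R ≡ D^ m g R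
  Y-D^ zero    {g} R r = trans (ℤ.*-identityˡ _) (Y-rank R r)
  Y-D^ (suc m) {g} R r =
    trans (cong (_* Y g R) (ℤ.pos-* (suc m) (m !)))
    (trans (sw (+ suc m) (+ (m !)) (Y g R))
    (trans (cong (+ (m !) *_) step) (Y-D^ m R (Rk-D (+ (m ℕ.+ ∣ R ∣)) r))))
    where
    sw : ∀ a b c → a * b * c ≡ b * (a * c)
    sw = solve-∀
    sp : ∀ a b c → a * c + b * c ≡ (a + b) * c
    sp = solve-∀
    step : + suc m * Y g R ≡ Y (D g) R
    step = +-cancelʳ (+ ∣ R ∣ * Y g R) _ _
      (trans (sp (+ suc m) (+ ∣ R ∣) (Y g R))
      (trans (sym (Y-⊙ (+ (suc m ℕ.+ ∣ R ∣)) g R))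
      (trans (sym (Y-cong r R)) (Y-D g R))))

  Y-𝟎 : Y {n} 𝟎 ≈ 𝟎
  Y-𝟎 []          = refl
  Y-𝟎 (false ∷ S) = cong₂ _+_ (Y-𝟎 S) (Y-𝟎 S)
  Y-𝟎 (true ∷ S)  = Y-𝟎 S

  -- Since `Y (D h)` vanishes, `Y-D` shows that `Y h` has rank l too, and for |R| = l only S = R
  -- contributes to `Y h R`.
  Y-harmonic : ∀ l {h : Fun n} → Rk (+ l) h → Harmonic h → Y h ≈ h
  Y-harmonic l {h} r H R = go (Rk-support l r R) (Rk-support l rY R)
    where
    rY : Rk (+ l) (Y h)
    rY S = trans (sym (trans (Y-D h S) (trans (cong (_+ rk (Y h) S) (trans (Y-cong H S) (Y-𝟎 S))) (ℤ.+-identityˡ _))))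
                 (trans (Y-cong r S) (Y-⊙ (+ l) h S))
    go : h R ≡ 0ℤ ⊎ ∣ R ∣ ≡ l → Y h R ≡ 0ℤ ⊎ ∣ R ∣ ≡ l → Y h R ≡ h R
    go (inj₁ p)    (inj₁ q)    = trans q (sym p)
    go (inj₂ refl) _           = Y-rank R r
    go (inj₁ _)    (inj₂ refl) = Y-rank R r

  ε : ℕ → ℤ
  ε zero    = 1ℤ
  ε (suc l) = - ε l

  sg-ε : (f : Fun n) (S : Subset n) → sg f S ≡ ε ∣ S ∣ * f S
  sg-ε f []          = sym (ℤ.*-identityˡ _)
  sg-ε f (false ∷ S) = sg-ε (lo f) S
  sg-ε f (true ∷ S)  = trans (cong -_ (sg-ε (hi f) S)) (neg (ε ∣ S ∣) (hi f S))
    where neg : ∀ a b → - (a * b) ≡ (- a) * b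
          neg = solve-∀

  sg-rank : ∀ l {f : Fun n} → Rk (+ l) f → sg f ≈ ε l ⊙ f
  sg-rank l {f} r S with Rk-support l r S
  ... | inj₁ z    = trans (sg-ε f S) (trans (cong (ε ∣ S ∣ *_) z) (trans (ℤ.*-zeroʳ (ε ∣ S ∣))
                      (sym (trans (cong (ε l *_) z) (ℤ.*-zeroʳ (ε l))))))
  ... | inj₂ refl = sg-ε f S

  falling : ℤ → ℕ → ℤ
  falling x zero    = 1ℤ
  falling x (suc m) = x * falling (x - + 1) m

  K-U-rank : ∀ i j {f g : Fun n} → Rk i f → Rk j g → K (U f) g ≡ (+ n - i - j) * K f g
  K-U-rank {n} i j {f} {g} p q =
    trans (iso (K (U f) g) (K (rk f) g) (K f (rk g)))
    (trans (cong₂ _-_ (cong₂ _-_ (K-U f g) (trans (K-cong p (λ _ → refl)) (K-⊙ i f g)))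
                      (trans (K-cong (λ _ → refl) q) (K-⊙ʳ j f g)))
           (re (+ n) i j (K f g)))
    where
    iso : ∀ a b c → a ≡ (a + b + c) - b - c
    iso = solve-∀
    re : ∀ n i j x → n * x - i * x - j * x ≡ (n - i - j) * x
    re = solve-∀

  K-U^ : ∀ m i j {f g : Fun n} → Rk i f → Rk j g → K (U^ m f) g ≡ falling (+ n - i - j) m * K f g
  K-U^ zero    i j {f} {g} p q = sym (ℤ.*-identityˡ _)
  K-U^ {n} (suc m) i j {f} {g} p q =
    trans (K-cong (λ S → sym (U^-suc m f S)) (λ _ → refl))
    (trans (K-U^ m (+ 1 + i) j (Rk-U i p) q)
    (trans (cong₂ (λ x y → falling x m * y) (sh (+ n) i j) (K-U-rank i j p q))
           (re (falling (+ n - i - j - + 1) m) (+ n - i - j) (K f g))))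
    where
    sh : ∀ n i j → n - (+ 1 + i) - j ≡ n - i - j - + 1
    sh = solve-∀
    re : ∀ a b c → a * (b * c) ≡ b * a * c
    re = solve-∀

  -- In `K-Y` harmonicity leaves only the sets R of size l. There the sign is constant, and m! · Y g
  -- is `D^ m g`, which adjointness moves back onto h.
  K-harmonic : ∀ l m {h g : Fun n} → Rk (+ l) h → Harmonic h → Rk (+ (m ℕ.+ l)) g →
               + (m !) * K h g ≡ ε l * I (U^ m h) g
  K-harmonic l m {h} {g} r H rg =
    trans (cong (+ (m !) *_)
      (trans (K-Y h g)
      (trans (I-cong (λ S → trans (sg-ε (Y h) S) (trans (cong (ε ∣ S ∣ *_) (Y-harmonic l r H S))
                              (trans (sym (sg-ε h S)) (sg-rank l r S)))) (λ _ → refl))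
             (I-⊙ (ε l) h (Y g)))))
    (trans (sw (+ (m !)) (ε l) (I h (Y g)))
    (cong (ε l *_)
      (trans (sym (I-⊙ʳ (+ (m !)) h (Y g)))
      (trans (I-ext supp) (sym (adjoint^ m h g))))))
    where
    sw : ∀ a b c → a * (b * c) ≡ b * (a * c)
    sw = solve-∀
    supp : ∀ S → h S * (+ (m !) * Y g S) ≡ h S * D^ m g S
    supp S with Rk-support l r S
    ... | inj₁ z    = trans (cong (_* (+ (m !) * Y g S)) z) (sym (cong (_* D^ m g S) z))
    ... | inj₂ refl = cong (h S *_) (Y-D^ m S rg)

  -- After division by m! this is the Kneser eigenvalue (-1)^l C(n-k-l, k-l) with k = m + l. The
  -- eigenvector equation is stated weakly, against an arbitrary g of rank k.
  eigen : ∀ l m {h g : Fun n} → Rk (+ l) h → Harmonic h → Rk (+ (m ℕ.+ l)) g →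
          + (m !) * K (U^ m h) g ≡ ε l * falling (+ n - + l - + (m ℕ.+ l)) m * I (U^ m h) g
  eigen {n} l m {h} {g} r H rg =
    trans (cong (+ (m !) *_) (K-U^ m (+ l) (+ (m ℕ.+ l)) r rg))
    (trans (sw (+ (m !)) F (K h g))
    (trans (cong (F *_) (K-harmonic l m r H rg)) (sw₂ F (ε l) (I (U^ m h) g))))
    where
    F = falling (+ n - + l - + (m ℕ.+ l)) m
    sw : ∀ a b c → a * (b * c) ≡ b * (a * c)
    sw = solve-∀
    sw₂ : ∀ a b c → a * (b * c) ≡ b * a * c
    sw₂ = solve-∀

  -- Norms and orthogonality of the levels

  DU^ : ∀ l m {h : Fun n} → Rk (+ l) h → Harmonic h →
        D (U^ (suc m) h) ≈ (+ suc m * (+ n - + 2 * + l - + m)) ⊙ U^ m h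
  DU^ {n} l zero {h} r H S =
    trans (DU-rank (+ l) r S) (trans (cong (_+ (+ n - + 2 * + l) * h S) (trans (U-cong H S) (U-𝟎 S)))
          (re (+ n - + 2 * + l) (h S)))
    where re : ∀ x y → + 0 + x * y ≡ + 1 * (x - + 0) * y
          re = solve-∀
  DU^ {n} l (suc m) {h} r H S =
    trans (DU-rank (+ suc (m ℕ.+ l)) (Rk-U^ (suc m) l r) S)
    (trans (cong (_+ (+ n - + 2 * + suc (m ℕ.+ l)) * U^ (suc m) h S)
             (trans (U-cong (DU^ l m r H) S) (U-⊙ (+ suc m * (+ n - + 2 * + l - + m)) (U^ m h) S)))
           (re (+ n) (+ l) (+ m) (U^ (suc m) h S)))
    where re : ∀ n l m x → (+ 1 + m) * (n - + 2 * l - m) * x + (n - + 2 * (+ 1 + (m + l))) * x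
                         ≡ (+ 1 + (+ 1 + m)) * (n - + 2 * l - (+ 1 + m)) * x
          re = solve-∀

  -- The ratio I (U^ m h) (U^ m h) / I h h for harmonic h of rank l.
  normFactor : ℕ → ℕ → ℕ → ℤ
  normFactor n l zero    = 1ℤ
  normFactor n l (suc m) = + suc m * (+ n - + 2 * + l - + m) * normFactor n l m

  -- The m operators U on r are moved over as D, where `DU^` turns each into a scalar. The factor
  -- `normFactor n l j` stands in place of a quotient.
  level-shift : ∀ l j m {h r : Fun n} → Rk (+ l) h → Harmonic h →
                normFactor n l j * I (U^ (m ℕ.+ j) h) (U^ m r) ≡ normFactor n l (m ℕ.+ j) * I (U^ j h) r
  level-shift l j zero    r H = refl
  level-shift {n} l j (suc m) {h} {r} rh H =
    trans (cong (normFactor n l j *_)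
      (trans (I-comm _ (U (U^ m r))) (trans (adjoint (U^ m r) (U^ (suc m ℕ.+ j) h))
      (trans (I-cong (λ _ → refl) (DU^ l (m ℕ.+ j) rh H))
      (trans (I-⊙ʳ c (U^ m r) (U^ (m ℕ.+ j) h)) (cong (c *_) (I-comm (U^ m r) _)))))))
    (trans (sw (normFactor n l j) c (I (U^ (m ℕ.+ j) h) (U^ m r)))
    (trans (cong (c *_) (level-shift l j m rh H)) (sym (ℤ.*-assoc c _ _))))
    where
    c = + suc (m ℕ.+ j) * (+ n - + 2 * + l - + (m ℕ.+ j))
    sw : ∀ a b c → a * (b * c) ≡ b * (a * c)
    sw = solve-∀

  -- After m adjunctions h itself faces `U r`, and D h = 0. Hence a level is orthogonal to
  -- everything raised from smaller ranks.
  level-orthogonal : ∀ l m {h r : Fun n} → Rk (+ l) h → Harmonic h → I (U^ m h) (U^ (suc m) r) ≡ 0ℤ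
  level-orthogonal l zero {h} {r} rh H =
    trans (I-comm h (U r)) (trans (adjoint r h) (trans (I-cong (λ _ → refl) H) (trans (I-comm r 𝟎) (I-𝟎 r))))
  level-orthogonal {n} l (suc m) {h} {r} rh H =
    trans (I-comm _ (U (U^ (suc m) r)))
    (trans (adjoint (U^ (suc m) r) (U^ (suc m) h))
    (trans (I-cong (λ _ → refl) (DU^ l m rh H))
    (trans (I-⊙ʳ c (U^ (suc m) r) (U^ m h))
    (trans (cong (c *_) (trans (I-comm _ (U^ m h)) (level-orthogonal l m rh H))) (ℤ.*-zeroʳ c)))))
    where c = + suc m * (+ n - + 2 * + l - + m)

  -- Nonnegativity of a form away from levels 0 and 1

  *-pos : ∀ {i j} → 0ℤ < i → 0ℤ < j → 0ℤ < i * j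
  *-pos {i} {j} p q = subst (_< i * j) (ℤ.*-zeroʳ i) (ℤ.*-monoˡ-<-pos i {{positive p}} q)

  *-nonneg : ∀ {i j} → 0ℤ ≤ i → 0ℤ ≤ j → 0ℤ ≤ i * j
  *-nonneg {i} {j} p q = subst (_≤ i * j) (ℤ.*-zeroʳ i) (ℤ.*-monoˡ-≤-nonNeg i {{nonNegative p}} q)

  cancel-pos : ∀ {i j} → 0ℤ < i → 0ℤ ≤ i * j → 0ℤ ≤ j
  cancel-pos {i} {j} p q = ℤ.*-cancelˡ-≤-pos 0ℤ j i {{positive p}} (subst (_≤ i * j) (sym (ℤ.*-zeroʳ i)) q)

  square-nonneg : ∀ i → 0ℤ ≤ i * i
  square-nonneg (+ n) = *-nonneg {+ n} (+≤+ ℕ.z≤n) (+≤+ ℕ.z≤n)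
  square-nonneg -[1+ n ] = +≤+ ℕ.z≤n

  diff-pos : ∀ {i j} → i < j → 0ℤ < j - i
  diff-pos {i} {j} p = subst (_< j - i) (ℤ.+-inverseʳ i) (ℤ.+-monoˡ-< (- i) p)

  I-nonneg : (f : Fun n) → 0ℤ ≤ I f f
  I-nonneg {zero}  f = square-nonneg (f [])
  I-nonneg {suc n} f = ℤ.+-mono-≤ (I-nonneg (lo f)) (I-nonneg (hi f))

  -- The hypothesis says that the lowest levels are absent from θ, and U preserves levels. The rank
  -- is an integer because the recursion lowers it without looking at its sign.
  DU-vanish : ∀ i r {θ : Fun n} → Rk r θ → D^ i θ ≈ 𝟎 → D^ (suc i) (U θ) ≈ 𝟎
  DU-vanish zero    r {θ} rθ z S = trans (D-cong (λ T → trans (U-cong z T) (U-𝟎 T)) S) (D-𝟎 S)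
  DU-vanish {n} (suc i) r {θ} rθ z S =
    trans (D^-cong (suc i) (DU-rank r rθ) S)
    (trans (D^-⊕ (suc i) (U (D θ)) (c ⊙ θ) S)
    (trans (cong₂ _+_ (DU-vanish i (- + 1 + r) (Rk-D (- + 1 + r) (subst (λ x → Rk x θ) (shift r) rθ)) z S)
                      (trans (D^-⊙ (suc i) c θ S) (cong (c *_) (z S))))
           (trans (ℤ.+-identityˡ _) (ℤ.*-zeroʳ c))))
    where
    c = + n - + 2 * r
    shift : ∀ r → r ≡ + 1 + (- + 1 + r)
    shift = solve-∀

  -- If θ solves the equation for D χ one rank lower (with a + n − 2j), then ψ = c χ − U θ solves it for χ.
  Solution : ℕ → ℤ → Fun n → Set
  Solution {n} j a χ = Σ[ c ∈ ℤ ] Σ[ ψ ∈ Fun n ] 0ℤ < c × Rk (+ j) ψ ×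
    (∀ S → U (D ψ) S + a * ψ S ≡ c * χ S) × (∀ i → D^ i χ ≈ 𝟎 → D^ i ψ ≈ 𝟎)

  -- Inverts the positive operator UD + a up to the factor c. The bound on j keeps the shifted
  -- constant of the next lower rank positive; the vanishing clause lets ψ inherit the absence of
  -- low levels from χ.
  solveUD : ∀ j → 2 ℕ.* j ℕ.≤ suc n → ∀ a → 0ℤ < a → (χ : Fun n) → Rk (+ j) χ → Solution j a χ
  solveUD zero _ a a>0 χ rχ =
    a , χ , a>0 , rχ ,
    (λ S → trans (cong (_+ a * χ S) (trans (U-cong (Rk0-harmonic rχ) S) (U-𝟎 S))) (ℤ.+-identityˡ _)) ,
    (λ i z → z)
  solveUD {n} (suc j) le a a>0 χ rχ =
    lift (solveUD j (ℕ.≤-trans (ℕ.*-monoʳ-≤ 2 (ℕ.n≤1+n j)) le) a′ a′>0 (D χ) (Rk-D (+ j) rχ))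
    where
    a′ = a + (+ n - + 2 * + j)
    le′ : 2 ℕ.* j ℕ.≤ n
    le′ = ℕ.≤-trans (ℕ.m≤n+m (2 ℕ.* j) 1) (ℕ.≤-pred (subst (ℕ._≤ suc n) (ℕ.*-suc 2 j) le))
    a′>0 : 0ℤ < a + (+ n - + 2 * + j)
    a′>0 = ℤ.+-mono-<-≤ a>0 (ℤ.i≤j⇒0≤j-i (subst (_≤ + n) (ℤ.pos-* 2 j) (+≤+ le′)))
    lift : Solution j a′ (D χ) → Solution (suc j) a χ
    lift (c , θ , c>0 , rθ , eq , van) =
      a * c , ψ , *-pos a>0 c>0 , rψ , main , vanish
      where
      ψ : Fun n
      ψ = c ⊙ χ ⊕ (- + 1) ⊙ U θ
      rψ : Rk (+ suc j) ψ
      rψ = Rk-⊕ (+ suc j) (Rk-⊙ (+ suc j) c rχ) (Rk-⊙ (+ suc j) (- + 1) (Rk-U (+ j) rθ))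
      UDUθ : ∀ S → U (D (U θ)) S ≡ U (U (D θ)) S + (+ n - + 2 * + j) * U θ S
      UDUθ S = trans (U-cong (DU-rank (+ j) rθ) S) (trans (U-⊕ (U (D θ)) _ S) (cong (_+_ (U (U (D θ)) S)) (U-⊙ (+ n - + 2 * + j) θ S)))
      Ueq : ∀ S → U (U (D θ)) S + a′ * U θ S ≡ c * U (D χ) S
      Ueq S = trans (cong (_+_ (U (U (D θ)) S)) (sym (U-⊙ a′ θ S)))
              (trans (sym (U-⊕ (U (D θ)) (a′ ⊙ θ) S)) (trans (U-cong eq S) (U-⊙ c (D χ) S)))
      UDψ : ∀ S → U (D ψ) S ≡ c * U (D χ) S + (- + 1) * U (D (U θ)) S
      UDψ S = trans (U-cong (λ T → trans (D-⊕ (c ⊙ χ) _ T) (cong₂ _+_ (D-⊙ c χ T) (D-⊙ (- + 1) (U θ) T))) S)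
              (trans (U-⊕ (c ⊙ D χ) ((- + 1) ⊙ D (U θ)) S) (cong₂ _+_ (U-⊙ c (D χ) S) (U-⊙ (- + 1) (D (U θ)) S)))
      main : ∀ S → U (D ψ) S + a * ψ S ≡ a * c * χ S
      main S = trans (cong (_+ a * ψ S) (trans (UDψ S) (cong₂ (λ x y → x + (- + 1) * y) (sym (Ueq S)) (UDUθ S))))
               (re (U (U (D θ)) S) a (+ n - + 2 * + j) (U θ S) c (χ S))
        where re : ∀ u a b t c x → (u + (a + b) * t) + (- + 1) * (u + b * t) + a * (c * x + (- + 1) * t) ≡ a * c * x
              re = solve-∀
      combine : ∀ i → D^ i χ ≈ 𝟎 → D^ i (U θ) ≈ 𝟎 → D^ i ψ ≈ 𝟎
      combine i z w S = trans (D^-⊕ i (c ⊙ χ) _ S)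
        (trans (cong₂ _+_ (trans (D^-⊙ i c χ S) (cong (c *_) (z S))) (trans (D^-⊙ i (- + 1) (U θ) S) (cong ((- + 1) *_) (w S))))
               (re c))
        where re : ∀ c → c * + 0 + (- + 1) * + 0 ≡ + 0
              re = solve-∀
      vanish : ∀ i → D^ i χ ≈ 𝟎 → D^ i ψ ≈ 𝟎
      vanish zero    z = combine zero z (λ S → trans (U-cong (van zero (λ T → trans (D-cong z T) (D-𝟎 T))) S) (U-𝟎 S))
      vanish (suc i) z = combine (suc i) z (DU-vanish i (+ j) rθ (van i z))

  -- `ev` concerns m! times the eigenvalue of A K + B I on level l + 2, for every level from 2 to k.
  module Positivity (k : ℕ) (2k≤n : 2 ℕ.* k ℕ.≤ n) (A B : ℤ)
    (ev : ∀ l m → m ℕ.+ suc (suc l) ≡ k →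
          0ℤ ≤ A * (ε (suc (suc l)) * falling (+ n - + suc (suc l) - + k) m) + B * + (m !)) where

    Q : Fun n → Fun n → ℤ
    Q f g = A * K f g + B * I f g

    Q-cong : ∀ {f f′ g g′} → f ≈ f′ → g ≈ g′ → Q f g ≡ Q f′ g′
    Q-cong p q = cong₂ (λ x y → A * x + B * y) (K-cong p q) (I-cong p q)

    Q-comm : ∀ f g → Q f g ≡ Q g f
    Q-comm f g = cong₂ (λ x y → A * x + B * y) (K-comm f g) (I-comm f g)

    Q-⊕ : ∀ f g h → Q (f ⊕ g) h ≡ Q f h + Q g h
    Q-⊕ f g h = trans (cong₂ (λ x y → A * x + B * y) (K-⊕ f g h) (I-⊕ f g h))
                      (re A B (K f h) (K g h) (I f h) (I g h))
      where re : ∀ a b x y z w → a * (x + y) + b * (z + w) ≡ (a * x + b * z) + (a * y + b * w)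
            re = solve-∀

    Q-⊙ : ∀ c f h → Q (c ⊙ f) h ≡ c * Q f h
    Q-⊙ c f h = trans (cong₂ (λ x y → A * x + B * y) (K-⊙ c f h) (I-⊙ c f h)) (re A B c (K f h) (I f h))
      where re : ∀ a b c x y → a * (c * x) + b * (c * y) ≡ c * (a * x + b * y)
            re = solve-∀

    Q-⊕ʳ : ∀ f g h → Q f (g ⊕ h) ≡ Q f g + Q f h
    Q-⊕ʳ f g h = trans (Q-comm f _) (trans (Q-⊕ g h f) (cong₂ _+_ (Q-comm g f) (Q-comm h f)))

    Q-⊙ʳ : ∀ c f h → Q f (c ⊙ h) ≡ c * Q f h
    Q-⊙ʳ c f h = trans (Q-comm f _) (trans (Q-⊙ c h f) (cong (c *_) (Q-comm h f)))

    Q-eigen : ∀ l m {h g} → m ℕ.+ l ≡ k → Rk (+ l) h → Harmonic h → Rk (+ k) g →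
              + (m !) * Q (U^ m h) g ≡ (A * (ε l * falling (+ n - + l - + k) m) + B * + (m !)) * I (U^ m h) g
    Q-eigen l m {h} {g} refl r H rg =
      trans (d (+ (m !)) A B (K (U^ m h) g) (I (U^ m h) g))
      (trans (cong (λ x → A * x + B * + (m !) * I (U^ m h) g) (eigen l m r H rg))
             (d₂ A B (ε l * falling (+ n - + l - + k) m) (+ (m !)) (I (U^ m h) g)))
      where
      d : ∀ c a b x y → c * (a * x + b * y) ≡ a * (c * x) + b * c * y
      d = solve-∀
      d₂ : ∀ a b e c y → a * (e * y) + b * c * y ≡ (a * e + b * c) * y
      d₂ = solve-∀

    m!>0 : ∀ m → 0ℤ < + (m !)
    m!>0 m = +<+ (ℕ.>-nonZero⁻¹ (m !) {{m ℕ.!≢0}})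

    -- `D^ l φ` has rank 1, and its vanishing says that φ has no part in levels 0 and 1. The
    -- induction splits off the top level: solving UD + (n - 2j) for `D φ`, where j is its rank,
    -- gives ψ with D (U ψ) = c · D φ, so h = c φ - U ψ is harmonic. Its contribution is nonnegative
    -- by `ev`, that of ψ by induction.
    Q-nonneg : ∀ l m → m ℕ.+ suc l ≡ k → (φ : Fun n) → Rk (+ suc l) φ → D^ l φ ≈ 𝟎 →
               0ℤ ≤ Q (U^ m φ) (U^ m φ)
    Q-nonneg zero m e φ r z = ℤ.≤-reflexive (sym
      (trans (Q-cong (λ S → trans (U^-cong m z S) (U^-𝟎 m S)) (λ _ → refl))
             (trans (cong₂ (λ x y → A * x + B * y) (K-𝟎 (U^ m φ)) (I-𝟎 (U^ m φ))) (re A B))))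
      where re : ∀ a b → a * + 0 + b * + 0 ≡ + 0
            re = solve-∀
    Q-nonneg (suc l) m e φ r z =
      split (solveUD (suc l) le₁ (+ n - + 2 * + suc l) pos (D φ) (Rk-D (+ suc l) r))
      where
      le₂ : 2 ℕ.* suc (suc l) ℕ.≤ n
      le₂ = ℕ.≤-trans (ℕ.*-monoʳ-≤ 2 (subst (suc (suc l) ℕ.≤_) e (ℕ.m≤n+m _ m))) 2k≤n
      lt : suc (2 ℕ.* suc l) ℕ.≤ n
      lt = ℕ.≤-trans (ℕ.n≤1+n _) (subst (ℕ._≤ n) (ℕ.*-suc 2 (suc l)) le₂)
      le₁ : 2 ℕ.* suc l ℕ.≤ suc n
      le₁ = ℕ.≤-trans (ℕ.n≤1+n _) (ℕ.m≤n⇒m≤1+n lt)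
      pos : 0ℤ < + n - + 2 * + suc l
      pos = subst (λ x → 0ℤ < + n - x) (ℤ.pos-* 2 (suc l)) (diff-pos (+<+ lt))
      split : Solution (suc l) (+ n - + 2 * + suc l) (D φ) → 0ℤ ≤ Q (U^ m φ) (U^ m φ)
      split (c , ψ , c>0 , rψ , eq , van) = cancel-pos {c * c} (*-pos c>0 c>0)
          (subst (0ℤ ≤_) total
            (ℤ.+-mono-≤ (Q-nonneg l (suc m) (trans (sym (ℕ.+-suc m (suc l))) e) ψ rψ (van l z)) Qhh))
        where
        h : Fun n
        h = c ⊙ φ ⊕ (- + 1) ⊙ U ψ
        rh : Rk (+ suc (suc l)) h
        rh = Rk-⊕ (+ suc (suc l)) (Rk-⊙ (+ suc (suc l)) c r) (Rk-⊙ (+ suc (suc l)) (- + 1) (Rk-U (+ suc l) rψ))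
        H : Harmonic h
        H S = trans (D-⊕ (c ⊙ φ) _ S) (trans (cong₂ _+_ (trans (D-⊙ c φ S) (sym (eq S)))
                (trans (D-⊙ (- + 1) (U ψ) S) (cong ((- + 1) *_) (DU-rank (+ suc l) rψ S))))
                (re (U (D ψ) S + (+ n - + 2 * + suc l) * ψ S)))
          where re : ∀ x → x + (- + 1) * x ≡ + 0
                re = solve-∀
        p q x : Fun n
        p = U^ (suc m) ψ
        q = U^ m h
        x = U^ m φ
        x≈ : c ⊙ x ≈ p ⊕ q
        x≈ S = trans (re (c * x S) (p S)) (cong (_+_ (p S)) (sym
                 (trans (U^-⊕ m (c ⊙ φ) _ S) (cong₂ _+_ (U^-⊙ m c φ S) (trans (U^-⊙ m (- + 1) (U ψ) S)
                    (cong ((- + 1) *_) (U^-suc m ψ S)))))))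
          where re : ∀ a b → a ≡ b + (a + (- + 1) * b)
                re = solve-∀
        rx : ∀ {f} → Rk (+ (m ℕ.+ suc (suc l))) f → Rk (+ k) f
        rx {f} = subst (λ j → Rk (+ j) f) e
        rq : Rk (+ k) q
        rq = rx (Rk-U^ m (suc (suc l)) rh)
        rp : Rk (+ k) p
        rp = subst (λ j → Rk (+ j) p) (trans (sym (ℕ.+-suc m (suc l))) e) (Rk-U^ (suc m) (suc l) rψ)
        λ′ = A * (ε (suc (suc l)) * falling (+ n - + suc (suc l) - + k) m) + B * + (m !)
        -- No mixed term: q lies in the single level l + 2, p in lower ones.
        Qqp : Q q p ≡ 0ℤ
        Qqp = ℤ.*-cancelˡ-≡ (+ (m !)) _ _ {{>-nonZero (m!>0 m)}}
                (trans (Q-eigen (suc (suc l)) m e rh H rp)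
                (trans (cong (λ′ *_) (level-orthogonal (suc (suc l)) m rh H))
                (trans (ℤ.*-zeroʳ λ′) (sym (ℤ.*-zeroʳ (+ (m !)))))))
        Qhh : 0ℤ ≤ Q q q
        Qhh = cancel-pos (m!>0 m) (subst (0ℤ ≤_) (sym (Q-eigen (suc (suc l)) m e rh H rq))
                (*-nonneg (ev l m e) (I-nonneg q)))
        total : Q p p + Q q q ≡ c * c * Q x x
        total = trans (re₁ (Q p p) (Q q q))
          (trans (cong₂ (λ y z → Q p p + y + (z + Q q q)) (trans (sym Qqp) (Q-comm q p)) (sym Qqp))
          (trans (sym (trans (Q-⊕ p q (p ⊕ q)) (cong₂ _+_ (Q-⊕ʳ p p q) (Q-⊕ʳ q p q))))
          (trans (sym (Q-cong x≈ x≈)) (trans (Q-⊙ c x (c ⊙ x)) (trans (cong (c *_) (Q-⊙ʳ c x x)) (sym (ℤ.*-assoc c c _)))))))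
          where re₁ : ∀ a b → a + b ≡ a + + 0 + (+ 0 + b)
                re₁ = solve-∀

  -- Symmetric polynomials of a weight on the points

  ∑ : (Fin n → ℤ) → ℤ
  ∑ {zero}  v = 0ℤ
  ∑ {suc n} v = v zero + ∑ (v ∘ suc)

  infixl 7 _·_
  _·_ : {A : Set} → (A → ℤ) → (A → ℤ) → A → ℤ
  (u · v) i = u i * v i

  -- The power sum and the second elementary symmetric polynomial of the weights in S. As functions
  -- on all subsets they admit uniform formulas for U and D; `at` cuts them down to one rank.
  p1 e2 : (Fin n → ℤ) → Fun n
  p1 w []          = 0ℤ
  p1 w (false ∷ S) = p1 (w ∘ suc) S
  p1 w (true ∷ S)  = w zero + p1 (w ∘ suc) S
  e2 w []          = 0ℤ
  e2 w (false ∷ S) = e2 (w ∘ suc) S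
  e2 w (true ∷ S)  = e2 (w ∘ suc) S + w zero * p1 (w ∘ suc) S

  𝟏 : Fun n
  𝟏 _ = 1ℤ

  δ : ℕ → ℕ → ℤ
  δ zero    zero    = 1ℤ
  δ zero    (suc t) = 0ℤ
  δ (suc k) zero    = 0ℤ
  δ (suc k) (suc t) = δ k t

  at : ℕ → Fun n → Fun n
  at k P S = δ k ∣ S ∣ * P S

  δ-dichotomy : ∀ k t → δ k t ≡ 0ℤ ⊎ t ≡ k
  δ-dichotomy zero    zero    = inj₂ refl
  δ-dichotomy zero    (suc t) = inj₁ refl
  δ-dichotomy (suc k) zero    = inj₁ refl
  δ-dichotomy (suc k) (suc t) with δ-dichotomy k t
  ... | inj₁ z = inj₁ z
  ... | inj₂ e = inj₂ (cong suc e)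

  δ-refl : ∀ k → δ k k ≡ 1ℤ
  δ-refl zero    = refl
  δ-refl (suc k) = δ-refl k

  at-cong : ∀ k {P P′ : Fun n} → (∀ S → ∣ S ∣ ≡ k → P S ≡ P′ S) → at k P ≈ at k P′
  at-cong k {P} {P′} e S with δ-dichotomy k ∣ S ∣
  ... | inj₁ z = trans (cong (_* P S) z) (sym (cong (_* P′ S) z))
  ... | inj₂ q = cong (δ k ∣ S ∣ *_) (e S q)

  at-value : ∀ k (P : Fun n) S → ∣ S ∣ ≡ k → at k P S ≡ P S
  at-value k P S refl = trans (cong (_* P S) (δ-refl ∣ S ∣)) (ℤ.*-identityˡ _)

  Rk-at : ∀ k (P : Fun n) → Rk (+ k) (at k P)
  Rk-at k P S with δ-dichotomy k ∣ S ∣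
  ... | inj₁ z = trans (cong (λ x → + ∣ S ∣ * (x * P S)) z) (trans (re (+ ∣ S ∣) (+ k) (P S)) (sym (cong (λ x → + k * (x * P S)) z)))
    where re : ∀ a b p → a * (+ 0 * p) ≡ b * (+ 0 * p)
          re = solve-∀
  ... | inj₂ refl = refl

  at-⊕ : ∀ k (P R : Fun n) → at k (P ⊕ R) ≈ at k P ⊕ at k R
  at-⊕ k P R S = ℤ.*-distribˡ-+ (δ k ∣ S ∣) (P S) (R S)

  at-⊙ : ∀ k c (P : Fun n) → at k (c ⊙ P) ≈ c ⊙ at k P
  at-⊙ k c P S = re (δ k ∣ S ∣) c (P S)
    where re : ∀ d c p → d * (c * p) ≡ c * (d * p)
          re = solve-∀

  private
    dist : ∀ c a b → c * a + c * b ≡ c * (a + b)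
    dist = solve-∀

  U-weight : (c : ℕ → ℤ) (P : Fun n) (S : Subset n) → U (λ T → c (suc ∣ T ∣) * P T) S ≡ c ∣ S ∣ * U P S
  U-weight c P []          = sym (ℤ.*-zeroʳ (c 0))
  U-weight c P (false ∷ S) = U-weight c (lo P) S
  U-weight c P (true ∷ S)  = trans (cong (_+ c (suc ∣ S ∣) * lo P S) (U-weight (c ∘ suc) (hi P) S))
                                   (dist (c (suc ∣ S ∣)) (U (hi P) S) (lo P S))

  D-weight : (c : ℕ → ℤ) (P : Fun n) (S : Subset n) → D (λ T → c ∣ T ∣ * P T) S ≡ c (suc ∣ S ∣) * D P S
  D-weight c P []          = sym (ℤ.*-zeroʳ (c 1))
  D-weight c P (false ∷ S) = trans (cong (_+ c (suc ∣ S ∣) * hi P S) (D-weight c (lo P) S))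
                                   (dist (c (suc ∣ S ∣)) (D (lo P) S) (hi P S))
  D-weight c P (true ∷ S)  = D-weight (c ∘ suc) (hi P) S

  U-at : ∀ k (P : Fun n) → U (at k P) ≈ at (suc k) (U P)
  U-at k P = U-weight (δ (suc k)) P

  D-at : ∀ k (P : Fun n) → D (at (suc k) P) ≈ at k (D P)
  D-at k P = D-weight (δ (suc k)) P

  U-𝟏 : (S : Subset n) → U 𝟏 S ≡ + ∣ S ∣
  U-𝟏 []          = refl
  U-𝟏 (false ∷ S) = U-𝟏 S
  U-𝟏 (true ∷ S)  = trans (cong (_+ 1ℤ) (U-𝟏 S)) (ℤ.+-comm (+ ∣ S ∣) 1ℤ)

  D-𝟏 : (S : Subset n) → D 𝟏 S ≡ + n - + ∣ S ∣
  D-𝟏 []          = refl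
  D-𝟏 {suc n} (false ∷ S) = trans (cong (_+ 1ℤ) (D-𝟏 S)) (re (+ n) (+ ∣ S ∣))
    where re : ∀ n s → n - s + + 1 ≡ (+ 1 + n) - s
          re = solve-∀
  D-𝟏 {suc n} (true ∷ S) = trans (D-𝟏 S) (re (+ n) (+ ∣ S ∣))
    where re : ∀ n s → n - s ≡ (+ 1 + n) - (+ 1 + s)
          re = solve-∀

  private
    const-split : ∀ c (S : Subset n) → c ≡ (c ⊙ 𝟏) S
    const-split c S = sym (ℤ.*-identityʳ c)

  U-p1 : (w : Fin n → ℤ) (S : Subset n) → U (p1 w) S ≡ (+ ∣ S ∣ - + 1) * p1 w S
  U-p1 w []          = refl
  U-p1 w (false ∷ S) = U-p1 (w ∘ suc) S
  U-p1 w (true ∷ S)  =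
    trans (cong (_+ p1 w′ S)
      (trans (U-cong (λ T → cong (_+ p1 w′ T) (const-split (w zero) T)) S)
      (trans (U-⊕ (w zero ⊙ 𝟏) (p1 w′) S)
             (cong₂ _+_ (trans (U-⊙ (w zero) 𝟏 S) (cong (w zero *_) (U-𝟏 S))) (U-p1 w′ S)))))
    (re (w zero) (+ ∣ S ∣) (p1 w′ S))
    where
    w′ = w ∘ suc
    re : ∀ w s p → (w * s + (s - + 1) * p) + p ≡ ((+ 1 + s) - + 1) * (w + p)
    re = solve-∀

  D-p1 : (w : Fin n → ℤ) (S : Subset n) → D (p1 w) S ≡ (+ n - + ∣ S ∣) * p1 w S + (∑ w - p1 w S)
  D-p1 w []          = refl
  D-p1 {suc n} w (false ∷ S) = trans (cong (_+ (w zero + p1 w′ S)) (D-p1 w′ S))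
                                     (re (+ n) (+ ∣ S ∣) (p1 w′ S) (w zero) (∑ w′))
    where
    w′ = w ∘ suc
    re : ∀ n s p w W → ((n - s) * p + (W - p)) + (w + p) ≡ ((+ 1 + n) - s) * p + ((w + W) - p)
    re = solve-∀
  D-p1 {suc n} w (true ∷ S)  =
    trans (D-cong (λ T → cong (_+ p1 w′ T) (const-split (w zero) T)) S)
    (trans (D-⊕ (w zero ⊙ 𝟏) (p1 w′) S)
    (trans (cong₂ _+_ (trans (D-⊙ (w zero) 𝟏 S) (cong (w zero *_) (D-𝟏 S))) (D-p1 w′ S))
           (re (+ n) (+ ∣ S ∣) (p1 w′ S) (w zero) (∑ w′))))
    where
    w′ = w ∘ suc
    re : ∀ n s p w W → w * (n - s) + ((n - s) * p + (W - p)) ≡ ((+ 1 + n) - (+ 1 + s)) * (w + p) + ((w + W) - (w + p))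
    re = solve-∀

  U-e2 : (w : Fin n → ℤ) (S : Subset n) → U (e2 w) S ≡ (+ ∣ S ∣ - + 2) * e2 w S
  U-e2 w []          = refl
  U-e2 w (false ∷ S) = U-e2 (w ∘ suc) S
  U-e2 w (true ∷ S)  =
    trans (cong (_+ e2 w′ S)
      (trans (U-⊕ (e2 w′) (w zero ⊙ p1 w′) S)
             (cong₂ _+_ (U-e2 w′ S) (trans (U-⊙ (w zero) (p1 w′) S) (cong (w zero *_) (U-p1 w′ S))))))
    (re (w zero) (+ ∣ S ∣) (p1 w′ S) (e2 w′ S))
    where
    w′ = w ∘ suc
    re : ∀ w s p e → ((s - + 2) * e + w * ((s - + 1) * p)) + e ≡ ((+ 1 + s) - + 2) * (e + w * p)
    re = solve-∀

  D-e2 : (w : Fin n → ℤ) (S : Subset n) → D (e2 w) S ≡ (+ n - + ∣ S ∣) * e2 w S + p1 w S * (∑ w - p1 w S)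
  D-e2 w []          = refl
  D-e2 {suc n} w (false ∷ S) = trans (cong (_+ (e2 w′ S + w zero * p1 w′ S)) (D-e2 w′ S))
                                     (re (+ n) (+ ∣ S ∣) (p1 w′ S) (e2 w′ S) (w zero) (∑ w′))
    where
    w′ = w ∘ suc
    re : ∀ n s p e w W → ((n - s) * e + p * (W - p)) + (e + w * p) ≡ ((+ 1 + n) - s) * e + p * ((w + W) - p)
    re = solve-∀
  D-e2 {suc n} w (true ∷ S)  =
    trans (D-⊕ (e2 w′) (w zero ⊙ p1 w′) S)
    (trans (cong₂ _+_ (D-e2 w′ S) (trans (D-⊙ (w zero) (p1 w′) S) (cong (w zero *_) (D-p1 w′ S))))
           (re (+ n) (+ ∣ S ∣) (p1 w′ S) (e2 w′ S) (w zero) (∑ w′)))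
    where
    w′ = w ∘ suc
    re : ∀ n s p e w W → ((n - s) * e + p * (W - p)) + w * ((n - s) * p + (W - p))
       ≡ ((+ 1 + n) - (+ 1 + s)) * (e + w * p) + (w + p) * ((w + W) - (w + p))
    re = solve-∀

  p1² : (w : Fin n → ℤ) (S : Subset n) → p1 w S * p1 w S ≡ + 2 * e2 w S + p1 (w · w) S
  p1² w []          = refl
  p1² w (false ∷ S) = p1² (w ∘ suc) S
  p1² w (true ∷ S)  = trans (re₁ (w zero) (p1 (w ∘ suc) S)) (trans (cong (λ z → z + (w zero * w zero + + 2 * (w zero * p1 (w ∘ suc) S))) (p1² (w ∘ suc) S))
     (re₂ (w zero) (p1 (w ∘ suc) S) (e2 (w ∘ suc) S) (p1 ((w · w) ∘ suc) S)))
    where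
    re₁ : ∀ w p → (w + p) * (w + p) ≡ p * p + (w * w + + 2 * (w * p))
    re₁ = solve-∀
    re₂ : ∀ w p e q → (+ 2 * e + q) + (w * w + + 2 * (w * p)) ≡ + 2 * (e + w * p) + (w * w + q)
    re₂ = solve-∀

  p1-empty : (w : Fin n → ℤ) (S : Subset n) → ∣ S ∣ ≡ 0 → p1 w S ≡ 0ℤ
  p1-empty w []          e = refl
  p1-empty w (false ∷ S) e = p1-empty (w ∘ suc) S e

  e2-empty : (w : Fin n → ℤ) (S : Subset n) → ∣ S ∣ ≡ 0 → e2 w S ≡ 0ℤ
  e2-empty w []          e = refl
  e2-empty w (false ∷ S) e = e2-empty (w ∘ suc) S e

  e2-singleton : (w : Fin n → ℤ) (S : Subset n) → ∣ S ∣ ≡ 1 → e2 w S ≡ 0ℤ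
  e2-singleton w (false ∷ S) e = e2-singleton (w ∘ suc) S e
  e2-singleton w (true ∷ S)  e =
    trans (cong₂ (λ x y → x + w zero * y) (e2-empty (w ∘ suc) S (ℕ.suc-injective e)) (p1-empty (w ∘ suc) S (ℕ.suc-injective e)))
          (trans (ℤ.+-identityˡ _) (ℤ.*-zeroʳ (w zero)))

  p1-singleton-· : (u v : Fin n → ℤ) (S : Subset n) → ∣ S ∣ ≡ 1 → p1 u S * p1 v S ≡ p1 (u · v) S
  p1-singleton-· u v (false ∷ S) e = p1-singleton-· (u ∘ suc) (v ∘ suc) S e
  p1-singleton-· u v (true ∷ S)  e =
    trans (cong₂ (λ x y → (u zero + x) * (v zero + y)) (p1-empty (u ∘ suc) S e′) (p1-empty (v ∘ suc) S e′))
    (trans (re (u zero) (v zero)) (cong (_+_ (u zero * v zero)) (sym (p1-empty ((u · v) ∘ suc) S e′))))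
    where
    e′ = ℕ.suc-injective e
    re : ∀ a b → (a + + 0) * (b + + 0) ≡ a * b + + 0
    re = solve-∀

  -- Sums over all sets of one size, in terms of power sums

  sumₛ : ℕ → Fun n → ℤ
  sumₛ j G = I (at j 𝟏) G

  I-at : ∀ j (P G : Fun n) → I (at j P) (at j G) ≡ sumₛ j (P · G)
  I-at j P G = I-ext λ S → go S (δ-dichotomy j ∣ S ∣)
    where
    re₀ : ∀ p g → (+ 0 * p) * (+ 0 * g) ≡ (+ 0 * + 1) * (p * g)
    re₀ = solve-∀
    re₁ : ∀ p g → (+ 1 * p) * (+ 1 * g) ≡ (+ 1 * + 1) * (p * g)
    re₁ = solve-∀
    go : ∀ S → δ j ∣ S ∣ ≡ 0ℤ ⊎ ∣ S ∣ ≡ j → at j P S * at j G S ≡ at j 𝟏 S * (P S * G S)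
    go S (inj₁ z) = subst (λ d → d * P S * (d * G S) ≡ d * 1ℤ * (P S * G S)) (sym z) (re₀ (P S) (G S))
    go S (inj₂ e) = subst (λ d → d * P S * (d * G S) ≡ d * 1ℤ * (P S * G S))
                          (sym (trans (cong (δ j) e) (δ-refl j))) (re₁ (P S) (G S))

  sumₛ-0 : ∀ c {G : Fun n} → (∀ S → ∣ S ∣ ≡ 0 → G S ≡ c) → sumₛ 0 G ≡ c
  sumₛ-0 {zero}  c e = trans (ℤ.*-identityˡ _) (e [] refl)
  sumₛ-0 {suc n} c {G} e = trans (cong₂ _+_ (sumₛ-0 c (λ S → e (false ∷ S))) (trans (I-cong {f = hi (at 0 𝟏)} {f′ = 𝟎} {g = hi G} (λ S → refl) (λ S → refl)) (I-𝟎 (hi G))))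
                               (ℤ.+-identityʳ c)

  sumₛ-1 : (v : Fin n → ℤ) {G : Fun n} → (∀ S → ∣ S ∣ ≡ 1 → G S ≡ p1 v S) → sumₛ 1 G ≡ ∑ v
  sumₛ-1 {zero}  v e = refl
  sumₛ-1 {suc n} v {G} e = trans (cong₂ _+_ (sumₛ-1 (v ∘ suc) (λ S → e (false ∷ S)))
      (sumₛ-0 (v zero) {hi G} (λ S z → trans (e (true ∷ S) (cong suc z)) (trans (cong (_+_ (v zero)) (p1-empty (v ∘ suc) S z)) (ℤ.+-identityʳ _)))))
    (ℤ.+-comm (∑ (v ∘ suc)) (v zero))

  ∑-⊙ : ∀ c (v : Fin n → ℤ) → ∑ (λ i → c * v i) ≡ c * ∑ v
  ∑-⊙ {zero}  c v = sym (ℤ.*-zeroʳ c)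
  ∑-⊙ {suc n} c v = trans (cong (_+_ (c * v zero)) (∑-⊙ c (v ∘ suc))) (dist c (v zero) (∑ (v ∘ suc)))

  ∑-+ : ∀ (u v : Fin n → ℤ) → ∑ (λ i → u i + v i) ≡ ∑ u + ∑ v
  ∑-+ {zero}  u v = refl
  ∑-+ {suc n} u v = trans (cong (_+_ (u zero + v zero)) (∑-+ (u ∘ suc) (v ∘ suc))) (re (u zero) (v zero) (∑ (u ∘ suc)) (∑ (v ∘ suc)))
    where re : ∀ a b c d → a + b + (c + d) ≡ (a + c) + (b + d)
          re = solve-∀

  ∑-cong : {u v : Fin n → ℤ} → (∀ i → u i ≡ v i) → ∑ u ≡ ∑ v
  ∑-cong {zero}  e = refl
  ∑-cong {suc n} e = cong₂ _+_ (e zero) (∑-cong (e ∘ suc))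

  p1-⊙ : ∀ c (v : Fin n → ℤ) (S : Subset n) → p1 (λ i → c * v i) S ≡ c * p1 v S
  p1-⊙ c v []          = sym (ℤ.*-zeroʳ c)
  p1-⊙ c v (false ∷ S) = p1-⊙ c (v ∘ suc) S
  p1-⊙ c v (true ∷ S)  = trans (cong (_+_ (c * v zero)) (p1-⊙ c (v ∘ suc) S)) (dist c (v zero) (p1 (v ∘ suc) S))

  p1-+ : ∀ (u v : Fin n → ℤ) (S : Subset n) → p1 (λ i → u i + v i) S ≡ p1 u S + p1 v S
  p1-+ u v []          = refl
  p1-+ u v (false ∷ S) = p1-+ (u ∘ suc) (v ∘ suc) S
  p1-+ u v (true ∷ S)  = trans (cong (_+_ (u zero + v zero)) (p1-+ (u ∘ suc) (v ∘ suc) S)) (re (u zero) (v zero) (p1 (u ∘ suc) S) (p1 (v ∘ suc) S))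
    where re : ∀ a b c d → a + b + (c + d) ≡ (a + c) + (b + d)
          re = solve-∀

  sumₛ-e2 : (w : Fin n → ℤ) → + 2 * sumₛ 2 (e2 w) ≡ ∑ w * ∑ w - ∑ (w · w)
  sumₛ-e2 {zero}  w = refl
  sumₛ-e2 {suc n} w = trans (ℤ.*-distribˡ-+ (+ 2) (sumₛ 2 (e2 (w ∘ suc))) (sumₛ 1 (hi (e2 w))))
    (trans (cong₂ (λ x y → x + + 2 * y) (sumₛ-e2 w′)
       (trans (sumₛ-1 (λ i → w zero * w′ i) (λ S e → trans (cong (_+ w zero * p1 w′ S) (e2-singleton w′ S e))
          (trans (ℤ.+-identityˡ _) (sym (p1-⊙ (w zero) w′ S))))) (∑-⊙ (w zero) w′)))
     (re (w zero) (∑ w′) (∑ (w′ · w′))))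
    where
    w′ = w ∘ suc
    re : ∀ w W s → (W * W - s) + + 2 * (w * W) ≡ (w + W) * (w + W) - (w * w + s)
    re = solve-∀

  sumₛ-e2² : (w : Fin n → ℤ) → + 2 * sumₛ 2 (e2 w · e2 w) ≡ ∑ (w · w) * ∑ (w · w) - ∑ (w · w · (w · w))
  sumₛ-e2² {zero}  w = refl
  sumₛ-e2² {suc n} w = trans (ℤ.*-distribˡ-+ (+ 2) (sumₛ 2 (e2 (w ∘ suc) · e2 (w ∘ suc))) (sumₛ 1 (hi (e2 w · e2 w))))
    (trans (cong₂ (λ x y → x + + 2 * y) (sumₛ-e2² w′)
       (trans (sumₛ-1 (λ i → w zero * w zero * (w′ i * w′ i)) step) (∑-⊙ (w zero * w zero) (w′ · w′))))
     (re (w zero) (∑ (w′ · w′)) (∑ (w′ · w′ · (w′ · w′)))))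
    where
    w′ = w ∘ suc
    re : ∀ w s q → (s * s - q) + + 2 * (w * w * s) ≡ (w * w + s) * (w * w + s) - (w * w * (w * w) + q)
    re = solve-∀
    sq : ∀ w p → (+ 0 + w * p) * (+ 0 + w * p) ≡ w * w * (p * p)
    sq = solve-∀
    step : ∀ S → ∣ S ∣ ≡ 1 → hi (e2 w · e2 w) S ≡ p1 (λ i → w zero * w zero * (w′ i * w′ i)) S
    step S e = trans (cong (λ x → (x + w zero * p1 w′ S) * (x + w zero * p1 w′ S)) (e2-singleton w′ S e))
      (trans (sq (w zero) (p1 w′ S))
      (trans (cong (w zero * w zero *_) (p1-singleton-· w′ w′ S e)) (sym (p1-⊙ (w zero * w zero) (w′ · w′) S))))

  sumₛ-e2-p1 : (w : Fin n → ℤ) → sumₛ 2 (e2 w · p1 (w · w)) ≡ ∑ w * ∑ (w · w · w) - ∑ (w · w · (w · w))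
  sumₛ-e2-p1 {zero}  w = refl
  sumₛ-e2-p1 {suc n} w =
    trans (cong₂ _+_ (sumₛ-e2-p1 w′)
       (trans (sumₛ-1 (λ i → w zero * w zero * w zero * w′ i + w zero * (w′ i * w′ i * w′ i)) step)
       (trans (∑-+ (λ i → w zero * w zero * w zero * w′ i) _) (cong₂ _+_ (∑-⊙ (w zero * w zero * w zero) w′) (∑-⊙ (w zero) (w′ · w′ · w′))))))
     (re (w zero) (∑ w′) (∑ (w′ · w′ · w′)) (∑ (w′ · w′ · (w′ · w′))))
    where
    w′ = w ∘ suc
    re : ∀ w W c q → (W * c - q) + (w * w * w * W + w * c) ≡ (w + W) * (w * w * w + c) - (w * w * (w * w) + q)
    re = solve-∀
    ex : ∀ w p s → (+ 0 + w * p) * (w * w + s) ≡ w * w * w * p + w * (s * p)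
    ex = solve-∀
    step : ∀ S → ∣ S ∣ ≡ 1 → hi (e2 w · p1 (w · w)) S
         ≡ p1 (λ i → w zero * w zero * w zero * w′ i + w zero * (w′ i * w′ i * w′ i)) S
    step S e = trans (cong (λ x → (x + w zero * p1 w′ S) * (w zero * w zero + p1 (w′ · w′) S)) (e2-singleton w′ S e))
      (trans (ex (w zero) (p1 w′ S) (p1 (w′ · w′) S))
      (trans (cong₂ _+_ (sym (p1-⊙ (w zero * w zero * w zero) w′ S))
                        (trans (cong (w zero *_) (p1-singleton-· (w′ · w′) w′ S e)) (sym (p1-⊙ (w zero) (w′ · w′ · w′) S))))
             (sym (p1-+ (λ i → w zero * w zero * w zero * w′ i) _ S))))

  -- Levels 0 and 1 in closed form

  !>0 : ∀ m → 0ℤ < + (m !)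
  !>0 m = +<+ (ℕ.>-nonZero⁻¹ (m !) {{m ℕ.!≢0}})

  !-suc : ∀ m → + (suc m !) ≡ + suc m * + (m !)
  !-suc m = ℤ.pos-* (suc m) (m !)

  cancel-≡ : ∀ {c x y} → 0ℤ < c → c * x ≡ c * y → x ≡ y
  cancel-≡ {c} {x} {y} p = ℤ.*-cancelˡ-≡ c x y {{>-nonZero p}}

  -- The factors m + 1 accumulate to m!. This gives a closed formula, valid in rank k, for a
  -- harmonic function raised from rank l.
  raise : ∀ l (P : ℕ → Fun n) → (∀ m S → ∣ S ∣ ≡ suc (m ℕ.+ l) → U (P m) S ≡ + suc m * P (suc m) S) →
          ∀ m k → m ℕ.+ l ≡ k → U^ m (at l (P 0)) ≈ + (m !) ⊙ at k (P m)
  raise l P step zero    _ refl S = sym (ℤ.*-identityˡ _)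
  raise l P step (suc m) _ refl S =
    trans (U-cong (raise l P step m _ refl) S)
    (trans (U-⊙ (+ (m !)) (at (m ℕ.+ l) (P m)) S)
    (trans (cong (+ (m !) *_) (trans (U-at (m ℕ.+ l) (P m) S)
             (trans (at-cong (suc (m ℕ.+ l)) (step m) S) (at-⊙ (suc (m ℕ.+ l)) (+ suc m) (P (suc m)) S))))
    (trans (re (+ (m !)) (+ suc m) (at (suc (m ℕ.+ l)) (P (suc m)) S))
           (cong (_* at (suc (m ℕ.+ l)) (P (suc m)) S) (sym (!-suc m))))))
    where re : ∀ a b c → a * (b * c) ≡ b * a * c
          re = solve-∀

  raise-𝟏 : ∀ k → U^ k (at {n} 0 𝟏) ≈ + (k !) ⊙ at k 𝟏
  raise-𝟏 k = raise 0 (λ _ → 𝟏) step k k (ℕ.+-identityʳ k)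
    where
    step : ∀ m S → ∣ S ∣ ≡ suc (m ℕ.+ 0) → U 𝟏 S ≡ + suc m * 1ℤ
    step m S e = trans (U-𝟏 S) (trans (cong +_ (trans e (cong suc (ℕ.+-identityʳ m)))) (sym (ℤ.*-identityʳ _)))

  raise-p1 : ∀ (v : Fin n → ℤ) m → U^ m (at 1 (p1 v)) ≈ + (m !) ⊙ at (suc m) (p1 v)
  raise-p1 v m = raise 1 (λ _ → p1 v) step m (suc m) (ℕ.+-comm m 1)
    where
    re : ∀ m p → ((+ 1 + (m + + 1)) - + 1) * p ≡ (+ 1 + m) * p
    re = solve-∀
    step : ∀ m S → ∣ S ∣ ≡ suc (m ℕ.+ 1) → U (p1 v) S ≡ + suc m * p1 v S
    step m S e = trans (U-p1 v S) (trans (cong (λ t → (+ t - + 1) * p1 v S) e) (re (+ m) (p1 v S)))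

  -- Compares consecutive levels at the same rank, so that all norms can be expressed through the
  -- one of level 0, which is C(n, k).
  normFactor-shift : ∀ n l m → (+ n - + 2 * + l - + m - + 1) * normFactor n l (suc m) ≡
             + suc m * ((+ n - + 2 * + l) * (+ n - + 2 * + l - + 1)) * normFactor n (suc l) m
  normFactor-shift n l zero = re (+ n) (+ l)
    where re : ∀ n l → (n - + 2 * l - + 0 - + 1) * (+ 1 * (n - + 2 * l - + 0) * + 1) ≡ + 1 * ((n - + 2 * l) * (n - + 2 * l - + 1)) * + 1
          re = solve-∀
  normFactor-shift n l (suc m) =
    trans (re₁ (+ n - + 2 * + l) (+ m) (normFactor n l (suc m)))
    (trans (cong (λ z → (+ 1 + + suc m) * (+ n - + 2 * + l - + suc m - + 1) * z) (normFactor-shift n l m))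
           (re₂ (+ n) (+ l) (+ m) (normFactor n (suc l) m)))
    where
    re₁ : ∀ x m c → (x - (+ 1 + m) - + 1) * ((+ 1 + (+ 1 + m)) * (x - (+ 1 + m)) * c) ≡
                    (+ 1 + (+ 1 + m)) * (x - (+ 1 + m) - + 1) * ((x - m - + 1) * c)
    re₁ = solve-∀
    re₂ : ∀ n l m c → (+ 1 + (+ 1 + m)) * (n - + 2 * l - (+ 1 + m) - + 1) *
            ((+ 1 + m) * ((n - + 2 * l) * (n - + 2 * l - + 1)) * c) ≡
          (+ 1 + (+ 1 + m)) * ((n - + 2 * l) * (n - + 2 * l - + 1)) * ((+ 1 + m) * (n - + 2 * (+ 1 + l) - m) * c)
    re₂ = solve-∀

  I-scale : ∀ c d (f g : Fun n) → I (c ⊙ f) (d ⊙ g) ≡ c * d * I f g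
  I-scale c d f g = trans (I-⊙ c f (d ⊙ g)) (trans (cong (c *_) (I-⊙ʳ d f g)) (sym (ℤ.*-assoc c d _)))

  harmonic-𝟏 : Harmonic (at {n} 0 𝟏)
  harmonic-𝟏 = Rk0-harmonic (Rk-at 0 𝟏)

  harmonic-p1 : (w : Fin n → ℤ) → ∑ w ≡ 0ℤ → Harmonic (at 1 (p1 w))
  harmonic-p1 w W S = trans (D-at 0 (p1 w) S) (trans (at-cong 0 {P′ = 𝟎} van S) (ℤ.*-zeroʳ (δ 0 ∣ S ∣)))
    where
    re : ∀ x → x * + 0 + (+ 0 - + 0) ≡ + 0
    re = solve-∀
    van : ∀ T → ∣ T ∣ ≡ 0 → D (p1 w) T ≡ 0ℤ
    van T e = trans (D-p1 w T) (trans (cong₂ (λ x y → (+ _ - + ∣ T ∣) * x + (y - x)) (p1-empty w T e) W) (re (+ _ - + ∣ T ∣)))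

  size-norm : ∀ k → + (k !) * + (k !) * I (at {n} k 𝟏) (at k 𝟏) ≡ normFactor n 0 k
  size-norm {n} k =
    trans (sym (I-scale {n} (+ (k !)) (+ (k !)) (at k 𝟏) (at k 𝟏)))
    (trans (sym (I-cong {n} (raise-𝟏 k) (raise-𝟏 k)))
    (trans (trans (sym (ℤ.*-identityˡ _)) (subst (λ j → 1ℤ * I (U^ j (at {n} 0 𝟏)) (U^ k (at 0 𝟏)) ≡ normFactor n 0 j * I (at {n} 0 𝟏) (at 0 𝟏)) (ℕ.+-identityʳ k)
             (level-shift {n} 0 0 k {r = at 0 𝟏} (Rk-at 0 𝟏) harmonic-𝟏)))
    (trans (cong (normFactor n 0 k *_) (trans (I-at {n} 0 𝟏 𝟏) (sumₛ-0 {n} 1ℤ (λ _ _ → refl)))) (ℤ.*-identityʳ _))))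

  size-p1 : ∀ m (v : Fin n → ℤ) →
            + n * I (at (suc m) 𝟏) (at (suc m) (p1 v)) ≡ + suc m * I (at {n} (suc m) 𝟏) (at (suc m) 𝟏) * ∑ v
  size-p1 {n} m v = cancel-≡ (*-pos (!>0 (suc m)) (!>0 m))
    (trans (re₁ (+ n) (+ (suc m !)) (+ (m !)) (I (at (suc m) 𝟏) (at (suc m) (p1 v))))
    (trans (cong (+ n *_) (trans (sym (I-scale (+ (suc m !)) (+ (m !)) (at (suc m) 𝟏) (at (suc m) (p1 v))))
              (I-cong (λ S → sym (raise-𝟏 (suc m) S)) (λ S → sym (raise-p1 v m S)))))
    (trans (cong (_* I (U^ (suc m) (at 0 𝟏)) (U^ m (at 1 (p1 v)))) (re₀ (+ n)))
    (trans (subst (λ j → normFactor n 0 1 * I (U^ j (at 0 𝟏)) (U^ m (at 1 (p1 v))) ≡ normFactor n 0 j * I (U^ 1 (at 0 𝟏)) (at 1 (p1 v)))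
                  (ℕ.+-comm m 1) (level-shift 0 1 m (Rk-at 0 𝟏) harmonic-𝟏))
    (trans (cong₂ _*_ (sym (size-norm {n} (suc m))) last)
           (trans (cong (λ z → z * + (suc m !) * B * ∑ v) (!-suc m))
           (re₂ (+ suc m) (+ (m !)) (+ (suc m !)) B (∑ v))))))))
    where
    B = I (at {n} (suc m) 𝟏) (at (suc m) 𝟏)
    re₀ : ∀ n → n ≡ + 1 * (n - + 2 * + 0 - + 0) * + 1
    re₀ = solve-∀
    re₁ : ∀ n a b x → a * b * (n * x) ≡ n * (a * b * x)
    re₁ = solve-∀
    re₂ : ∀ s f g b v → s * f * g * b * v ≡ g * f * (s * b * v)
    re₂ = solve-∀
    last : I (U^ 1 (at 0 𝟏)) (at 1 (p1 v)) ≡ ∑ v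
    last = trans (I-cong {n} {g = at 1 (p1 v)} (raise-𝟏 1) (λ _ → refl)) (trans (I-⊙ 1ℤ (at 1 𝟏) (at 1 (p1 v)))
           (trans (ℤ.*-identityˡ _) (trans (I-at 1 𝟏 (p1 v)) (sumₛ-1 v (λ S e → ℤ.*-identityˡ _)))))

  -- With ∑ w = 0 the weight is harmonic in rank 1, where the inner product is ∑ wᵢvᵢ; `level-shift`
  -- brings it up to rank k, and `normFactor-shift` trades the factor for C(n, k).
  p1-norm : ∀ m (w v : Fin n → ℤ) → ∑ w ≡ 0ℤ → let k = + suc m in
            + n * (+ n - + 1) * I (at (suc m) (p1 w)) (at (suc m) (p1 v)) ≡
            k * (+ n - k) * I (at {n} (suc m) 𝟏) (at (suc m) 𝟏) * ∑ (w · v)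
  p1-norm {n} m w v W = cancel-≡ (*-pos (*-pos {+ suc m} (+<+ ℕ.z<s) (!>0 m)) (!>0 m))
    (trans (re₁ (+ suc m) (+ (m !)) (+ n) V)
    (trans (cong (+ suc m * (+ n * (+ n - + 1)) *_) normV)
    (trans (re₂ (+ n) (+ suc m) (normFactor n 1 m) (∑ (w · v)))
    (trans (cong (_* ∑ (w · v)) (sym (normFactor-shift n 0 m)))
    (trans (cong (λ z → (+ n - + 2 * + 0 - + m - + 1) * z * ∑ (w · v)) (sym (size-norm {n} (suc m))))
    (trans (cong (λ z → (+ n - + 2 * + 0 - + m - + 1) * (z * z * B) * ∑ (w · v)) (!-suc m))
           (re₃ (+ n) (+ m) (+ (m !)) B (∑ (w · v)))))))))
    where
    B = I (at {n} (suc m) 𝟏) (at (suc m) 𝟏)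
    V = I (at (suc m) (p1 w)) (at (suc m) (p1 v))
    normV : + (m !) * + (m !) * V ≡ normFactor n 1 m * ∑ (w · v)
    normV = trans (sym (I-scale (+ (m !)) (+ (m !)) (at (suc m) (p1 w)) (at (suc m) (p1 v))))
      (trans (sym (I-cong (raise-p1 w m) (raise-p1 v m)))
      (trans (trans (sym (ℤ.*-identityˡ _)) (subst (λ j → 1ℤ * I (U^ j (at 1 (p1 w))) (U^ m (at 1 (p1 v))) ≡ normFactor n 1 j * I (at 1 (p1 w)) (at 1 (p1 v)))
                (ℕ.+-identityʳ m) (level-shift 1 0 m (Rk-at 1 (p1 w)) (harmonic-p1 w W))))
             (cong (normFactor n 1 m *_) (trans (I-at 1 (p1 w) (p1 v)) (sumₛ-1 (w · v) (p1-singleton-· w v))))))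
    re₁ : ∀ k f n j → k * f * f * (n * (n - + 1) * j) ≡ k * (n * (n - + 1)) * (f * f * j)
    re₁ = solve-∀
    re₂ : ∀ n k c s → k * (n * (n - + 1)) * (c * s) ≡ k * ((n - + 2 * + 0) * (n - + 2 * + 0 - + 1)) * c * s
    re₂ = solve-∀
    re₃ : ∀ n m f b s → (n - + 2 * + 0 - m - + 1) * ((+ 1 + m) * f * ((+ 1 + m) * f) * b) * s ≡
                        (+ 1 + m) * f * f * ((+ 1 + m) * (n - (+ 1 + m)) * b * s)
    re₃ = solve-∀

  -- The eigenfunction of level 2 built from a weight w

  module Quadratic (w : Fin n → ℤ) (W : ∑ w ≡ 0ℤ) where

    s q : ℤ
    s = ∑ (w · w)
    q = ∑ (w · w · (w · w))

    -- On sets of size m + 2 this is (n−1)((n−2)X² − (n−2k)P) − k(k−1)s with X = ∑ wᵢ, P = ∑ wᵢ² over the set: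
    -- the corrections to wᵢwⱼ are what makes it orthogonal to levels 0 and 1.
    y : ℕ → Fun n
    y m S = + 2 * ((+ n - + 1) * (+ n - + 2)) * e2 w S + + 2 * (+ n - + 1) * + suc m * p1 (w · w) S
          - + suc (suc m) * + suc m * s

    private
      linear : (F : Fun n → Fun n) → (∀ {f g} → f ≈ g → F f ≈ F g) → (∀ f g → F (f ⊕ g) ≈ F f ⊕ F g) → (∀ c f → F (c ⊙ f) ≈ c ⊙ F f) →
            ∀ a b c S → F (λ T → a * e2 w T + b * p1 (w · w) T - c) S ≡ a * F (e2 w) S + b * F (p1 (w · w)) S - c * F 𝟏 S
      linear F F-cong F-⊕ F-⊙ a b c S =
        trans (F-cong {g = a ⊙ e2 w ⊕ b ⊙ p1 (w · w) ⊕ (- c) ⊙ 𝟏} (λ T → cong (_+_ (a * e2 w T + b * p1 (w · w) T)) (sym (ℤ.*-identityʳ (- c)))) S)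
        (trans (F-⊕ (a ⊙ e2 w ⊕ b ⊙ p1 (w · w)) ((- c) ⊙ 𝟏) S)
        (trans (cong₂ _+_ (trans (F-⊕ (a ⊙ e2 w) (b ⊙ p1 (w · w)) S) (cong₂ _+_ (F-⊙ a (e2 w) S) (F-⊙ b (p1 (w · w)) S))) (F-⊙ (- c) 𝟏 S))
               (re (a * F (e2 w) S + b * F (p1 (w · w)) S) c (F 𝟏 S))))
        where re : ∀ x c y → x + (- c) * y ≡ x - c * y
              re = solve-∀

    harmonic-y : Harmonic (at 2 (y 0))
    harmonic-y S = trans (D-at 1 (y 0) S) (trans (at-cong 1 {P′ = 𝟎} van S) (ℤ.*-zeroʳ (δ 1 ∣ S ∣)))
      where
      a b c : ℤ
      a = + 2 * ((+ n - + 1) * (+ n - + 2))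
      b = + 2 * (+ n - + 1) * + 1
      c = + 2 * + 1 * s
      re : ∀ n s P → + 2 * ((n - + 1) * (n - + 2)) * ((n - + 1) * + 0 - P) + + 2 * (n - + 1) * + 1 * ((n - + 1) * P + (s - P))
           - + 2 * + 1 * s * (n - + 1) ≡ + 0
      re = solve-∀
      re₂ : ∀ x p → x + p * (+ 0 - p) ≡ x - p * p
      re₂ = solve-∀
      van : ∀ T → ∣ T ∣ ≡ 1 → D (y 0) T ≡ 0ℤ
      van T e = trans (linear D D-cong D-⊕ D-⊙ a b c T)
        (trans (cong₂ (λ x z → a * x + b * D (p1 (w · w)) T - c * z)
           (trans (D-e2 w T) (trans (cong₂ (λ x z → (+ n - + ∣ T ∣) * x + p1 w T * (z - p1 w T)) (e2-singleton w T e) W)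
             (trans (re₂ ((+ n - + ∣ T ∣) * 0ℤ) (p1 w T)) (cong₂ (λ t z → (+ n - + t) * 0ℤ - z) e (p1-singleton-· w w T e)))))
           (trans (D-𝟏 T) (cong (λ t → + n - + t) e)))
        (trans (cong (λ z → a * ((+ n - + 1) * 0ℤ - p1 (w · w) T) + b * z - c * (+ n - + 1))
                 (trans (D-p1 (w · w) T) (cong (λ t → (+ n - + t) * p1 (w · w) T + (s - p1 (w · w) T)) e)))
               (re (+ n) s (p1 (w · w) T))))

    raise-y : ∀ m → U^ m (at 2 (y 0)) ≈ + (m !) ⊙ at (suc (suc m)) (y m)
    raise-y m = raise 2 y step m (suc (suc m)) (ℕ.+-comm m 2)
      where
      re : ∀ n m e p s → + 2 * ((n - + 1) * (n - + 2)) * (((+ 1 + (m + + 2)) - + 2) * e) + + 2 * (n - + 1) * (+ 1 + m) * (((+ 1 + (m + + 2)) - + 1) * p)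
           - (+ 1 + (+ 1 + m)) * (+ 1 + m) * s * (+ 1 + (m + + 2)) ≡
           (+ 1 + m) * (+ 2 * ((n - + 1) * (n - + 2)) * e + + 2 * (n - + 1) * (+ 1 + (+ 1 + m)) * p - (+ 1 + (+ 1 + (+ 1 + m))) * (+ 1 + (+ 1 + m)) * s)
      re = solve-∀
      step : ∀ m S → ∣ S ∣ ≡ suc (m ℕ.+ 2) → U (y m) S ≡ + suc m * y (suc m) S
      step m S e = trans (linear U U-cong U-⊕ U-⊙ a b c S)
        (trans (cong₂ (λ x z → a * x + b * U (p1 (w · w)) S - c * z)
                  (trans (U-e2 w S) (cong (λ t → (+ t - + 2) * e2 w S) e)) (trans (U-𝟏 S) (cong +_ e)))
        (trans (cong (λ z → a * ((+ suc (m ℕ.+ 2) - + 2) * e2 w S) + b * z - c * + suc (m ℕ.+ 2))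
                  (trans (U-p1 (w · w) S) (cong (λ t → (+ t - + 1) * p1 (w · w) S) e)))
               (re (+ n) (+ m) (e2 w S) (p1 (w · w) S) s)))
        where
        a b c : ℤ
        a = + 2 * ((+ n - + 1) * (+ n - + 2))
        b = + 2 * (+ n - + 1) * + suc m
        c = + suc (suc m) * + suc m * s

    y-p1-orthogonal : ∀ m v → I (at (suc (suc m)) (y m)) (at (suc (suc m)) (p1 v)) ≡ 0ℤ
    y-p1-orthogonal m v = cancel-≡ (*-pos (!>0 m) (!>0 (suc m)))
      (trans (sym (I-scale (+ (m !)) (+ (suc m !)) (at (suc (suc m)) (y m)) (at (suc (suc m)) (p1 v))))
      (trans (sym (I-cong (raise-y m) (raise-p1 v (suc m))))
      (trans (level-orthogonal 2 m (Rk-at 2 (y 0)) harmonic-y) (sym (ℤ.*-zeroʳ (+ (m !) * + (suc m !)))))))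

    Ψ : ℤ
    Ψ = ((+ n - + 1) * (+ n - + 2) + + 1) * (s * s) - + n * (+ n - + 1) * q

    -- On pairs `y 0` differs from a multiple of `e2 w` by U of a function of rank 1, to which a
    -- harmonic function is orthogonal. So one of the two factors may be replaced by that multiple
    -- of `e2 w`, and ∑ w = 0 removes the sum of cubes.
    y-base-norm : I (at 2 (y 0)) (at 2 (y 0)) ≡ + 2 * ((+ n - + 1) * (+ n - + 2)) * Ψ
    y-base-norm =
      trans (I-cong {f = h} (λ _ → refl) split)
      (trans (I-⊕ʳ h (a ⊙ at 2 (e2 w)) (U r))
      (trans (cong₂ _+_ (trans (I-⊙ʳ a h (at 2 (e2 w))) (cong (a *_) main))
                        (level-orthogonal 2 0 (Rk-at 2 (y 0)) harmonic-y))
             (ℤ.+-identityʳ _)))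
      where
      a b c : ℤ
      a = + 2 * ((+ n - + 1) * (+ n - + 2))
      b = + 2 * (+ n - + 1) * + 1
      c = + 2 * + 1 * s
      h r : Fun n
      h = at 2 (y 0)
      r = at 1 (b ⊙ p1 (w · w) ⊕ (- s) ⊙ 𝟏)
      Ur : ∀ S → ∣ S ∣ ≡ 2 → U (b ⊙ p1 (w · w) ⊕ (- s) ⊙ 𝟏) S ≡ b * p1 (w · w) S - c
      Ur S e = trans (U-⊕ (b ⊙ p1 (w · w)) ((- s) ⊙ 𝟏) S)
        (trans (cong₂ _+_ (trans (U-⊙ b (p1 (w · w)) S) (cong (b *_) (trans (U-p1 (w · w) S) (cong (λ t → (+ t - + 1) * p1 (w · w) S) e))))
                          (trans (U-⊙ (- s) 𝟏 S) (cong ((- s) *_) (trans (U-𝟏 S) (cong +_ e)))))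
               (re b (p1 (w · w) S) s))
        where re : ∀ b p s → b * ((+ 2 - + 1) * p) + (- s) * + 2 ≡ b * p - + 2 * + 1 * s
              re = solve-∀
      split : h ≈ a ⊙ at 2 (e2 w) ⊕ U r
      split S = trans (cong (δ 2 ∣ S ∣ *_) (re₁ (a * e2 w S) (b * p1 (w · w) S) c))
        (trans (at-⊕ 2 (a ⊙ e2 w) (λ T → b * p1 (w · w) T - c) S)
        (cong₂ _+_ (at-⊙ 2 a (e2 w) S)
          (trans (at-cong 2 (λ T e → sym (Ur T e)) S) (sym (U-at 1 (b ⊙ p1 (w · w) ⊕ (- s) ⊙ 𝟏) S)))))
        where re₁ : ∀ x y c → x + y - c ≡ x + (y - c)
              re₁ = solve-∀
      main : I h (at 2 (e2 w)) ≡ Ψ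
      main = cancel-≡ {+ 2} (+<+ ℕ.z<s)
        (trans (cong (+ 2 *_) (trans (I-at 2 (y 0) (e2 w))
          (trans (I-cong {f = at 2 𝟏} (λ _ → refl) expand)
          (trans (I-⊕ʳ (at 2 𝟏) (a ⊙ (e2 w · e2 w) ⊕ b ⊙ (e2 w · p1 (w · w))) ((- c) ⊙ e2 w))
          (cong₂ _+_ (trans (I-⊕ʳ (at 2 𝟏) (a ⊙ (e2 w · e2 w)) (b ⊙ (e2 w · p1 (w · w))))
                         (cong₂ _+_ (I-⊙ʳ a (at 2 𝟏) (e2 w · e2 w)) (I-⊙ʳ b (at 2 𝟏) (e2 w · p1 (w · w)))))
                     (I-⊙ʳ (- c) (at 2 𝟏) (e2 w)))))))
        (trans (re₂ a b c (sumₛ 2 (e2 w · e2 w)) (sumₛ 2 (e2 w · p1 (w · w))) (sumₛ 2 (e2 w)))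
        (trans (cong₂ _-_ (cong₂ (λ x z → a * x + + 2 * b * z) (sumₛ-e2² w) (trans (sumₛ-e2-p1 w) (cong (λ t → t * ∑ (w · w · w) - q) W)))
                          (cong (c *_) (trans (sumₛ-e2 w) (cong (λ t → t * t - s) W))))
               (re₃ (+ n) s q (∑ (w · w · w))))))
        where
        re₂ : ∀ a b c x y z → + 2 * (a * x + b * y + (- c) * z) ≡ a * (+ 2 * x) + + 2 * b * y - c * (+ 2 * z)
        re₂ = solve-∀
        re₃ : ∀ n s q t → + 2 * ((n - + 1) * (n - + 2)) * (s * s - q) + + 2 * (+ 2 * (n - + 1) * + 1) * (+ 0 * t - q) - + 2 * + 1 * s * (+ 0 * + 0 - s)
              ≡ + 2 * (((n - + 1) * (n - + 2) + + 1) * (s * s) - n * (n - + 1) * q)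
        re₃ = solve-∀
        expand : y 0 · e2 w ≈ a ⊙ (e2 w · e2 w) ⊕ b ⊙ (e2 w · p1 (w · w)) ⊕ (- c) ⊙ e2 w
        expand S = re a b c (e2 w S) (p1 (w · w) S)
          where re : ∀ a b c e p → (a * e + b * p - c) * e ≡ a * (e * e) + b * (e * p) + (- c) * e
                re = solve-∀

    -- As for `p1-norm`, with two shifts of level instead of one.
    y-norm : ∀ m → let k = + suc (suc m) in
             + n * (+ n - + 1) * ((+ n - + 2) * (+ n - + 3)) * I (at (suc (suc m)) (y m)) (at (suc (suc m)) (y m)) ≡
             k * (+ n - k) * ((k - + 1) * (+ n - k - + 1)) * I (at {n} (suc (suc m)) 𝟏) (at (suc (suc m)) 𝟏) *
             (+ 2 * ((+ n - + 1) * (+ n - + 2)) * Ψ)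
    y-norm m = cancel-≡ (*-pos (*-pos (*-pos {+ suc (suc m)} {+ suc m} (+<+ ℕ.z<s) (+<+ ℕ.z<s)) (!>0 m)) (!>0 m))
      (trans (re₁ (+ suc (suc m)) (+ suc m) (+ (m !)) (+ n) V)
      (trans (cong (+ suc (suc m) * (+ n * (+ n - + 1)) * (+ suc m * ((+ n - + 2) * (+ n - + 3))) *_) normV)
      (trans (re₂ (+ n) (+ suc (suc m)) (+ suc m) (normFactor n 2 m) Ψ′)
      (trans (cong (λ z → + suc (suc m) * (+ n * (+ n - + 1)) * z * Ψ′) (sym (normFactor-shift n 1 m)))
      (trans (re₃ (+ n) (+ suc (suc m)) (+ n - + 2 * + 1 - + m - + 1) (normFactor n 1 (suc m)) Ψ′)
      (trans (cong (λ z → (+ n - + 2 * + 1 - + m - + 1) * z * Ψ′) (sym (normFactor-shift n 0 (suc m))))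
      (trans (cong (λ z → (+ n - + 2 * + 1 - + m - + 1) * ((+ n - + 2 * + 0 - + suc m - + 1) * z) * Ψ′) (sym (size-norm {n} (suc (suc m)))))
      (trans (cong (λ z → (+ n - + 2 * + 1 - + m - + 1) * ((+ n - + 2 * + 0 - + suc m - + 1) * (z * z * B)) * Ψ′)
               (trans (!-suc (suc m)) (cong (+ suc (suc m) *_) (!-suc m))))
             (re₄ (+ n) (+ m) (+ (m !)) B Ψ′)))))))))
      where
      B = I (at {n} (suc (suc m)) 𝟏) (at (suc (suc m)) 𝟏)
      V = I (at (suc (suc m)) (y m)) (at (suc (suc m)) (y m))
      Ψ′ = + 2 * ((+ n - + 1) * (+ n - + 2)) * Ψ
      normV : + (m !) * + (m !) * V ≡ normFactor n 2 m * Ψ′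
      normV = trans (sym (I-scale (+ (m !)) (+ (m !)) (at (suc (suc m)) (y m)) (at (suc (suc m)) (y m))))
        (trans (sym (I-cong (raise-y m) (raise-y m)))
        (trans (trans (sym (ℤ.*-identityˡ _)) (subst (λ j → 1ℤ * I (U^ j (at 2 (y 0))) (U^ m (at 2 (y 0))) ≡ normFactor n 2 j * I (at 2 (y 0)) (at 2 (y 0)))
                  (ℕ.+-identityʳ m) (level-shift 2 0 m (Rk-at 2 (y 0)) harmonic-y)))
               (cong (normFactor n 2 m *_) y-base-norm)))
      re₁ : ∀ k l f n j → k * l * f * f * (n * (n - + 1) * ((n - + 2) * (n - + 3)) * j) ≡
            k * (n * (n - + 1)) * (l * ((n - + 2) * (n - + 3))) * (f * f * j)
      re₁ = solve-∀
      re₂ : ∀ n k l c s → k * (n * (n - + 1)) * (l * ((n - + 2) * (n - + 3))) * (c * s) ≡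
            k * (n * (n - + 1)) * (l * ((n - + 2 * + 1) * (n - + 2 * + 1 - + 1)) * c) * s
      re₂ = solve-∀
      re₃ : ∀ n k x c s → k * (n * (n - + 1)) * (x * c) * s ≡ x * (k * ((n - + 2 * + 0) * (n - + 2 * + 0 - + 1)) * c) * s
      re₃ = solve-∀
      re₄ : ∀ n m f b s → (n - + 2 * + 1 - m - + 1) * ((n - + 2 * + 0 - (+ 1 + m) - + 1) *
              ((+ 1 + (+ 1 + m)) * ((+ 1 + m) * f) * ((+ 1 + (+ 1 + m)) * ((+ 1 + m) * f)) * b)) * s ≡
            (+ 1 + (+ 1 + m)) * (+ 1 + m) * f * f *
            ((+ 1 + (+ 1 + m)) * (n - (+ 1 + (+ 1 + m))) * (((+ 1 + (+ 1 + m)) - + 1) * (n - (+ 1 + (+ 1 + m)) - + 1)) * b * s)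
      re₄ = solve-∀

  -- Detecting the absence of levels 0 and 1

  size-count : ∀ n k → I (at {n} k 𝟏) (at k 𝟏) ≡ + (n C k)
  size-count n k = trans (I-at {n} k 𝟏 𝟏) (count n k)
    where
    count : ∀ n k → sumₛ {n} k (𝟏 · 𝟏) ≡ + (n C k)
    count zero    zero    = refl
    count zero    (suc k) = refl
    count (suc n) zero    = sumₛ-0 {suc n} 1ℤ (λ _ _ → refl)
    count (suc n) (suc k) = trans (cong₂ _+_ (count n (suc k)) (count n k))
      (cong +_ (trans (ℕ.+-comm (n C suc k) (n C k)) (nCk+nC[k+1]≡[n+1]C[k+1] n k)))

  empty : (S : Subset n) → ∣ S ∣ ≡ 0 → S ≡ ∅
  empty []          e = refl
  empty (false ∷ S) e = cong (false ∷_) (empty S e)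

  vertex : Fun n → Fin n → ℤ
  vertex f zero    = f (true ∷ ∅)
  vertex f (suc i) = vertex (lo f) i

  p1-vertex : (f : Fun n) (S : Subset n) → ∣ S ∣ ≡ 1 → p1 (vertex f) S ≡ f S
  p1-vertex f (false ∷ S) e = p1-vertex (lo f) S e
  p1-vertex f (true ∷ S)  e = trans (cong₂ _+_ (cong (λ T → f (true ∷ T)) (sym (empty S (ℕ.suc-injective e))))
                                               (p1-empty (vertex (lo f)) S (ℕ.suc-injective e)))
                                    (ℤ.+-identityʳ _)

  p1-const : (S : Subset n) → p1 (λ _ → 1ℤ) S ≡ + ∣ S ∣
  p1-const []          = refl
  p1-const (false ∷ S) = p1-const S
  p1-const (true ∷ S)  = cong (_+_ 1ℤ) (p1-const S)

  private
    sum-zero : ∀ {a b} → 0ℤ ≤ a → 0ℤ ≤ b → a + b ≡ 0ℤ → a ≡ 0ℤ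
    sum-zero {a} {b} p q e = ℤ.≤-antisym (subst (a ≤_) e (subst (_≤ a + b) (ℤ.+-identityʳ a) (ℤ.+-monoʳ-≤ a q))) p

  I-definite : (f : Fun n) → I f f ≡ 0ℤ → f ≈ 𝟎
  I-definite f e [] with ℤ.i*j≡0⇒i≡0∨j≡0 (f []) e
  ... | inj₁ z = z
  ... | inj₂ z = z
  I-definite f e (false ∷ S) = I-definite (lo f) (sum-zero (I-nonneg (lo f)) (I-nonneg (hi f)) e) S
  I-definite f e (true ∷ S)  = I-definite (hi f)
    (sum-zero (I-nonneg (hi f)) (I-nonneg (lo f)) (trans (ℤ.+-comm (I (hi f) (hi f)) (I (lo f) (lo f))) e)) S

  -- `D^ m g` has rank 1, so it is `p1 v` for its own vector v of values on singletons; by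
  -- adjointness its norm is m! times the inner product of g with `p1 v`.
  D^-vanish : ∀ m (g : Fun n) → Rk (+ suc m) g → (∀ v → I g (at (suc m) (p1 v)) ≡ 0ℤ) → D^ m g ≈ 𝟎
  D^-vanish {n} m g rg z = I-definite r
    (trans (I-cong {f = r} {g = r} r≈ (λ _ → refl))
    (trans (sym (adjoint^ m (at 1 (p1 v)) g))
    (trans (I-cong (raise-p1 v m) (λ _ → refl))
    (trans (I-⊙ (+ (m !)) (at (suc m) (p1 v)) g)
    (trans (cong (+ (m !) *_) (trans (I-comm (at (suc m) (p1 v)) g) (z v))) (ℤ.*-zeroʳ (+ (m !))))))))
    where
    r : Fun n
    r = D^ m g
    rr : Rk (+ 1) r
    rr = Rk-D^ m 1 (subst (λ j → Rk (+ j) g) (sym (ℕ.+-comm m 1)) rg)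
    v = vertex r
    r≈ : r ≈ at 1 (p1 v)
    r≈ S with Rk-support 1 rr S
    ... | inj₂ e = sym (trans (at-value 1 (p1 v) S e) (p1-vertex r S e))
    ... | inj₁ e with δ-dichotomy 1 ∣ S ∣
    ...   | inj₁ d = trans e (sym (cong (_* p1 v S) d))
    ...   | inj₂ d = sym (trans (at-value 1 (p1 v) S d) (p1-vertex r S d))

  falling-pos : ∀ m x → + m ≤ x → 0ℤ < falling x m
  falling-pos zero    x p = +<+ ℕ.z<s
  falling-pos (suc m) x p = *-pos (ℤ.<-≤-trans (+<+ ℕ.z<s) p)
    (falling-pos m (x - + 1) (subst (_≤ x - + 1) (iso (+ m)) (ℤ.+-monoˡ-≤ (- + 1) p)))
    where iso : ∀ m → (+ 1 + m) - + 1 ≡ m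
          iso = solve-∀

  ε-bound : ∀ l {F G} → 0ℤ ≤ F → F ≤ G → 0ℤ ≤ ε l * F + G
  ε-bound l {F} {G} p q = go (ε-sign l)
    where
    ε-sign : ∀ l → ε l ≡ 1ℤ ⊎ ε l ≡ - 1ℤ
    ε-sign zero = inj₁ refl
    ε-sign (suc l) with ε-sign l
    ... | inj₁ e = inj₂ (cong -_ e)
    ... | inj₂ e = inj₁ (cong -_ e)
    re : ∀ f g → g - f ≡ - + 1 * f + g
    re = solve-∀
    go : ε l ≡ 1ℤ ⊎ ε l ≡ - 1ℤ → 0ℤ ≤ ε l * F + G
    go (inj₁ e) = subst (λ z → 0ℤ ≤ z * F + G) (sym e) (ℤ.+-mono-≤ (subst (0ℤ ≤_) (sym (ℤ.*-identityˡ F)) p) (ℤ.≤-trans p q))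
    go (inj₂ e) = subst (λ z → 0ℤ ≤ z * F + G) (sym e) (subst (0ℤ ≤_) (re F G) (ℤ.i≤j⇒0≤j-i q))

  -- Makes every factor of `falling (n − l − k) m`, the numerator of an eigenvalue, positive.
  room : ∀ n k l m → m ℕ.+ l ≡ k → 2 ℕ.* k ℕ.≤ n → + m ≤ + n - + l - + k
  room n _ l m refl le = ℤ.0≤i-j⇒j≤i (subst (0ℤ ≤_) (re (+ n) (+ l) (+ m))
    (ℤ.i≤j⇒0≤j-i (subst (_≤ + n) (ℤ.pos-* 2 (m ℕ.+ l)) (+≤+ le))))
    where re : ∀ n l m → n - + 2 * (m + l) ≡ n - l - (m + l) - m
          re = solve-∀

  -- The shifted Kneser form

  module Kneser (m : ℕ) (2k≤n : 2 ℕ.* suc (suc m) ℕ.≤ n) where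

    k : ℕ
    k = suc (suc m)

    -- A K + B I is a positive multiple of K + C(n−k−3, k−3) I.  On level l the form K is (−1)^l C(n−k−l, k−l) I,
    -- so level 1 is the only negative one.
    a q₃ p₂ A B : ℤ
    a  = + n - + k
    q₃ = + k * (+ suc m * + m)
    p₂ = falling (+ n - + 2 - + k) m
    A  = (a - + 2) * + (k !)
    B  = q₃ * p₂

    a-2≥0 : 0ℤ ≤ a - + 2
    a-2≥0 = ℤ.≤-trans (+≤+ ℕ.z≤n) (subst (+ m ≤_) (re (+ n) (+ k)) (room n k 2 m (ℕ.+-comm m 2) 2k≤n))
      where re : ∀ n k → n - + 2 - k ≡ n - k - + 2
            re = solve-∀

    A≥0 : 0ℤ ≤ A
    A≥0 = *-nonneg a-2≥0 (+≤+ ℕ.z≤n)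

    p₂>0 : 0ℤ < p₂
    p₂>0 = falling-pos m _ (room n k 2 m (ℕ.+-comm m 2) 2k≤n)

    q₃≥0 : 0ℤ ≤ q₃
    q₃≥0 = *-nonneg {+ k} (+≤+ ℕ.z≤n) (*-nonneg {+ suc m} (+≤+ ℕ.z≤n) (+≤+ ℕ.z≤n))

    falling-nonneg : ∀ l j → j ℕ.+ l ≡ k → 0ℤ ≤ falling (+ n - + l - + k) j
    falling-nonneg l j e = ℤ.<⇒≤ (falling-pos j _ (room n k l j e 2k≤n))

    -- Level 3 gives equality, by the choice of A and B. From one level to the next the modulus of
    -- the eigenvalue is multiplied by (j + 1)/x with x = n - l - k for the lower level l, and j + 1
    -- ≤ x by `room`.
    bound : ∀ l j → j ℕ.+ suc (suc (suc l)) ≡ k → A * falling (+ n - + suc (suc (suc l)) - + k) j ≤ B * + (j !)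
    bound zero j e = ℤ.≤-reflexive (trans (cong (λ z → (a - + 2) * z * falling (+ n - + 3 - + k) j) k!) (trans
        (re (a - + 2) (+ k) (+ suc m) (+ m) (+ (j !)) (falling (+ n - + 3 - + k) j))
        (cong (λ z → q₃ * z * + (j !)) (sym p₂≡))))
      where
      m≡ : m ≡ suc j
      m≡ = ℕ.suc-injective (ℕ.suc-injective (trans (sym e) (ℕ.+-comm j 3)))
      m! : + (m !) ≡ + m * + (j !)
      m! = trans (cong (λ t → + (t !)) m≡) (trans (!-suc j) (cong (λ t → + t * + (j !)) (sym m≡)))
      k! : + (k !) ≡ + k * (+ suc m * (+ m * + (j !)))
      k! = trans (!-suc (suc m)) (cong (+ k *_) (trans (!-suc m) (cong (+ suc m *_) m!)))
      p₂≡ : p₂ ≡ (a - + 2) * falling (+ n - + 3 - + k) j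
      p₂≡ = trans (cong (falling (+ n - + 2 - + k)) m≡) (cong₂ (λ x z → x * falling z j) (r₁ (+ n) (+ k)) (r₂ (+ n) (+ k)))
        where
        r₁ : ∀ n k → n - + 2 - k ≡ n - k - + 2
        r₁ = solve-∀
        r₂ : ∀ n k → n - + 2 - k - + 1 ≡ n - + 3 - k
        r₂ = solve-∀
      re : ∀ x k l m f p → x * (k * (l * (m * f))) * p ≡ k * (l * m) * (x * p) * f
      re = solve-∀
    bound (suc l) j e = ℤ.*-cancelˡ-≤-pos _ _ (+ suc j)
      (ℤ.≤-trans (ℤ.*-monoʳ-≤-nonNeg (A * F) {{nonNegative (*-nonneg A≥0 (falling-nonneg (suc (suc (suc (suc l)))) j e))}} j<x)
      (ℤ.≤-trans (ℤ.≤-reflexive (trans (r₁ x A F) (cong (λ z → A * (x * falling z j)) (sym (r₂ (+ n) (+ suc (suc (suc l))) (+ k))))))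
      (ℤ.≤-trans (bound l (suc j) e′) (ℤ.≤-reflexive (trans (cong (B *_) (!-suc j)) (r₃ B (+ suc j) (+ (j !))))))))
      where
      F = falling (+ n - + suc (suc (suc (suc l))) - + k) j
      x = + n - + suc (suc (suc l)) - + k
      e′ : suc j ℕ.+ suc (suc (suc l)) ≡ k
      e′ = trans (sym (ℕ.+-suc j _)) e
      j<x : + suc j ≤ x
      j<x = room n k (suc (suc (suc l))) (suc j) e′ 2k≤n
      r₁ : ∀ x a f → x * (a * f) ≡ a * (x * f)
      r₁ = solve-∀
      r₂ : ∀ n l k → n - l - k - + 1 ≡ n - (+ 1 + l) - k
      r₂ = solve-∀
      r₃ : ∀ b s f → b * (s * f) ≡ s * (b * f)
      r₃ = solve-∀

    eigenvalue≥0 : ∀ l j → j ℕ.+ suc (suc l) ≡ k →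
      0ℤ ≤ A * (ε (suc (suc l)) * falling (+ n - + suc (suc l) - + k) j) + B * + (j !)
    eigenvalue≥0 zero j e = ℤ.+-mono-≤ (*-nonneg A≥0 (subst (0ℤ ≤_) (sym (ℤ.*-identityˡ _)) (falling-nonneg 2 j e)))
      (*-nonneg (*-nonneg q₃≥0 (ℤ.<⇒≤ p₂>0)) (+≤+ ℕ.z≤n))
    eigenvalue≥0 (suc l) j e = subst (0ℤ ≤_) (cong (_+ B * + (j !)) (re (ε (suc (suc (suc l)))) A _))
      (ε-bound (suc (suc (suc l))) (*-nonneg A≥0 (falling-nonneg (suc (suc (suc l))) j e)) (bound l j e))
      where re : ∀ e a f → e * (a * f) ≡ a * (e * f)
            re = solve-∀

    open Positivity k 2k≤n A B eigenvalue≥0 public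

    -- Restates `Q-eigen` for the closed formula u instead of `U^ j h`, with j! cancelled from the
    -- eigenvalue.
    eigenfunction : ∀ l j {h u : Fun n} c → j ℕ.+ l ≡ k → Rk (+ l) h → Harmonic h → U^ j h ≈ + (j !) ⊙ u →
      A * (ε l * falling (+ n - + l - + k) j) + B * + (j !) ≡ + (j !) * c →
      ∀ {g} → Rk (+ k) g → Q u g ≡ c * I u g
    eigenfunction l j {h} {u} c e r H up ec {g} rg = cancel-≡ (*-pos (!>0 j) (!>0 j))
      (trans (r₁ (+ (j !)) (Q u g))
      (trans (cong (+ (j !) *_) (sym (trans (Q-cong up (λ _ → refl)) (Q-⊙ (+ (j !)) u g))))
      (trans (Q-eigen l j e r H rg)
      (trans (cong₂ _*_ ec (trans (I-cong up (λ _ → refl)) (I-⊙ (+ (j !)) u g)))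
             (r₂ (+ (j !)) c (I u g))))))
      where
      r₁ : ∀ f q → f * f * q ≡ f * (f * q)
      r₁ = solve-∀
      r₂ : ∀ f c i → f * c * (f * i) ≡ f * f * (c * i)
      r₂ = solve-∀

    -- The eigenvalues on levels 0, 1 and 2 without their common factor p₂. The factor a - 2 in A is
    -- what makes p₂ common, and it avoids an exponent k - 3, so that k = 2 needs no separate
    -- treatment.
    h₀ h₁ h₂ : ℤ
    h₀ = a * (a - + 1) * (a - + 2) + q₃
    h₁ = q₃ - + k * (a - + 1) * (a - + 2)
    h₂ = q₃ + + k * + suc m * (a - + 2)

    one : Fun n
    one = at k 𝟏

    Q-one : ∀ {g} → Rk (+ k) g → Q one g ≡ p₂ * h₀ * I one g
    Q-one = eigenfunction 0 k (p₂ * h₀) (ℕ.+-identityʳ k) (Rk-at 0 𝟏) harmonic-𝟏 (raise-𝟏 k)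
      (trans (cong (λ z → A * (1ℤ * ((+ n - + 0 - + k) * ((+ n - + 0 - + k - + 1) * falling z m))) + B * + (k !)) (r₁ (+ n) (+ k)))
             (r₂ (+ n) (+ k) (+ (k !)) p₂ q₃))
      where
      r₁ : ∀ n k → n - + 0 - k - + 1 - + 1 ≡ n - + 2 - k
      r₁ = solve-∀
      r₂ : ∀ n k f p q → (n - k - + 2) * f * (+ 1 * ((n - + 0 - k) * ((n - + 0 - k - + 1) * p))) + q * p * f ≡
           f * (p * ((n - k) * (n - k - + 1) * (n - k - + 2) + q))
      r₂ = solve-∀

    module Level (w : Fin n → ℤ) (W : ∑ w ≡ 0ℤ) where

      open Quadratic w W public

      X y′ : Fun n
      X = at k (p1 w)
      y′ = at k (y m)

      Q-X : ∀ {g} → Rk (+ k) g → Q X g ≡ p₂ * h₁ * I X g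
      Q-X = eigenfunction 1 (suc m) (p₂ * h₁) (ℕ.+-comm (suc m) 1) (Rk-at 1 (p1 w)) (harmonic-p1 w W) (raise-p1 w (suc m))
        (trans (cong₂ (λ f z → (a - + 2) * f * (- 1ℤ * ((+ n - + 1 - + k) * falling z m)) + B * + (suc m !)) (!-suc (suc m)) (r₁ (+ n) (+ k)))
               (r₂ (+ n) (+ k) (+ (suc m !)) p₂ q₃))
        where
        r₁ : ∀ n k → n - + 1 - k - + 1 ≡ n - + 2 - k
        r₁ = solve-∀
        r₂ : ∀ n k f p q → (n - k - + 2) * (k * f) * (- + 1 * ((n - + 1 - k) * p)) + q * p * f ≡
             f * (p * (q - k * (n - k - + 1) * (n - k - + 2)))
        r₂ = solve-∀

      Q-y : ∀ {g} → Rk (+ k) g → Q y′ g ≡ p₂ * h₂ * I y′ g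
      Q-y = eigenfunction 2 m (p₂ * h₂) (ℕ.+-comm m 2) (Rk-at 2 (y 0)) harmonic-y (raise-y m)
        (trans (cong (λ f → (a - + 2) * f * (1ℤ * p₂) + B * + (m !)) (trans (!-suc (suc m)) (cong (+ k *_) (!-suc m))))
               (r₂ (a - + 2) (+ k) (+ suc m) (+ (m !)) p₂ q₃))
        where
        r₂ : ∀ x k l f p q → x * (k * (l * f)) * (+ 1 * p) + q * p * f ≡ f * (p * (q + k * l * x))
        r₂ = solve-∀

      -- `bal` says that α f and r agree on levels 0 and 1. The coefficient β₂ is free: subtracting
      -- β₂ y′ bounds the level 2 part from below, as Cauchy-Schwarz would, without dividing by the
      -- norm of y′.
      module Test (n≥2 : 2 ℕ.≤ n) (f : Fun n) (rf : Rk (+ k) f) (Kff : K f f ≡ 0ℤ)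
        (α β₀ β₁ β₂ : ℤ)
        (bal : ∀ v → α * I f (at k (p1 v)) ≡ β₀ * I one (at k (p1 v)) + β₁ * I X (at k (p1 v))) where

        r g : Fun n
        r = β₀ ⊙ one ⊕ β₁ ⊙ X ⊕ β₂ ⊙ y′
        g = α ⊙ f ⊕ (- + 1) ⊙ r

        rr : Rk (+ k) r
        rr = Rk-⊕ (+ k) (Rk-⊕ (+ k) (Rk-⊙ (+ k) β₀ (Rk-at k 𝟏)) (Rk-⊙ (+ k) β₁ (Rk-at k (p1 w)))) (Rk-⊙ (+ k) β₂ (Rk-at k (y m)))

        rg : Rk (+ k) g
        rg = Rk-⊕ (+ k) (Rk-⊙ (+ k) α rf) (Rk-⊙ (+ k) (- + 1) rr)

        I-r : ∀ x → I r x ≡ β₀ * I one x + β₁ * I X x + β₂ * I y′ x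
        I-r x = trans (I-⊕ (β₀ ⊙ one ⊕ β₁ ⊙ X) (β₂ ⊙ y′) x)
          (cong₂ _+_ (trans (I-⊕ (β₀ ⊙ one) (β₁ ⊙ X) x) (cong₂ _+_ (I-⊙ β₀ one x) (I-⊙ β₁ X x))) (I-⊙ β₂ y′ x))

        Q-r : ∀ {x} → Rk (+ k) x → Q r x ≡ p₂ * (β₀ * (h₀ * I one x) + β₁ * (h₁ * I X x) + β₂ * (h₂ * I y′ x))
        Q-r {x} rx = trans (Q-⊕ (β₀ ⊙ one ⊕ β₁ ⊙ X) (β₂ ⊙ y′) x)
          (trans (cong₂ _+_ (trans (Q-⊕ (β₀ ⊙ one) (β₁ ⊙ X) x)
              (cong₂ _+_ (trans (Q-⊙ β₀ one x) (cong (β₀ *_) (Q-one rx))) (trans (Q-⊙ β₁ X x) (cong (β₁ *_) (Q-X rx)))))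
              (trans (Q-⊙ β₂ y′ x) (cong (β₂ *_) (Q-y rx))))
            (re p₂ β₀ β₁ β₂ h₀ h₁ h₂ (I one x) (I X x) (I y′ x)))
          where re : ∀ p b₀ b₁ b₂ c₀ c₁ c₂ i₀ i₁ i₂ → b₀ * (p * c₀ * i₀) + b₁ * (p * c₁ * i₁) + b₂ * (p * c₂ * i₂) ≡
                     p * (b₀ * (c₀ * i₀) + b₁ * (c₁ * i₁) + b₂ * (c₂ * i₂))
                re = solve-∀

        k-one : at k (p1 (λ _ → 1ℤ)) ≈ + k ⊙ one
        k-one S = trans (at-cong k {P′ = + k ⊙ 𝟏} (λ T e → trans (p1-const T) (trans (cong +_ e) (sym (ℤ.*-identityʳ _)))) S)
                        (at-⊙ k (+ k) 𝟏 S)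

        -- The constant weight gives k on every set of size k, so testing against all `p1 v` covers
        -- level 0 as well.
        from-p1 : ∀ u → I u (at k (p1 (λ _ → 1ℤ))) ≡ 0ℤ → I u one ≡ 0ℤ
        from-p1 u z = cancel-≡ {+ k} (+<+ ℕ.z<s)
          (trans (sym (I-⊙ʳ (+ k) u one)) (trans (I-cong {f = u} (λ _ → refl) (λ S → sym (k-one S))) (trans z (sym (ℤ.*-zeroʳ (+ k))))))

        yp : ∀ v → I y′ (at k (p1 v)) ≡ 0ℤ
        yp = y-p1-orthogonal m

        n[n-1]>0 : 0ℤ < + n * (+ n - + 1)
        n[n-1]>0 = *-pos (+<+ (ℕ.<-≤-trans ℕ.z<s n≥2)) (diff-pos (+<+ n≥2))

        y1 : I y′ one ≡ 0ℤ
        y1 = from-p1 y′ (yp _)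

        X1 : I X one ≡ 0ℤ
        X1 = from-p1 X (cancel-≡ n[n-1]>0 (trans (p1-norm (suc m) w (λ _ → 1ℤ) W)
          (trans (cong (+ k * (+ n - + k) * I one one *_) (trans (∑-cong (λ i → ℤ.*-identityʳ (w i))) W))
          (trans (ℤ.*-zeroʳ (+ k * (+ n - + k) * I one one)) (sym (ℤ.*-zeroʳ (+ n * (+ n - + 1))))))))

        I-one-r : I one r ≡ β₀ * I one one
        I-one-r = trans (I-comm one r) (trans (I-r one) (trans (cong₂ (λ x z → β₀ * I one one + β₁ * x + β₂ * z) X1 y1) (re (β₀ * I one one) β₁ β₂)))
          where re : ∀ x b c → x + b * + 0 + c * + 0 ≡ x
                re = solve-∀

        I-X-r : I X r ≡ β₁ * I X X
        I-X-r = trans (I-comm X r) (trans (I-r X) (trans (cong₂ (λ x z → β₀ * x + β₁ * I X X + β₂ * z) (trans (I-comm one X) X1) (yp w)) (re (β₁ * I X X) β₀ β₂)))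
          where re : ∀ x b c → b * + 0 + x + c * + 0 ≡ x
                re = solve-∀

        I-y-r : I y′ r ≡ β₂ * I y′ y′
        I-y-r = trans (I-comm y′ r) (trans (I-r y′) (trans (cong₂ (λ x z → β₀ * x + β₁ * z + β₂ * I y′ y′) (trans (I-comm one y′) y1) (trans (I-comm X y′) (yp w))) (re (β₂ * I y′ y′) β₀ β₁)))
          where re : ∀ x b c → b * + 0 + c * + 0 + x ≡ x
                re = solve-∀

        g-levels : ∀ v → I g (at k (p1 v)) ≡ 0ℤ
        g-levels v = trans (I-⊕ (α ⊙ f) ((- + 1) ⊙ r) z)
          (trans (cong₂ _+_ (trans (I-⊙ α f z) (bal v)) (trans (I-⊙ (- + 1) r z) (cong ((- + 1) *_) (trans (I-r z) (cong (λ t → β₀ * I one z + β₁ * I X z + β₂ * t) (yp v))))))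
                 (re (β₀ * I one z + β₁ * I X z) β₂))
          where
          z = at k (p1 v)
          re : ∀ x b → x + (- + 1) * (x + b * + 0) ≡ + 0
          re = solve-∀

        -- `Q g g` expanded and divided by p₂. Since K f f = 0, only the shift survives in `Q f f`;
        -- the inner products of r with its three summands are diagonal.
        inequality : 0ℤ ≤ α * α * (q₃ * I f f)
          - + 2 * α * (β₀ * (h₀ * I one f) + β₁ * (h₁ * I X f) + β₂ * (h₂ * I y′ f))
          + (β₀ * (h₀ * (β₀ * I one one)) + β₁ * (h₁ * (β₁ * I X X)) + β₂ * (h₂ * (β₂ * I y′ y′)))
        inequality = cancel-pos p₂>0 (subst (0ℤ ≤_) expand
            (Q-nonneg (suc m) 0 refl g rg (D^-vanish (suc m) g rg g-levels)))
          where
          Qff : Q f f ≡ q₃ * p₂ * I f f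
          Qff = trans (cong (λ t → A * t + B * I f f) Kff) (trans (cong (_+ B * I f f) (ℤ.*-zeroʳ A)) (ℤ.+-identityˡ _))
          S₁ = β₀ * (h₀ * I one f) + β₁ * (h₁ * I X f) + β₂ * (h₂ * I y′ f)
          S₂ = β₀ * (h₀ * (β₀ * I one one)) + β₁ * (h₁ * (β₁ * I X X)) + β₂ * (h₂ * (β₂ * I y′ y′))
          Qrr : Q r r ≡ p₂ * S₂
          Qrr = trans (Q-r rr) (cong (p₂ *_) (cong₂ _+_ (cong₂ (λ x z → β₀ * (h₀ * x) + β₁ * (h₁ * z)) I-one-r I-X-r) (cong (λ x → β₂ * (h₂ * x)) I-y-r)))
          expand : Q g g ≡ p₂ * (α * α * (q₃ * I f f) - + 2 * α * S₁ + S₂)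
          expand = trans (Q-⊕ (α ⊙ f) ((- + 1) ⊙ r) g)
            (trans (cong₂ _+_ (trans (Q-⊙ α f g) (cong (α *_) Qfg)) (trans (Q-⊙ (- + 1) r g) (cong ((- + 1) *_) Qrg)))
                   (re p₂ α q₃ (I f f) S₁ S₂))
            where
            Qfg : Q f g ≡ α * (q₃ * p₂ * I f f) + (- + 1) * (p₂ * S₁)
            Qfg = trans (Q-⊕ʳ f (α ⊙ f) ((- + 1) ⊙ r)) (cong₂ _+_ (trans (Q-⊙ʳ α f f) (cong (α *_) Qff))
                    (trans (Q-⊙ʳ (- + 1) f r) (cong ((- + 1) *_) (trans (Q-comm f r) (Q-r rf)))))
            Qrg : Q r g ≡ α * (p₂ * S₁) + (- + 1) * (p₂ * S₂)
            Qrg = trans (Q-⊕ʳ r (α ⊙ f) ((- + 1) ⊙ r)) (cong₂ _+_ (trans (Q-⊙ʳ α r f) (cong (α *_) (Q-r rf)))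
                    (trans (Q-⊙ʳ (- + 1) r r) (cong ((- + 1) *_) Qrr)))
            re : ∀ p a q i s t → a * (a * (q * p * i) + (- + 1) * (p * s)) + (- + 1) * (a * (p * s) + (- + 1) * (p * t)) ≡
                 p * (a * a * (q * i) - + 2 * a * s + t)
            re = solve-∀

  -- Up to positive factors, the discriminant of the quadratic polynomial in s of stepE below.
  slope constant discr : ℤ → ℤ → ℤ
  slope n k = + 128 * n * (n - + 1) * (n - k - + 1) * (n - + 2 * k)
          + + 3 * (n - + 4) * ((n - + 1) * (+ 13 * ((n - + 2 * k) * (n - + 2 * k)) + + 32 * (n - + 2 * k) * k) + + 32 * n * (k * (k - + 1)))
  constant n k = n * (+ 8 * n - + 35) + + 27 * ((n - + 2 * k) * (n - + 2 * k))
  discr n k = (n - + 4) * (+ 5 * ((n - + 1) * (n - + 2)) - + 3) * n * ((n - k) * (n - k - + 1)) * (n - + 2) * constant n k * + 512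
          - + 3 * (n - + 3) * (slope n k * slope n k)

  -- Wrapped so that discr is never unfolded at concrete arguments.
  data Discr⁺ (n k : ℤ) : Set where
    discr⁺ : 0ℤ < discr n k → Discr⁺ n k

  -- From the spectral inequality to a quadratic inequality in s

  module Arithmetic (n m N s x z b₁ b₂ B₀ R q c₃ X₂ P : ℤ) where

    -- The form is evaluated on α f − β₀ − β₁ X − β₂ y.  The ratios β₀ / α and β₁ / α are forced by orthogonality
    -- to levels 0 and 1; β₂ / α is 3/4 of the value natural for p = k/n → 0, which is close to optimal.
    k l a d q₃ Ψ h₀ h₁ h₂ T α β₀ β₁ β₂ : ℤ
    k = + 1 + (+ 1 + m)
    l = + 1 + m
    a = n - k
    d = n - + 2 * k
    q₃ = k * (l * m)
    Ψ = ((n - + 1) * (n - + 2) + + 1) * (s * s) - n * (n - + 1) * q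
    h₀ = a * (a - + 1) * (a - + 2) + q₃
    h₁ = q₃ - k * (a - + 1) * (a - + 2)
    h₂ = q₃ + k * l * (a - + 2)
    T = k * a * (l * (a - + 1))
    α = + 8 * n * N * T * B₀
    β₀ = + 8 * n * N * N * T
    β₁ = + 8 * n * N * (n - + 1) * (l * (a - + 1))
    β₂ = + 3 * (n - + 3)

    module Contradiction
      (n>4 : 0ℤ < n - + 4) (m≥0 : 0ℤ ≤ m) (a>1 : 0ℤ < a - + 1) (N>0 : 0ℤ < N) (B₀>0 : 0ℤ < B₀)
      (spectral : 0ℤ ≤ α * α * (q₃ * N) - + 2 * α * (β₀ * (h₀ * N) + β₁ * (h₁ * x) + β₂ * (h₂ * z))
                + (β₀ * (h₀ * (β₀ * B₀)) + β₁ * (h₁ * (β₁ * b₁)) + β₂ * (h₂ * (β₂ * b₂))))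
      (nx : n * x ≡ s)
      (nb₁ : n * (n - + 1) * b₁ ≡ k * a * B₀ * s)
      (nb₂ : n * (n - + 1) * ((n - + 2) * (n - + 3)) * b₂ ≡
             k * a * ((k - + 1) * (a - + 1)) * B₀ * (+ 2 * ((n - + 1) * (n - + 2)) * Ψ))
      (nR : n * (n - + 1) * (n - + 2) * R ≡ q₃ * B₀)
      (large : + 36 * R ≤ N)
      (nz : z ≡ (n - + 1) * ((n - + 2) * X₂ - d * P) - k * l * s * N)
      (nP : n * P ≡ c₃ + k * N * s)
      (cauchy : s * s ≤ n * n * N * X₂)
      (cubic : + 4 * (+ 8 * d * N * c₃ - + 3 * q) ≤ + 13 * (d * d) * (N * N) * s)
      (discr>0 : Discr⁺ n k)
      where

      private
        unwrap : Discr⁺ n k → 0ℤ < discr n k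
        unwrap (discr⁺ p) = p
        shift : ∀ {i} j → 0ℤ < i → 0ℤ ≤ j → 0ℤ < j + i
        shift j p q = ℤ.+-mono-≤-< q p

        n-1 : 0ℤ < n - + 1
        n-1 = subst (0ℤ <_) (re n) (shift (+ 3) n>4 (+≤+ ℕ.z≤n))
          where re : ∀ n → + 3 + (n - + 4) ≡ n - + 1
                re = solve-∀
        n-2 : 0ℤ < n - + 2
        n-2 = subst (0ℤ <_) (re n) (shift (+ 2) n>4 (+≤+ ℕ.z≤n))
          where re : ∀ n → + 2 + (n - + 4) ≡ n - + 2
                re = solve-∀
        n-3 : 0ℤ < n - + 3
        n-3 = subst (0ℤ <_) (re n) (shift (+ 1) n>4 (+≤+ ℕ.z≤n))
          where re : ∀ n → + 1 + (n - + 4) ≡ n - + 3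
                re = solve-∀
        n>0 : 0ℤ < n
        n>0 = subst (0ℤ <_) (re n) (shift (+ 4) n>4 (+≤+ ℕ.z≤n))
          where re : ∀ n → + 4 + (n - + 4) ≡ n
                re = solve-∀
        a>0 : 0ℤ < a
        a>0 = subst (0ℤ <_) (re a) (shift (+ 1) a>1 (+≤+ ℕ.z≤n))
          where re : ∀ n → + 1 + (n - + 1) ≡ n
                re = solve-∀
        l>0 : 0ℤ < l
        l>0 = ℤ.+-mono-<-≤ {0ℤ} {1ℤ} (+<+ ℕ.z<s) m≥0
        k>0 : 0ℤ < k
        k>0 = ℤ.+-mono-<-≤ {0ℤ} {1ℤ} (+<+ ℕ.z<s) (ℤ.<⇒≤ l>0)
        T>0 : 0ℤ < T
        T>0 = *-pos (*-pos k>0 a>0) (*-pos l>0 a>1)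
        8>0 : 0ℤ < + 8
        8>0 = +<+ ℕ.z<s
        4>0 : 0ℤ < + 4
        4>0 = +<+ ℕ.z<s
        α>0 : 0ℤ < α
        α>0 = *-pos (*-pos (*-pos (*-pos 8>0 n>0) N>0) T>0) B₀>0

        β₀B₀ : β₀ * B₀ ≡ α * N
        β₀B₀ = re n N T B₀
          where re : ∀ n N T B → + 8 * n * N * N * T * B ≡ + 8 * n * N * T * B * N
                re = solve-∀

        β₁b₁ : β₁ * b₁ ≡ α * x
        β₁b₁ = trans (r₁ n N (l * (a - + 1)) b₁) (trans (cong (+ 8 * N * (l * (a - + 1)) *_) nb₁)
          (trans (cong (λ t → + 8 * N * (l * (a - + 1)) * (k * a * B₀ * t)) (sym nx)) (r₂ n N (l * (a - + 1)) (k * a) B₀ x)))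
          where
          r₁ : ∀ n N e b → + 8 * n * N * (n - + 1) * e * b ≡ + 8 * N * e * (n * (n - + 1) * b)
          r₁ = solve-∀
          r₂ : ∀ n N e f B x → + 8 * N * e * (f * B * (n * x)) ≡ + 8 * n * N * (f * e) * B * x
          r₂ = solve-∀

        u : ℤ
        u = + 4 * n * n * N

        β₂b₂ : u * (β₂ * b₂) ≡ + 3 * (α * Ψ)
        β₂b₂ = cancel-≡ (*-pos {+ 2} (+<+ ℕ.z<s) (*-pos n-1 n-2))
          (trans (r₁ n N b₂) (trans (cong (+ 24 * n * N *_) nb₂) (r₂ n N k l m a B₀ (+ 2 * ((n - + 1) * (n - + 2))) Ψ)))
          where
          r₁ : ∀ n N b → + 2 * ((n - + 1) * (n - + 2)) * (+ 4 * n * n * N * (+ 3 * (n - + 3) * b)) ≡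
               + 24 * n * N * (n * (n - + 1) * ((n - + 2) * (n - + 3)) * b)
          r₁ = solve-∀
          r₂ : ∀ n N _ _ m a B t Ψ → + 24 * n * N * ((+ 1 + (+ 1 + m)) * a * (((+ 1 + (+ 1 + m)) - + 1) * (a - + 1)) * B * (t * Ψ)) ≡
               t * (+ 3 * (+ 8 * n * N * ((+ 1 + (+ 1 + m)) * a * ((+ 1 + m) * (a - + 1))) * B * Ψ))
          r₂ = solve-∀

        -- By the three identities above, every quadratic term of `spectral` becomes a multiple of α
        -- after multiplication by u, so one factor α cancels. On levels 0 and 1 the square term
        -- eats half of the mixed term, as for a projection.
        stepB : 0ℤ ≤ u * (α * (q₃ * N) - β₀ * (h₀ * N) - β₁ * (h₁ * x) - + 2 * (β₂ * (h₂ * z))) + + 3 * (β₂ * (h₂ * Ψ))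
        stepB = cancel-pos α>0 (subst (0ℤ ≤_) eq (*-nonneg (ℤ.<⇒≤ (*-pos (*-pos (*-pos 4>0 n>0) n>0) N>0)) spectral))
          where
          r₁ : ∀ u α β₀ β₁ β₂ h₀ h₁ h₂ w x z N t → u * (α * α * w - + 2 * α * (β₀ * (h₀ * N) + β₁ * (h₁ * x) + β₂ * (h₂ * z))
                 + (β₀ * (h₀ * (α * N)) + β₁ * (h₁ * (α * x)) + β₂ * (h₂ * t))) ≡
               α * (u * (α * w - β₀ * (h₀ * N) - β₁ * (h₁ * x) - + 2 * (β₂ * (h₂ * z)))) + β₂ * (h₂ * (u * t))
          r₁ = solve-∀
          r₂ : ∀ α E b h Ψ → α * E + b * (h * (+ 3 * (α * Ψ))) ≡ α * (E + + 3 * (b * (h * Ψ)))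
          r₂ = solve-∀
          E : ℤ
          E = u * (α * (q₃ * N) - β₀ * (h₀ * N) - β₁ * (h₁ * x) - + 2 * (β₂ * (h₂ * z)))
          eq : u * (α * α * (q₃ * N) - + 2 * α * (β₀ * (h₀ * N) + β₁ * (h₁ * x) + β₂ * (h₂ * z))
                + (β₀ * (h₀ * (β₀ * B₀)) + β₁ * (h₁ * (β₁ * b₁)) + β₂ * (h₂ * (β₂ * b₂)))) ≡ α * (E + + 3 * (β₂ * (h₂ * Ψ)))
          eq = trans (cong₂ (λ e f → u * (α * α * (q₃ * N) - + 2 * α * (β₀ * (h₀ * N) + β₁ * (h₁ * x) + β₂ * (h₂ * z))
                       + (β₀ * (h₀ * e) + β₁ * (h₁ * f) + β₂ * (h₂ * (β₂ * b₂))))) β₀B₀ β₁b₁)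
               (trans (r₁ u α β₀ β₁ β₂ h₀ h₁ h₂ (q₃ * N) x z N (β₂ * b₂))
               (trans (cong (λ t → α * E + β₂ * (h₂ * t)) β₂b₂) (r₂ α E β₂ h₂ Ψ)))

        M₃ : ℤ
        M₃ = n * (n - + 1) * (n - + 2)

        -- Here the lower bound on N enters: the cost of the shift becomes comparable with level 0.
        αq₃ : + 36 * (α * (q₃ * N)) ≤ β₀ * (M₃ * N)
        αq₃ = ℤ.≤-trans (ℤ.≤-reflexive (trans (r₁ n N T B₀ q₃) (trans (cong (+ 36 * (+ 8 * n * N * T * N) *_) (sym nR)) (r₂ n N T M₃ R))))
          (ℤ.≤-trans (ℤ.*-monoˡ-≤-nonNeg (+ 8 * n * N * T * N * M₃) {{nonNegative (ℤ.<⇒≤ (*-pos (*-pos (*-pos (*-pos (*-pos 8>0 n>0) N>0) T>0) N>0) (*-pos (*-pos n>0 n-1) n-2)))}} large)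
          (ℤ.≤-reflexive (r₃ n N T M₃)))
          where
          r₁ : ∀ n N T B q → + 36 * (+ 8 * n * N * T * B * (q * N)) ≡ + 36 * (+ 8 * n * N * T * N) * (q * B)
          r₁ = solve-∀
          r₂ : ∀ n N T M R → + 36 * (+ 8 * n * N * T * N) * (M * R) ≡ + 8 * n * N * T * N * M * (+ 36 * R)
          r₂ = solve-∀
          r₃ : ∀ n N T M → + 8 * n * N * T * N * M * N ≡ + 8 * n * N * N * T * (M * N)
          r₃ = solve-∀

        -- `stepB` times 36, so that `αq₃` applies, and divided by the 4 of u; hence 27 = 36·3/4.
        stepC : 0ℤ ≤ n * n * N * (β₀ * (N * (M₃ - + 36 * h₀)) - + 36 * (β₁ * (h₁ * x)) - + 72 * (β₂ * (h₂ * z))) + + 27 * (β₂ * (h₂ * Ψ))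
        stepC = cancel-pos 4>0 (ℤ.≤-trans (*-nonneg {+ 36} (+≤+ ℕ.z≤n) stepB)
          (ℤ.≤-trans (ℤ.≤-reflexive (r₁ (n * n * N) n N (α * (q₃ * N)) (β₀ * (h₀ * N)) (β₁ * (h₁ * x)) (β₂ * (h₂ * z)) (β₂ * (h₂ * Ψ))))
          (ℤ.≤-trans (ℤ.+-monoˡ-≤ Z (ℤ.*-monoˡ-≤-nonNeg (+ 4 * n * n * N) {{nonNegative (ℤ.<⇒≤ (*-pos (*-pos (*-pos 4>0 n>0) n>0) N>0))}} αq₃))
          (ℤ.≤-reflexive (r₂ n N β₀ M₃ h₀ (β₁ * (h₁ * x)) (β₂ * (h₂ * z)) (β₂ * (h₂ * Ψ)))))))
          where
          Z : ℤ
          Z = + 4 * n * n * N * (- (+ 36 * (β₀ * (h₀ * N))) - + 36 * (β₁ * (h₁ * x)) - + 72 * (β₂ * (h₂ * z))) + + 108 * (β₂ * (h₂ * Ψ))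
          r₁ : ∀ _ n N A B Γ D E → + 36 * (+ 4 * n * n * N * (A - B - Γ - + 2 * D) + + 3 * E) ≡
               + 4 * n * n * N * (+ 36 * A) + (+ 4 * n * n * N * (- (+ 36 * B) - + 36 * Γ - + 72 * D) + + 108 * E)
          r₁ = solve-∀
          r₂ : ∀ n N β M h Γ D E → + 4 * n * n * N * (β * (M * N)) + (+ 4 * n * n * N * (- (+ 36 * (β * (h * N))) - + 36 * Γ - + 72 * D) + + 108 * E) ≡
               + 4 * (n * n * N * (β * (N * (M - + 36 * h)) - + 36 * Γ - + 72 * D) + + 27 * E)
          r₂ = solve-∀

        G : ℤ
        G = constant n k

        -- The origin of `constant`: what is left of level 0 after paying for the shift.
        h₀≡ : M₃ - + 36 * h₀ ≡ - ((n - + 2) * G)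
        h₀≡ = re n m
          where re : ∀ n m → n * (n - + 1) * (n - + 2) - + 36 * ((n - (+ 1 + (+ 1 + m))) * (n - (+ 1 + (+ 1 + m)) - + 1) * (n - (+ 1 + (+ 1 + m)) - + 2) + (+ 1 + (+ 1 + m)) * ((+ 1 + m) * m))
                     ≡ - ((n - + 2) * (n * (+ 8 * n - + 35) + + 27 * ((n - + 2 * (+ 1 + (+ 1 + m))) * (n - + 2 * (+ 1 + (+ 1 + m))))))
                re = solve-∀
        -- The negative eigenvalue is proportional to d = n - 2k, so level 1 does no harm near n =
        -- 2k.
        h₁≡ : h₁ ≡ - (k * d * (n - + 3))
        h₁≡ = re n m
          where re : ∀ n m → (+ 1 + (+ 1 + m)) * ((+ 1 + m) * m) - (+ 1 + (+ 1 + m)) * (n - (+ 1 + (+ 1 + m)) - + 1) * (n - (+ 1 + (+ 1 + m)) - + 2)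
                     ≡ - ((+ 1 + (+ 1 + m)) * (n - + 2 * (+ 1 + (+ 1 + m))) * (n - + 3))
                re = solve-∀
        h₂≡ : h₂ ≡ k * l * (n - + 4)
        h₂≡ = re n m
          where re : ∀ n m → (+ 1 + (+ 1 + m)) * ((+ 1 + m) * m) + (+ 1 + (+ 1 + m)) * (+ 1 + m) * (n - (+ 1 + (+ 1 + m)) - + 2)
                     ≡ (+ 1 + (+ 1 + m)) * (+ 1 + m) * (n - + 4)
                re = solve-∀

        -- All three levels share the factor k l, which cancels; `nx` replaces n x by s.
        stepD : 0ℤ ≤ n * n * N * (- (+ 8 * n * N * N * N * (a * (a - + 1)) * ((n - + 2) * G)) + + 288 * N * (n - + 1) * (n - + 3) * (a - + 1) * d * s)
                   - + 27 * ((n - + 3) * (n - + 4)) * (+ 8 * (n * n * N * z) - + 3 * Ψ)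
        stepD = cancel-pos (*-pos k>0 l>0) (subst (0ℤ ≤_) eq stepC)
          where
          r₁ : ∀ n N k l a d x z Ψ H → n * n * N * (+ 8 * n * N * N * (k * a * (l * (a - + 1))) * (N * (- H)) - + 36 * (+ 8 * n * N * (n - + 1) * (l * (a - + 1)) * (- (k * d * (n - + 3)) * x))
                 - + 72 * (+ 3 * (n - + 3) * (k * l * (n - + 4) * z))) + + 27 * (+ 3 * (n - + 3) * (k * l * (n - + 4) * Ψ)) ≡
               k * l * (n * n * N * (- (+ 8 * n * N * N * N * (a * (a - + 1)) * H) + + 288 * N * (n - + 1) * (n - + 3) * (a - + 1) * d * (n * x))
                   - + 27 * ((n - + 3) * (n - + 4)) * (+ 8 * (n * n * N * z) - + 3 * Ψ))
          r₁ = solve-∀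
          eq : n * n * N * (β₀ * (N * (M₃ - + 36 * h₀)) - + 36 * (β₁ * (h₁ * x)) - + 72 * (β₂ * (h₂ * z))) + + 27 * (β₂ * (h₂ * Ψ)) ≡
               k * l * (n * n * N * (- (+ 8 * n * N * N * N * (a * (a - + 1)) * ((n - + 2) * G)) + + 288 * N * (n - + 1) * (n - + 3) * (a - + 1) * d * s)
                   - + 27 * ((n - + 3) * (n - + 4)) * (+ 8 * (n * n * N * z) - + 3 * Ψ))
          eq = trans (cong₂ (λ h₁ h₂ → n * n * N * (β₀ * (N * (M₃ - + 36 * h₀)) - + 36 * (β₁ * (h₁ * x)) - + 72 * (β₂ * (h₂ * z))) + + 27 * (β₂ * (h₂ * Ψ))) h₁≡ h₂≡)
               (trans (cong (λ e → n * n * N * (β₀ * (N * e) - + 36 * (β₁ * (- (k * d * (n - + 3)) * x)) - + 72 * (β₂ * (k * l * (n - + 4) * z))) + + 27 * (β₂ * (k * l * (n - + 4) * Ψ))) h₀≡)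
               (trans (r₁ n N k l a d x z Ψ ((n - + 2) * G))
               (cong (λ t → k * l * (n * n * N * (- (+ 8 * n * N * N * N * (a * (a - + 1)) * ((n - + 2) * G)) + + 288 * N * (n - + 1) * (n - + 3) * (a - + 1) * d * t)
                   - + 27 * ((n - + 3) * (n - + 4)) * (+ 8 * (n * n * N * z) - + 3 * Ψ))) nx)))

        Z : ℤ
        Z = (n - + 1) * ((n - + 2) * (s * s) - d * (n * N * (c₃ + k * N * s))) - n * n * N * N * (k * l * s)

        Z≤ : Z ≤ n * n * N * z
        Z≤ = ℤ.≤-trans (ℤ.+-monoˡ-≤ (- (n * n * N * N * (k * l * s))) (ℤ.*-monoˡ-≤-nonNeg (n - + 1) {{nonNegative (ℤ.<⇒≤ n-1)}}
               (ℤ.+-monoˡ-≤ (- (d * (n * N * (c₃ + k * N * s)))) (ℤ.*-monoˡ-≤-nonNeg (n - + 2) {{nonNegative (ℤ.<⇒≤ n-2)}} cauchy))))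
             (ℤ.≤-reflexive (trans (cong (λ t → (n - + 1) * ((n - + 2) * (n * n * N * X₂) - d * (n * N * t)) - n * n * N * N * (k * l * s)) (sym nP))
               (trans (re n N d X₂ P (k * l) s) (cong (n * n * N *_) (sym nz)))))
          where re : ∀ n N d X P e s → (n - + 1) * ((n - + 2) * (n * n * N * X) - d * (n * N * (n * P))) - n * n * N * N * (e * s) ≡
                     n * n * N * ((n - + 1) * ((n - + 2) * X - d * P) - e * s * N)
                re = solve-∀

        E₅ L : ℤ
        E₅ = + 5 * ((n - + 1) * (n - + 2)) - + 3
        L = (n - + 1) * (+ 13 * (d * d) + + 32 * d * k) + + 32 * n * (k * (k - + 1))

        -- The coefficient of s² is 8(n-1)(n-2) from z less 3((n-1)(n-2) + 1) from Ψ, which is E₅.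
        -- The sums c₃ and q occur exactly in the combination 8dN c₃ - 3q that `cubic` bounds.
        bracket : + 4 * (s * s) * E₅ - s * (N * N) * n * L ≤ + 4 * (+ 8 * (n * n * N * z) - + 3 * Ψ)
        bracket = ℤ.≤-trans (ℤ.≤-trans (ℤ.≤-reflexive (r₁ n N d k s (s * s)))
            (ℤ.≤-trans (ℤ.+-monoʳ-≤ W (ℤ.neg-mono-≤ (ℤ.*-monoˡ-≤-nonNeg (n * (n - + 1)) {{nonNegative (ℤ.<⇒≤ (*-pos n>0 n-1))}} cubic)))
                       (ℤ.≤-reflexive (r₂ n N d m s q c₃))))
          (ℤ.*-monoˡ-≤-nonNeg (+ 4) (ℤ.+-monoˡ-≤ (- (+ 3 * Ψ)) (ℤ.*-monoˡ-≤-nonNeg (+ 8) Z≤)))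
          where
          W : ℤ
          W = + 4 * (s * s) * E₅ - s * (N * N) * n * ((n - + 1) * (+ 32 * d * k) + + 32 * n * (k * (k - + 1)))
          r₁ : ∀ n N d k s t → + 4 * t * (+ 5 * ((n - + 1) * (n - + 2)) - + 3) - s * (N * N) * n * ((n - + 1) * (+ 13 * (d * d) + + 32 * d * k) + + 32 * n * (k * (k - + 1))) ≡
               + 4 * t * (+ 5 * ((n - + 1) * (n - + 2)) - + 3) - s * (N * N) * n * ((n - + 1) * (+ 32 * d * k) + + 32 * n * (k * (k - + 1))) - n * (n - + 1) * (+ 13 * (d * d) * (N * N) * s)
          r₁ = solve-∀
          r₂ : ∀ n N d m s q c → + 4 * (s * s) * (+ 5 * ((n - + 1) * (n - + 2)) - + 3) - s * (N * N) * n * ((n - + 1) * (+ 32 * d * (+ 1 + (+ 1 + m))) + + 32 * n * ((+ 1 + (+ 1 + m)) * ((+ 1 + (+ 1 + m)) - + 1)))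
                 - n * (n - + 1) * (+ 4 * (+ 8 * d * N * c - + 3 * q)) ≡
               + 4 * (+ 8 * ((n - + 1) * ((n - + 2) * (s * s) - d * (n * N * (c + (+ 1 + (+ 1 + m)) * N * s))) - n * n * N * N * ((+ 1 + (+ 1 + m)) * (+ 1 + m) * s))
                 - + 3 * (((n - + 1) * (n - + 2) + + 1) * (s * s) - n * (n - + 1) * q))
          r₂ = solve-∀

        Γ b A M : ℤ
        Γ = + 32 * n * n * n * (a * (a - + 1)) * ((n - + 2) * G)
        b = + 9 * n * (n - + 3) * slope n k
        A = + 108 * ((n - + 3) * (n - + 4)) * E₅
        M = N * N

        stepE : 0ℤ ≤ - (Γ * (M * M)) + b * (M * s) - A * (s * s)
        stepE = ℤ.≤-trans (*-nonneg {+ 4} (+≤+ ℕ.z≤n) stepD)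
          (ℤ.≤-trans (ℤ.≤-reflexive (r₁ V ((n - + 3) * (n - + 4)) (+ 8 * (n * n * N * z) - + 3 * Ψ)))
          (ℤ.≤-trans (ℤ.+-monoʳ-≤ (+ 4 * V) (ℤ.neg-mono-≤ (ℤ.*-monoˡ-≤-nonNeg (+ 27 * ((n - + 3) * (n - + 4)))
                        {{nonNegative (*-nonneg {+ 27} (+≤+ ℕ.z≤n) (ℤ.<⇒≤ (*-pos n-3 n>4)))}} bracket)))
          (ℤ.≤-reflexive (r₂ n N a d s ((n - + 2) * G) k))))
          where
          V : ℤ
          V = n * n * N * (- (+ 8 * n * N * N * N * (a * (a - + 1)) * ((n - + 2) * G)) + + 288 * N * (n - + 1) * (n - + 3) * (a - + 1) * d * s)
          r₁ : ∀ V e t → + 4 * (V - + 27 * e * t) ≡ + 4 * V - + 27 * e * (+ 4 * t)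
          r₁ = solve-∀
          r₂ : ∀ n N a d s H k → + 4 * (n * n * N * (- (+ 8 * n * N * N * N * (a * (a - + 1)) * H) + + 288 * N * (n - + 1) * (n - + 3) * (a - + 1) * d * s))
                 - + 27 * ((n - + 3) * (n - + 4)) * (+ 4 * (s * s) * (+ 5 * ((n - + 1) * (n - + 2)) - + 3)
                     - s * (N * N) * n * ((n - + 1) * (+ 13 * (d * d) + + 32 * d * k) + + 32 * n * (k * (k - + 1)))) ≡
               - (+ 32 * n * n * n * (a * (a - + 1)) * H * (N * N * (N * N)))
               + + 9 * n * (n - + 3) * (+ 128 * n * (n - + 1) * (a - + 1) * d
                   + + 3 * (n - + 4) * ((n - + 1) * (+ 13 * (d * d) + + 32 * d * k) + + 32 * n * (k * (k - + 1)))) * (N * N * s)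
               - + 108 * ((n - + 3) * (n - + 4)) * (+ 5 * ((n - + 1) * (n - + 2)) - + 3) * (s * s)
          r₂ = solve-∀

        E₅>0 : 0ℤ < E₅
        E₅>0 = subst (0ℤ <_) (re n) (shift (+ 5 * ((n - + 1) * (n - + 3)) + (+ 5 * (n - + 4))) (+<+ {0} {12} ℕ.z<s)
            (ℤ.+-mono-≤ (*-nonneg {+ 5} (+≤+ ℕ.z≤n) (ℤ.<⇒≤ (*-pos n-1 n-3))) (*-nonneg {+ 5} (+≤+ ℕ.z≤n) (ℤ.<⇒≤ n>4))))
          where re : ∀ n → + 5 * ((n - + 1) * (n - + 3)) + + 5 * (n - + 4) + + 12 ≡ + 5 * ((n - + 1) * (n - + 2)) - + 3
                re = solve-∀

        A>0 : 0ℤ < A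
        A>0 = *-pos (*-pos {+ 108} (+<+ ℕ.z<s) (*-pos n-3 n>4)) E₅>0

        discriminant : + 4 * A * Γ - b * b ≡ + 27 * n * n * (n - + 3) * discr n k
        discriminant = re n E₅ (a * (a - + 1)) G (slope n k)
          where re : ∀ n E t G j → + 4 * (+ 108 * ((n - + 3) * (n - + 4)) * E) * (+ 32 * n * n * n * t * ((n - + 2) * G)) - + 9 * n * (n - + 3) * j * (+ 9 * n * (n - + 3) * j) ≡
                     + 27 * n * n * (n - + 3) * ((n - + 4) * E * n * t * (n - + 2) * G * + 512 - + 3 * (n - + 3) * (j * j))
                re = solve-∀

      -- Completing the square: -4A times the form of `stepE` is (4AΓ - b²)M² plus a square.
      contradictory : ⊥
      contradictory = ℤ.<⇒≱ (subst (0ℤ <_) (sym (re A b Γ s M)) pos) (ℤ.neg-mono-≤ (*-nonneg (ℤ.<⇒≤ (*-pos 4>0 A>0)) stepE))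
        where
        re : ∀ A b Γ s M → - (+ 4 * A * (- (Γ * (M * M)) + b * (M * s) - A * (s * s))) ≡
             (+ 4 * A * Γ - b * b) * (M * M) + (+ 2 * A * s - b * M) * (+ 2 * A * s - b * M)
        re = solve-∀
        pos : 0ℤ < (+ 4 * A * Γ - b * b) * (M * M) + (+ 2 * A * s - b * M) * (+ 2 * A * s - b * M)
        pos = ℤ.+-mono-<-≤ (*-pos (subst (0ℤ <_) (sym discriminant)
                (*-pos (*-pos (*-pos (*-pos {+ 27} (+<+ ℕ.z<s) n>0) n>0) n-3) (unwrap discr>0))) (*-pos (*-pos N>0 N>0) (*-pos N>0 N>0)))
              (square-nonneg (+ 2 * A * s - b * M))

  -- Positivity of the discriminant

  open Naturals

  private
    infixl 7 _⊗_
    infixl 6 _⊞_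
    _⊗_ : ∀ {a b x y} → + a ≡ x → + b ≡ y → + (a ℕ.* b) ≡ x * y
    _⊗_ {a} {b} p q = trans (ℤ.pos-* a b) (cong₂ _*_ p q)
    _⊞_ : ∀ {a b x y} → + a ≡ x → + b ≡ y → + (a ℕ.+ b) ≡ x + y
    p ⊞ q = cong₂ _+_ p q

  cast : ∀ ν m d {n k} → + (ν ℕ.+ 5) ≡ n → + (m ℕ.+ 2) ≡ k → + d ≡ n - + 2 * k →
         lower ν m d ℕ.< upper ν m d → Discr⁺ n k
  cast ν m d {n} {k} n₀ k₀ dd lt = discr⁺ (subst (0ℤ <_) (trans (cong₂ _-_ upper≡ lower≡) glue) (diff-pos (+<+ lt)))
    where
    n₁ : + (ν ℕ.+ 4) ≡ n - + 1
    n₁ = trans (re (+ ν)) (cong (_- + 1) n₀)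
      where re : ∀ v → v + + 4 ≡ v + + 5 - + 1
            re = solve-∀
    n₂ : + (ν ℕ.+ 3) ≡ n - + 2
    n₂ = trans (re (+ ν)) (cong (_- + 2) n₀)
      where re : ∀ v → v + + 3 ≡ v + + 5 - + 2
            re = solve-∀
    n₃ : + (ν ℕ.+ 2) ≡ n - + 3
    n₃ = trans (re (+ ν)) (cong (_- + 3) n₀)
      where re : ∀ v → v + + 2 ≡ v + + 5 - + 3
            re = solve-∀
    n₄ : + (ν ℕ.+ 1) ≡ n - + 4
    n₄ = trans (re (+ ν)) (cong (_- + 4) n₀)
      where re : ∀ v → v + + 1 ≡ v + + 5 - + 4
            re = solve-∀
    n₅ : + ν ≡ n - + 5
    n₅ = trans (re (+ ν)) (cong (_- + 5) n₀)
      where re : ∀ v → v ≡ v + + 5 - + 5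
            re = solve-∀
    k₁ : + (m ℕ.+ 1) ≡ k - + 1
    k₁ = trans (re (+ m)) (cong (_- + 1) k₀)
      where re : ∀ v → v + + 1 ≡ v + + 2 - + 1
            re = solve-∀
    a : + (m ℕ.+ d ℕ.+ 2) ≡ n - k
    a = trans (re (+ m) (+ d)) (trans (cong₂ _+_ k₀ dd) (re₂ n k))
      where
      re : ∀ m d → m + d + + 2 ≡ (m + + 2) + d
      re = solve-∀
      re₂ : ∀ n k → k + (n - + 2 * k) ≡ n - k
      re₂ = solve-∀
    a₁ : + (m ℕ.+ d ℕ.+ 1) ≡ n - k - + 1
    a₁ = trans (re (+ m) (+ d)) (cong (_- + 1) a)
      where re : ∀ m d → m + d + + 1 ≡ (m + d + + 2) - + 1
            re = solve-∀
    slope≡ : + slopeℕ ν m d ≡ slope n k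
    slope≡ = trans (n₀ ⊗ n₁ ⊗ a₁ ⊗ dd ⊗ refl ⊞
                  n₄ ⊗ (n₁ ⊗ (dd ⊗ dd ⊗ refl ⊞ dd ⊗ k₀ ⊗ refl) ⊞ n₀ ⊗ (k₀ ⊗ k₁) ⊗ refl) ⊗ refl)
      (re n (n - + 1) (n - k - + 1) (n - + 2 * k) (n - + 4) k (k - + 1))
      where
      re : ∀ n n₁ a₁ d n₄ k k₁ →
           n * n₁ * a₁ * d * + 128 + n₄ * (n₁ * (d * d * + 13 + d * k * + 32) + n * (k * k₁) * + 32) * + 3 ≡
           + 128 * n * n₁ * a₁ * d + + 3 * n₄ * (n₁ * (+ 13 * (d * d) + + 32 * d * k) + + 32 * n * (k * k₁))
      re = solve-∀
    upper≡ : + upper ν m d ≡ (n - + 4) * (n * (n - + 3) * + 5 + + 7) * n * ((n - k) * (n - k - + 1)) * (n - + 2) *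
               (n * ((n - + 5) * + 8 + + 5) + (n - + 2 * k) * (n - + 2 * k) * + 27) * + 512
    upper≡ = n₄ ⊗ (n₀ ⊗ n₃ ⊗ refl ⊞ refl) ⊗ n₀ ⊗ (a ⊗ a₁) ⊗ n₂ ⊗ (n₀ ⊗ (n₅ ⊗ refl ⊞ refl) ⊞ dd ⊗ dd ⊗ refl) ⊗ refl
    lower≡ : + lower ν m d ≡ (n - + 3) * (slope n k * slope n k) * + 3
    lower≡ = n₃ ⊗ (slope≡ ⊗ slope≡) ⊗ refl
    glue : (n - + 4) * (n * (n - + 3) * + 5 + + 7) * n * ((n - k) * (n - k - + 1)) * (n - + 2) *
             (n * ((n - + 5) * + 8 + + 5) + (n - + 2 * k) * (n - + 2 * k) * + 27) * + 512
           - (n - + 3) * (slope n k * slope n k) * + 3 ≡ discr n k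
    glue = cong₂ _-_
      (cong₂ (λ e g → (n - + 4) * e * n * ((n - k) * (n - k - + 1)) * (n - + 2) * g * + 512) (r₁ n) (r₂ n (n - + 2 * k)))
      (r₃ (n - + 3) (slope n k * slope n k))
      where
      r₁ : ∀ n → n * (n - + 3) * + 5 + + 7 ≡ + 5 * ((n - + 1) * (n - + 2)) - + 3
      r₁ = solve-∀
      r₂ : ∀ n d → n * ((n - + 5) * + 8 + + 5) + d * d * + 27 ≡ n * (+ 8 * n - + 35) + + 27 * (d * d)
      r₂ = solve-∀
      r₃ : ∀ x j → x * j * + 3 ≡ + 3 * x * j
      r₃ = solve-∀

  discr-pos : ∀ n m → 2 ℕ.* suc (suc m) ℕ.≤ n → 33 ℕ.≤ n ⊎ 2 ℕ.≤ m → Discr⁺ (+ n) (+ suc (suc m))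
  discr-pos = go
    where
    conv : ∀ ν m d {n k} → ν ℕ.+ 5 ≡ n → m ℕ.+ 2 ≡ k → 2 ℕ.* k ℕ.+ d ≡ n → lower ν m d ℕ.< upper ν m d → Discr⁺ (+ n) (+ k)
    conv ν m d {n} {k} n₀ k₀ e lt = cast ν m d (cong +_ n₀) (cong +_ k₀) d≡ lt
      where
      re : ∀ k d → d ≡ + 2 * k + d - + 2 * k
      re = solve-∀
      d≡ : + d ≡ + n - + 2 * + k
      d≡ = trans (re (+ k) (+ d)) (cong (_- + 2 * + k) (trans (cong (_+ + d) (sym (ℤ.pos-* 2 k))) (cong +_ e)))
    go : ∀ n m → 2 ℕ.* suc (suc m) ℕ.≤ n → 33 ℕ.≤ n ⊎ 2 ℕ.≤ m → Discr⁺ (+ n) (+ suc (suc m))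
    right : ∀ x a b → x ℕ.+ a ℕ.+ b ≡ a ℕ.+ b ℕ.+ x
    right x a b = trans (ℕ.+-assoc x a b) (ℕ.+-comm x (a ℕ.+ b))
    left : ∀ x a b → a ℕ.+ (x ℕ.+ b) ≡ a ℕ.+ b ℕ.+ x
    left x a b = trans (cong (a ℕ.+_) (ℕ.+-comm x b)) (sym (ℕ.+-assoc a b x))
    case-2 : ∀ {n} → (∃ λ x → 33 ℕ.+ x ≡ n) → Discr⁺ (+ n) (+ 2)
    case-2 (x , e) = conv (x ℕ.+ 28) 0 (x ℕ.+ 29) (trans (right x 28 5) e) refl (trans (left x 4 29) e) (k=2 x)
    case-3 : ∀ {n} → (∃ λ x → 33 ℕ.+ x ≡ n) → Discr⁺ (+ n) (+ 3)
    case-3 (x , e) = conv (x ℕ.+ 28) 1 (x ℕ.+ 27) (trans (right x 28 5) e) refl (trans (left x 6 27) e) (k=3 x)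
    case-4 : ∀ {n} → (∃ λ x → 8 ℕ.+ x ≡ n) → Discr⁺ (+ n) (+ 4)
    -- n = 8, 9, 10 lie below the range n = x + 11 of `k=4` and are settled by evaluation.
    case-4 (0 , e) = conv 3 2 0 e refl e (ℕ.<ᵇ⇒< (lower 3 2 0) (upper 3 2 0) _)
    case-4 (1 , e) = conv 4 2 1 e refl e (ℕ.<ᵇ⇒< (lower 4 2 1) (upper 4 2 1) _)
    case-4 (2 , e) = conv 5 2 2 e refl e (ℕ.<ᵇ⇒< (lower 5 2 2) (upper 5 2 2) _)
    case-4 (suc (suc (suc x)) , e) = conv (x ℕ.+ 6) 2 (x ℕ.+ 3) (trans (right x 6 5) e) refl (trans (left x 8 3) e) (k=4 x)
    case-5 : ∀ {n} x → (∃ λ y → 2 ℕ.* (5 ℕ.+ x) ℕ.+ y ≡ n) → Discr⁺ (+ n) (+ (5 ℕ.+ x))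
    case-5 x (y , e) = conv (x ℕ.+ x ℕ.+ y ℕ.+ 5) (x ℕ.+ 3) y (trans (e₁ x y) (trans (cong (λ t → 2 ℕ.* t ℕ.+ y) (ℕ.+-comm x 5)) e))
                    (trans (ℕ.+-assoc x 3 2) (ℕ.+-comm x 5)) e (k≥5 x y)
      where
      e₁ : ∀ x y → x ℕ.+ x ℕ.+ y ℕ.+ 5 ℕ.+ 5 ≡ 2 ℕ.* (x ℕ.+ 5) ℕ.+ y
      e₁ = solveℕ-∀
    go n 0 _ (inj₁ big) = case-2 (ℕ.m≤n⇒∃[o]m+o≡n big)
    go n 1 _ (inj₁ big) = case-3 (ℕ.m≤n⇒∃[o]m+o≡n big)
    go n 1 _ (inj₂ (ℕ.s≤s ()))
    go n 2 le _ = case-4 (ℕ.m≤n⇒∃[o]m+o≡n le)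
    go n (suc (suc (suc x))) le _ = case-5 x (ℕ.m≤n⇒∃[o]m+o≡n le)

  -- Indicator functions of families

  point : Subset n → Fun n
  point []          []          = 1ℤ
  point (false ∷ F) (false ∷ S) = point F S
  point (false ∷ F) (true ∷ S)  = 0ℤ
  point (true ∷ F)  (false ∷ S) = 0ℤ
  point (true ∷ F)  (true ∷ S)  = point F S

  point-support : (F S : Subset n) → point F S ≡ 0ℤ ⊎ F ≡ S
  point-support []          []          = inj₂ refl
  point-support (false ∷ F) (false ∷ S) with point-support F S
  ... | inj₁ z    = inj₁ z
  ... | inj₂ refl = inj₂ refl
  point-support (false ∷ F) (true ∷ S)  = inj₁ refl
  point-support (true ∷ F)  (false ∷ S) = inj₁ refl
  point-support (true ∷ F)  (true ∷ S) with point-support F S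
  ... | inj₁ z    = inj₁ z
  ... | inj₂ refl = inj₂ refl

  point-self : (F : Subset n) → point F F ≡ 1ℤ
  point-self []          = refl
  point-self (false ∷ F) = point-self F
  point-self (true ∷ F)  = point-self F

  I-point : (F : Subset n) (g : Fun n) → I (point F) g ≡ g F
  I-point []          g = ℤ.*-identityˡ (g [])
  I-point (false ∷ F) g = trans (cong₂ _+_ (I-point F (lo g)) (I-𝟎 (hi g))) (ℤ.+-identityʳ _)
  I-point (true ∷ F)  g = trans (cong₂ _+_ (I-𝟎 (lo g)) (I-point F (hi g))) (ℤ.+-identityˡ _)

  K-𝟎ʳ : (f : Fun n) → K f 𝟎 ≡ 0ℤ
  K-𝟎ʳ f = trans (K-comm f 𝟎) (K-𝟎 f)

  K-point : (F G : Subset n) → Nonempty (F ∩ G) → K (point F) (point G) ≡ 0ℤ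
  K-point {suc n} (false ∷ F) (false ∷ G) (suc i , there p) =
    cong₂ _+_ (cong₂ _+_ (K-point F G (i , p)) (K-𝟎ʳ (point F))) (K-𝟎 (point G))
  K-point {suc n} (false ∷ F) (true ∷ G)  (suc i , there p) =
    cong₂ _+_ (cong₂ _+_ (K-𝟎ʳ (point F)) (K-point F G (i , p))) (K-𝟎 {n} 𝟎)
  K-point {suc n} (true ∷ F)  (false ∷ G) (suc i , there p) =
    cong₂ _+_ (cong₂ _+_ (K-𝟎 (point G)) (K-𝟎 {n} 𝟎)) (K-point F G (i , p))
  K-point {suc n} (true ∷ F)  (true ∷ G)  _ =
    cong₂ _+_ (cong₂ _+_ (K-𝟎 {n} 𝟎) (K-𝟎 (point G))) (K-𝟎ʳ (point F))

  indicator : List (Subset n) → Fun n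
  indicator []      = 𝟎
  indicator (F ∷ 𝓕) = point F ⊕ indicator 𝓕

  sumₗ : {A : Set} → (A → ℤ) → List A → ℤ
  sumₗ g []      = 0ℤ
  sumₗ g (F ∷ 𝓕) = g F + sumₗ g 𝓕

  sumₗ-cong : {A : Set} (xs : List A) {g h : A → ℤ} → (∀ F → F ∈ₗ xs → g F ≡ h F) → sumₗ g xs ≡ sumₗ h xs
  sumₗ-cong []       e = refl
  sumₗ-cong (x ∷ xs) e = cong₂ _+_ (e x (here refl)) (sumₗ-cong xs (λ F p → e F (there p)))

  sumₗ-+ : {A : Set} (xs : List A) (g h : A → ℤ) → sumₗ (λ F → g F + h F) xs ≡ sumₗ g xs + sumₗ h xs
  sumₗ-+ []       g h = refl
  sumₗ-+ (x ∷ xs) g h = trans (cong (_+_ (g x + h x)) (sumₗ-+ xs g h)) (re (g x) (h x) (sumₗ g xs) (sumₗ h xs))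
    where re : ∀ a b c d → a + b + (c + d) ≡ (a + c) + (b + d)
          re = solve-∀

  sumₗ-⊙ : {A : Set} (xs : List A) (c : ℤ) (g : A → ℤ) → sumₗ (λ F → c * g F) xs ≡ c * sumₗ g xs
  sumₗ-⊙ []       c g = sym (ℤ.*-zeroʳ c)
  sumₗ-⊙ (x ∷ xs) c g = trans (cong (_+_ (c * g x)) (sumₗ-⊙ xs c g)) (sym (ℤ.*-distribˡ-+ c (g x) (sumₗ g xs)))

  sumₗ-const : {A : Set} (xs : List A) (c : ℤ) → sumₗ (λ _ → c) xs ≡ + length xs * c
  sumₗ-const []       c = refl
  sumₗ-const (x ∷ xs) c = trans (cong (_+_ c) (sumₗ-const xs c)) (re c (+ length xs))
    where re : ∀ c n → c + n * c ≡ (+ 1 + n) * c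
          re = solve-∀

  sumₗ-nonneg : {A : Set} (xs : List A) (g : A → ℤ) → (∀ x → 0ℤ ≤ g x) → 0ℤ ≤ sumₗ g xs
  sumₗ-nonneg []       g p = ℤ.≤-refl
  sumₗ-nonneg (x ∷ xs) g p = ℤ.+-mono-≤ (p x) (sumₗ-nonneg xs g p)

  I-indicator : (𝓕 : List (Subset n)) (g : Fun n) → I (indicator 𝓕) g ≡ sumₗ g 𝓕
  I-indicator []      g = I-𝟎 g
  I-indicator (F ∷ 𝓕) g = trans (I-⊕ (point F) (indicator 𝓕) g) (cong₂ _+_ (I-point F g) (I-indicator 𝓕 g))

  Rk-indicator : ∀ k (𝓕 : List (Subset n)) → Uniform k 𝓕 → Rk (+ k) (indicator 𝓕)
  Rk-indicator k []      u S = trans (ℤ.*-zeroʳ (+ ∣ S ∣)) (sym (ℤ.*-zeroʳ (+ k)))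
  Rk-indicator k (F ∷ 𝓕) u = Rk-⊕ (+ k) rF (Rk-indicator k 𝓕 (λ G p → u G (there p)))
    where
    rF : Rk (+ k) (point F)
    rF S with point-support F S
    ... | inj₁ z    = trans (cong (+ ∣ S ∣ *_) z) (trans (ℤ.*-zeroʳ (+ ∣ S ∣)) (sym (trans (cong (+ k *_) z) (ℤ.*-zeroʳ (+ k)))))
    ... | inj₂ refl = cong (λ t → + t * point F F) (u F (here refl))

  K-indicator : (𝓕 𝓖 : List (Subset n)) → (∀ F G → F ∈ₗ 𝓕 → G ∈ₗ 𝓖 → Nonempty (F ∩ G)) → K (indicator 𝓕) (indicator 𝓖) ≡ 0ℤ
  K-indicator []      𝓖 e = K-𝟎 (indicator 𝓖)
  K-indicator (F ∷ 𝓕) 𝓖 e = trans (K-⊕ (point F) (indicator 𝓕) (indicator 𝓖))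
    (cong₂ _+_ (row 𝓖 (λ G → e F G (here refl))) (K-indicator 𝓕 𝓖 (λ F′ G p → e F′ G (there p))))
    where
    row : ∀ 𝓖 → (∀ G → G ∈ₗ 𝓖 → Nonempty (F ∩ G)) → K (point F) (indicator 𝓖) ≡ 0ℤ
    row []      e = K-𝟎ʳ (point F)
    row (G ∷ 𝓖) e = trans (K-⊕ʳ (point F) (point G) (indicator 𝓖)) (cong₂ _+_ (K-point F G (e G (here refl))) (row 𝓖 (λ G′ p → e G′ (there p))))

  indicator-outside : (𝓕 : List (Subset n)) (F : Subset n) → All (F ≢_) 𝓕 → indicator 𝓕 F ≡ 0ℤ
  indicator-outside []      F []       = refl
  indicator-outside (G ∷ 𝓕) F (p ∷ ps) with point-support G F
  ... | inj₁ z = cong₂ _+_ z (indicator-outside 𝓕 F ps)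
  ... | inj₂ e = contradiction (sym e) p

  -- In a list with repetitions this would be the multiplicity; distinctness makes the norm of f
  -- equal to N.
  indicator-member : (𝓕 : List (Subset n)) → Unique 𝓕 → ∀ F → F ∈ₗ 𝓕 → indicator 𝓕 F ≡ 1ℤ
  indicator-member (G ∷ 𝓕) (p ∷ ps) F (here refl) = cong₂ _+_ (point-self F) (indicator-outside 𝓕 F p)
  indicator-member (G ∷ 𝓕) (p ∷ ps) F (there q) with point-support G F
  ... | inj₁ z    = cong₂ _+_ z (indicator-member 𝓕 ps F q)
  ... | inj₂ refl = contradiction refl (All.lookup p q)

  indicator-norm : (𝓕 : List (Subset n)) → Unique 𝓕 → I (indicator 𝓕) (indicator 𝓕) ≡ + length 𝓕
  indicator-norm 𝓕 u = trans (I-indicator 𝓕 (indicator 𝓕)) (trans (sumₗ-cong 𝓕 (indicator-member 𝓕 u)) (trans (sumₗ-const 𝓕 1ℤ) (ℤ.*-identityʳ _)))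

  χ : Fin n → Subset n → ℤ
  χ i F with does (i ∈? F)
  ... | true  = 1ℤ
  ... | false = 0ℤ

  degree : List (Subset n) → Fin n → ℤ
  degree 𝓕 i = + length (link 𝓕 i)

  degree-χ : (𝓕 : List (Subset n)) (i : Fin n) → sumₗ (χ i) 𝓕 ≡ degree 𝓕 i
  degree-χ 𝓕 i = trans (go 𝓕) (cong +_ (sym (length-map _ (filter (i ∈?_) 𝓕))))
    where
    go : ∀ 𝓕 → sumₗ (χ i) 𝓕 ≡ + length (filter (i ∈?_) 𝓕)
    go []      = refl
    go (F ∷ 𝓕) with does (i ∈? F)
    ... | true  = cong (_+_ 1ℤ) (go 𝓕)
    ... | false = trans (ℤ.+-identityˡ _) (go 𝓕)

  p1-χ : (v : Fin n → ℤ) (F : Subset n) → p1 v F ≡ ∑ (λ i → v i * χ i F)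
  p1-χ v []          = refl
  p1-χ v (false ∷ F) = trans (p1-χ (v ∘ suc) F) (re (v zero) (∑ (λ i → v (suc i) * χ i F)))
    where re : ∀ a b → b ≡ a * + 0 + b
          re = solve-∀
  p1-χ v (true ∷ F)  = cong₂ _+_ (sym (ℤ.*-identityʳ (v zero))) (p1-χ (v ∘ suc) F)

  ∑-zero : ∑ {n} (λ _ → 0ℤ) ≡ 0ℤ
  ∑-zero {zero}  = refl
  ∑-zero {suc n} = trans (ℤ.+-identityˡ _) (∑-zero {n})

  sumₗ-p1 : (𝓕 : List (Subset n)) (v : Fin n → ℤ) → sumₗ (p1 v) 𝓕 ≡ ∑ (λ i → v i * degree 𝓕 i)
  sumₗ-p1 {n} 𝓕 v = trans (go 𝓕) (∑-cong (λ i → cong (v i *_) (degree-χ 𝓕 i)))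
    where
    go : ∀ 𝓕 → sumₗ (p1 v) 𝓕 ≡ ∑ (λ i → v i * sumₗ (χ i) 𝓕)
    go []      = sym (trans (∑-cong (λ i → ℤ.*-zeroʳ (v i))) (∑-zero {n}))
    go (F ∷ 𝓕) = trans (cong₂ _+_ (p1-χ v F) (go 𝓕))
      (trans (sym (∑-+ (λ i → v i * χ i F) (λ i → v i * sumₗ (χ i) 𝓕)))
             (∑-cong (λ i → sym (ℤ.*-distribˡ-+ (v i) (χ i F) (sumₗ (χ i) 𝓕)))))

  ∑-const : ∀ n c → ∑ {n} (λ _ → c) ≡ + n * c
  ∑-const zero    c = refl
  ∑-const (suc n) c = trans (cong (_+_ c) (∑-const n c)) (re c (+ n))
    where re : ∀ c n → c + n * c ≡ (+ 1 + n) * c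
          re = solve-∀

  ∑-nonneg : (v : Fin n → ℤ) → (∀ i → 0ℤ ≤ v i) → 0ℤ ≤ ∑ v
  ∑-nonneg {zero}  v p = ℤ.≤-refl
  ∑-nonneg {suc n} v p = ℤ.+-mono-≤ (p zero) (∑-nonneg (v ∘ suc) (p ∘ suc))

  -- Binomial identities

  nC0≡1 : ∀ n → n C 0 ≡ 1
  nC0≡1 n = trans (nCk≡nC[n∸k] {0} {n} ℕ.z≤n) (nCn≡1 n)

  absorption : ∀ n k → suc k ℕ.* (suc n C suc k) ≡ suc n ℕ.* (n C k)
  absorption n       zero    = trans (ℕ.*-identityˡ (suc n C 1)) (trans (nC1≡n (suc n))
    (trans (sym (ℕ.*-identityʳ (suc n))) (cong (suc n ℕ.*_) (sym (nC0≡1 n)))))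
  absorption zero    (suc k) = trans (cong (suc (suc k) ℕ.*_) (sym (nCk+nC[k+1]≡[n+1]C[k+1] 0 (suc k))))
    (ℕ.*-zeroʳ (suc (suc k)))
  absorption (suc n) (suc k) =
    trans (cong (suc (suc k) ℕ.*_) (sym (nCk+nC[k+1]≡[n+1]C[k+1] (suc n) (suc k))))
    (trans (re₁ k (suc n C suc k) (suc n C suc (suc k)))
    (trans (cong₂ (λ x y → (suc n C suc k) ℕ.+ (x ℕ.+ y)) (absorption n k) (absorption n (suc k)))
    (trans (cong (suc n C suc k ℕ.+_) (sym (ℕ.*-distribˡ-+ (suc n) (n C k) (n C suc k))))
           (cong (λ t → suc n C suc k ℕ.+ suc n ℕ.* t) (nCk+nC[k+1]≡[n+1]C[k+1] n k)))))
    where re₁ : ∀ k x y → suc (suc k) ℕ.* (x ℕ.+ y) ≡ x ℕ.+ (suc k ℕ.* x ℕ.+ suc (suc k) ℕ.* y)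
          re₁ = solveℕ-∀

  -- Absorption applied three times. For k = 2 both sides vanish, in accordance with the convention
  -- on `binom-3`.
  binom-3-ratio : ∀ n m → 3 ℕ.≤ n →
    + n * (+ n - + 1) * (+ n - + 2) * + binom-3 n (suc (suc m)) ≡ + suc (suc m) * (+ suc m * + m) * + (n C suc (suc m))
  binom-3-ratio (suc zero) _ (ℕ.s≤s ())
  binom-3-ratio (suc (suc zero)) _ (ℕ.s≤s (ℕ.s≤s ()))
  binom-3-ratio (suc (suc (suc n))) zero    le = re (+ suc (suc (suc n))) (+ (suc (suc (suc n)) C 2))
    where re : ∀ n c → n * (n - + 1) * (n - + 2) * + 0 ≡ + 2 * (+ 1 * + 0) * c
          re = solve-∀
  binom-3-ratio (suc (suc (suc n))) (suc m) le =
    trans (re₁ (+ n) (+ (n C m)))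
    (trans (cong (λ t → + 3+n * (+ 2+n * t)) (step n m))
    (trans (cong (+ 3+n *_) (sw (+ 2+n) (+ suc m) (+ (suc n C suc m))))
    (trans (cong (λ t → + 3+n * (+ suc m * t)) (step (suc n) (suc m)))
    (trans (sw₂ (+ 3+n) (+ suc m) (+ suc (suc m)) (+ (2+n C suc (suc m))))
    (trans (cong (λ t → + suc m * (+ suc (suc m) * t)) (step 2+n (suc (suc m))))
           (re₂ (+ suc m) (+ suc (suc m)) (+ suc (suc (suc m))) (+ (3+n C suc (suc (suc m))))))))))
    where
    2+n = suc (suc n)
    3+n = suc (suc (suc n))
    step : ∀ n k → + suc n * + (n C k) ≡ + suc k * + (suc n C suc k)
    step n k = trans (sym (ℤ.pos-* (suc n) (n C k))) (trans (cong +_ (sym (absorption n k))) (ℤ.pos-* (suc k) (suc n C suc k)))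
    re₁ : ∀ n c → (+ 1 + (+ 1 + (+ 1 + n))) * ((+ 1 + (+ 1 + (+ 1 + n))) - + 1) * ((+ 1 + (+ 1 + (+ 1 + n))) - + 2) * c ≡
          (+ 1 + (+ 1 + (+ 1 + n))) * ((+ 1 + (+ 1 + n)) * ((+ 1 + n) * c))
    re₁ = solve-∀
    sw : ∀ a b c → a * (b * c) ≡ b * (a * c)
    sw = solve-∀
    sw₂ : ∀ a b c d → a * (b * (c * d)) ≡ b * (c * (a * d))
    sw₂ = solve-∀
    re₂ : ∀ a b c d → a * (b * (c * d)) ≡ c * (b * a) * d
    re₂ = solve-∀

  -- No intersecting family with all degrees at most N/2

  module LowDegree (n m : ℕ) (2k≤n : 2 ℕ.* suc (suc m) ℕ.≤ n) (big : 33 ℕ.≤ n ⊎ 2 ℕ.≤ m)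
    (𝓕 : Family n) (unique : Unique 𝓕) (uniform : Uniform (suc (suc m)) 𝓕) (inter : Intersecting 𝓕)
    (nonempty : 0 ℕ.< length 𝓕) (large : 36 ℕ.* binom-3 n (suc (suc m)) ℕ.≤ length 𝓕)
    (low : ∀ i → 2 ℕ.* length (link 𝓕 i) ℕ.≤ length 𝓕) where

    open Kneser m 2k≤n

    N : ℤ
    N = + length 𝓕

    N>0 : 0ℤ < N
    N>0 = +<+ nonempty

    w : Fin n → ℤ
    w i = + n * degree 𝓕 i - + k * N

    5≤n : 5 ℕ.≤ n
    5≤n = go big
      where
      go : 33 ℕ.≤ n ⊎ 2 ℕ.≤ m → 5 ℕ.≤ n
      go (inj₁ p) = ℕ.≤-trans (ℕ.m≤m+n 5 28) p
      go (inj₂ p) = ℕ.≤-trans (ℕ.m≤m+n 5 3) (ℕ.≤-trans (ℕ.*-monoʳ-≤ 2 (ℕ.s≤s (ℕ.s≤s p))) 2k≤n)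

    n>0 : 0ℤ < + n
    n>0 = +<+ (ℕ.≤-trans (ℕ.m≤m+n 1 4) 5≤n)

    -- Double counting of incidences with weight v. It yields all linear moments needed: v = 1 gives
    -- ∑ w = 0, v = w gives `nx`, v = w² relates P₂ to the cubes, and general v gives `balance`.
    weighted : ∀ v → + n * sumₗ (p1 v) 𝓕 ≡ ∑ (w · v) + + k * N * ∑ v
    weighted v =
      trans (cong (+ n *_) (sumₗ-p1 𝓕 v))
      (trans (sym (∑-⊙ (+ n) (λ i → v i * degree 𝓕 i)))
      (trans (∑-cong (λ i → re (+ n) (v i) (degree 𝓕 i) (+ k * N)))
      (trans (∑-+ (w · v) (λ i → + k * N * v i)) (cong (_+_ (∑ (w · v))) (∑-⊙ (+ k * N) v)))))
      where re : ∀ n v d c → n * (v * d) ≡ (n * d - c) * v + c * v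
            re = solve-∀

    W : ∑ w ≡ 0ℤ
    W = trans (∑-cong (λ i → sym (ℤ.*-identityʳ (w i)))) (re-cancel (trans (sym (weighted (λ _ → 1ℤ))) (trans (cong (+ n *_) sizes) (re (+ n) N (+ k)))))
      where
      sizes : sumₗ (p1 (λ _ → 1ℤ)) 𝓕 ≡ N * + k
      sizes = trans (sumₗ-cong 𝓕 (λ F F∈ → trans (p1-const F) (cong +_ (uniform F F∈)))) (sumₗ-const 𝓕 (+ k))
      re : ∀ n N k → n * (N * k) ≡ k * N * (n * + 1)
      re = solve-∀
      iso : ∀ a b → a ≡ (a + b) - b
      iso = solve-∀
      re-cancel : ∀ {a} → a + + k * N * ∑ {n} (λ _ → 1ℤ) ≡ + k * N * (+ n * + 1) → a ≡ 0ℤ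
      re-cancel {a} e = trans (iso a b) (trans (cong (_- b) (trans e (cong (+ k * N *_) (sym (∑-const n 1ℤ))))) (ℤ.+-inverseʳ b))
        where b = + k * N * ∑ {n} (λ _ → 1ℤ)

    open Level w W

    f : Fun n
    f = indicator 𝓕

    rf : Rk (+ k) f
    rf = Rk-indicator k 𝓕 uniform

    I-f : ∀ P → I f (at k P) ≡ sumₗ P 𝓕
    I-f P = trans (I-indicator 𝓕 (at k P)) (sumₗ-cong 𝓕 (λ F F∈ → at-value k P F (uniform F F∈)))

    X₂ P₂ c₃ x z b₁ b₂ B₀ R : ℤ
    X₂ = sumₗ (p1 w · p1 w) 𝓕
    P₂ = sumₗ (p1 (w · w)) 𝓕
    c₃ = ∑ (w · (w · w))
    x = I X f
    z = I y′ f
    b₁ = I X X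
    b₂ = I y′ y′
    B₀ = I one one
    R = + binom-3 n k

    module Ar = Arithmetic (+ n) (+ m) N s x z b₁ b₂ B₀ R q c₃ X₂ P₂

    balance : ∀ v → Ar.α * I f (at k (p1 v)) ≡ Ar.β₀ * I one (at k (p1 v)) + Ar.β₁ * I X (at k (p1 v))
    balance v = cancel-≡ (*-pos n>0 (diff-pos (+<+ (ℕ.≤-trans (ℕ.m≤m+n 2 3) 5≤n))))
      (trans (r₁ (+ n) (Ar.α) (I f (at k (p1 v))))
      (trans (cong (λ t → Ar.α * (+ n - + 1) * t) (trans (cong (+ n *_) (I-f (p1 v))) (weighted v)))
      (trans (r₂ (+ n) N Ar.k Ar.a (Ar.l * (Ar.a - + 1)) B₀ (∑ (w · v)) (∑ v))
      (trans (cong₂ (λ i j → Ar.β₀ * (+ n - + 1) * i + Ar.β₁ * j) (sym (size-p1 (suc m) v)) (sym (p1-norm (suc m) w v W)))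
             (r₃ (+ n) Ar.β₀ Ar.β₁ (I one (at k (p1 v))) (I X (at k (p1 v))))))))
      where
      r₁ : ∀ n α i → n * (n - + 1) * (α * i) ≡ α * (n - + 1) * (n * i)
      r₁ = solve-∀
      r₂ : ∀ n N k a e B s v → + 8 * n * N * (k * a * e) * B * (n - + 1) * (s + k * N * v) ≡
           + 8 * n * N * N * (k * a * e) * (n - + 1) * (k * B * v) + + 8 * n * N * (n - + 1) * e * (k * a * B * s)
      r₂ = solve-∀
      r₃ : ∀ n b c i j → b * (n - + 1) * (n * i) + c * (n * (n - + 1) * j) ≡ n * (n - + 1) * (b * i + c * j)
      r₃ = solve-∀

    module Te = Test (ℕ.≤-trans (ℕ.m≤m+n 2 3) 5≤n) f rf (K-indicator 𝓕 𝓕 inter) Ar.α Ar.β₀ Ar.β₁ Ar.β₂ balance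

    spectral : 0ℤ ≤ Ar.α * Ar.α * (Ar.q₃ * N) - + 2 * Ar.α * (Ar.β₀ * (Ar.h₀ * N) + Ar.β₁ * (Ar.h₁ * x) + Ar.β₂ * (Ar.h₂ * z))
                + (Ar.β₀ * (Ar.h₀ * (Ar.β₀ * B₀)) + Ar.β₁ * (Ar.h₁ * (Ar.β₁ * b₁)) + Ar.β₂ * (Ar.h₂ * (Ar.β₂ * b₂)))
    spectral = subst₂ (λ i j → 0ℤ ≤ Ar.α * Ar.α * (Ar.q₃ * i) - + 2 * Ar.α * (Ar.β₀ * (Ar.h₀ * j) + Ar.β₁ * (Ar.h₁ * x) + Ar.β₂ * (Ar.h₂ * z))
                + (Ar.β₀ * (Ar.h₀ * (Ar.β₀ * B₀)) + Ar.β₁ * (Ar.h₁ * (Ar.β₁ * b₁)) + Ar.β₂ * (Ar.h₂ * (Ar.β₂ * b₂))))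
      (indicator-norm 𝓕 unique)
      (trans (I-comm one f) (trans (I-f 𝟏) (trans (sumₗ-const 𝓕 1ℤ) (ℤ.*-identityʳ N))))
      Te.inequality

    nLx : + n * sumₗ (p1 w) 𝓕 ≡ s
    nLx = trans (weighted w) (trans (cong (λ t → s + + k * N * t) W) (re s (+ k * N)))
      where re : ∀ s c → s + c * + 0 ≡ s
            re = solve-∀

    nx : + n * x ≡ s
    nx = trans (cong (+ n *_) (trans (I-comm X f) (I-f (p1 w)))) nLx

    -- Trading 2 e₂ for X² - P through `p1²` gives `y m` its form in X² and P, which is then summed
    -- over 𝓕.
    nz : z ≡ (+ n - + 1) * ((+ n - + 2) * X₂ - Ar.d * P₂) - Ar.k * Ar.l * s * N
    nz = trans (I-comm y′ f) (trans (I-f (y m))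
      (trans (sumₗ-cong 𝓕 (λ F _ → pointwise F))
      (trans (sumₗ-+ 𝓕 (λ F → c₁ * (p1 w · p1 w) F + c₂ * p1 (w · w) F) (λ _ → - (Ar.k * Ar.l * s)))
      (trans (cong₂ _+_ (trans (sumₗ-+ 𝓕 (λ F → c₁ * (p1 w · p1 w) F) (λ F → c₂ * p1 (w · w) F))
                               (cong₂ _+_ (sumₗ-⊙ 𝓕 c₁ (p1 w · p1 w)) (sumₗ-⊙ 𝓕 c₂ (p1 (w · w)))))
                        (sumₗ-const 𝓕 (- (Ar.k * Ar.l * s))))
             (re (+ n) Ar.d (Ar.k * Ar.l * s) N X₂ P₂)))))
      where
      c₁ c₂ : ℤ
      c₁ = (+ n - + 1) * (+ n - + 2)
      c₂ = - ((+ n - + 1) * Ar.d)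
      re : ∀ n d e N X P → (n - + 1) * (n - + 2) * X + - ((n - + 1) * d) * P + N * - e ≡ (n - + 1) * ((n - + 2) * X - d * P) - e * N
      re = solve-∀
      r₁ : ∀ c e p t u → + 2 * c * e + p - t ≡ c * (+ 2 * e + u) - c * u + p - t
      r₁ = solve-∀
      r₂ : ∀ n m Q P t → (n - + 1) * (n - + 2) * Q - (n - + 1) * (n - + 2) * P + + 2 * (n - + 1) * (+ 1 + m) * P - t ≡
           (n - + 1) * (n - + 2) * Q + - ((n - + 1) * (n - + 2 * (+ 1 + (+ 1 + m)))) * P + - t
      r₂ = solve-∀
      pointwise : ∀ F → y m F ≡ c₁ * (p1 w F * p1 w F) + c₂ * p1 (w · w) F + - (Ar.k * Ar.l * s)
      pointwise F = trans (r₁ c₁ (e2 w F) (+ 2 * (+ n - + 1) * + suc m * p1 (w · w) F) (Ar.k * Ar.l * s) (p1 (w · w) F))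
        (trans (cong (λ t → c₁ * t - c₁ * p1 (w · w) F + + 2 * (+ n - + 1) * + suc m * p1 (w · w) F - Ar.k * Ar.l * s) (sym (p1² w F)))
               (r₂ (+ n) (+ m) (p1 w F * p1 w F) (p1 (w · w) F) (Ar.k * Ar.l * s)))

    -- The sum over 𝓕 of the squares (nN·X(F) - s)² is nonnegative, where s/(nN) is the mean of X on
    -- 𝓕.
    cauchy : s * s ≤ + n * + n * N * X₂
    cauchy = ℤ.0≤i-j⇒j≤i (cancel-pos N>0 (subst (0ℤ ≤_) total (sumₗ-nonneg 𝓕 square (λ F → square-nonneg (+ n * N * p1 w F - s)))))
      where
      square : Subset n → ℤ
      square F = (+ n * N * p1 w F - s) * (+ n * N * p1 w F - s)
      c₁ c₂ : ℤ
      c₁ = + n * N * (+ n * N)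
      c₂ = - (+ 2 * (+ n * N) * s)
      ex : ∀ a p s → (a * p - s) * (a * p - s) ≡ a * a * (p * p) + - (+ 2 * a * s) * p + s * s
      ex = solve-∀
      re : ∀ n N s X L → n * N * (n * N) * X + - (+ 2 * (n * N) * s) * L + N * (s * s) ≡ N * (n * n * N * X - + 2 * s * (n * L) + s * s)
      re = solve-∀
      re₂ : ∀ N A s → N * (A - + 2 * s * s + s * s) ≡ N * (A - s * s)
      re₂ = solve-∀
      total : sumₗ square 𝓕 ≡ N * (+ n * + n * N * X₂ - s * s)
      total = trans (sumₗ-cong 𝓕 (λ F _ → ex (+ n * N) (p1 w F) s))
        (trans (sumₗ-+ 𝓕 (λ F → c₁ * (p1 w · p1 w) F + c₂ * p1 w F) (λ _ → s * s))
        (trans (cong₂ _+_ (trans (sumₗ-+ 𝓕 (λ F → c₁ * (p1 w · p1 w) F) (λ F → c₂ * p1 w F))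
                                 (cong₂ _+_ (sumₗ-⊙ 𝓕 c₁ (p1 w · p1 w)) (sumₗ-⊙ 𝓕 c₂ (p1 w))))
                          (sumₗ-const 𝓕 (s * s)))
        (trans (re (+ n) N s X₂ (sumₗ (p1 w) 𝓕))
        (trans (cong (λ t → N * (+ n * + n * N * X₂ - + 2 * s * t + s * s)) nLx)
               (re₂ N (+ n * + n * N * X₂) s)))))

    Δ : ℤ
    Δ = Ar.d * N

    Δ≥0 : 0ℤ ≤ Δ
    Δ≥0 = *-nonneg (ℤ.i≤j⇒0≤j-i (subst (_≤ + n) (ℤ.pos-* 2 k) (+≤+ 2k≤n))) (ℤ.<⇒≤ N>0)

    -- The only place where the degree bound enters: 2 w i ≤ d N.
    2w≤Δ : ∀ i → 0ℤ ≤ Δ - + 2 * w i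
    2w≤Δ i = subst (0ℤ ≤_) (re (+ n) (+ k) N (degree 𝓕 i))
      (*-nonneg (ℤ.<⇒≤ n>0) (ℤ.i≤j⇒0≤j-i (subst (_≤ N) (ℤ.pos-* 2 (length (link 𝓕 i))) (+≤+ (low i)))))
      where re : ∀ n k N d → n * (N - + 2 * d) ≡ (n - + 2 * k) * N - + 2 * (n * d - k * N)
            re = solve-∀

    -- Termwise, 13Δ² - 32Δw + 12w² = (Δ - 2w)(13Δ - 6w), and 13Δ - 6w = 10Δ + 3(Δ - 2w). The
    -- constant 13 = 16 - 3 is the one that puts a root at w = Δ/2, the extreme value allowed by
    -- `2w≤Δ`.
    cubic : + 4 * (+ 8 * Ar.d * N * c₃ - + 3 * q) ≤ + 13 * (Ar.d * Ar.d) * (N * N) * s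
    cubic = ℤ.0≤i-j⇒j≤i (subst (0ℤ ≤_) total (∑-nonneg t t≥0))
      where
      t : Fin n → ℤ
      t i = w i * w i * ((Δ - + 2 * w i) * (+ 10 * Δ + + 3 * (Δ - + 2 * w i)))
      t≥0 : ∀ i → 0ℤ ≤ t i
      t≥0 i = *-nonneg (square-nonneg (w i)) (*-nonneg (2w≤Δ i)
        (ℤ.+-mono-≤ (*-nonneg {+ 10} (+≤+ ℕ.z≤n) Δ≥0) (*-nonneg {+ 3} (+≤+ ℕ.z≤n) (2w≤Δ i))))
      c₁ c₂ : ℤ
      c₁ = + 13 * (Δ * Δ)
      c₂ = - (+ 32 * Δ)
      ex : ∀ Δ w → w * w * ((Δ - + 2 * w) * (+ 10 * Δ + + 3 * (Δ - + 2 * w))) ≡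
           + 13 * (Δ * Δ) * (w * w) + - (+ 32 * Δ) * (w * (w * w)) + + 12 * (w * w * (w * w))
      ex = solve-∀
      re : ∀ d N s c q → + 13 * (d * N * (d * N)) * s + - (+ 32 * (d * N)) * c + + 12 * q ≡
           + 13 * (d * d) * (N * N) * s - + 4 * (+ 8 * d * N * c - + 3 * q)
      re = solve-∀
      total : ∑ t ≡ + 13 * (Ar.d * Ar.d) * (N * N) * s - + 4 * (+ 8 * Ar.d * N * c₃ - + 3 * q)
      total = trans (∑-cong (λ i → ex Δ (w i)))
        (trans (∑-+ (λ i → c₁ * (w · w) i + c₂ * (w · (w · w)) i) (λ i → + 12 * (w · w · (w · w)) i))
        (trans (cong₂ _+_ (trans (∑-+ (λ i → c₁ * (w · w) i) (λ i → c₂ * (w · (w · w)) i))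
                                 (cong₂ _+_ (∑-⊙ c₁ (w · w)) (∑-⊙ c₂ (w · (w · w)))))
                          (∑-⊙ (+ 12) (w · w · (w · w))))
               (re Ar.d N s c₃ q)))

    B₀>0 : 0ℤ < B₀
    B₀>0 = ℤ.≤∧≢⇒< (I-nonneg one) λ e → pick 𝓕 nonempty uniform (I-definite one (sym e))
      where
      pick : ∀ 𝓖 → 0 ℕ.< length 𝓖 → Uniform k 𝓖 → one ≈ 𝟎 → ⊥
      pick (F ∷ 𝓖) _ u e with trans (sym (at-value k 𝟏 F (u F (here refl)))) (e F)
      ... | ()

    a>1 : 0ℤ < Ar.a - + 1
    a>1 = subst (0ℤ <_) (re (+ n) (+ k)) (diff-pos (ℤ.<-≤-trans (+<+ lt) (+≤+ 2k≤n)))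
      where
      lt : suc k ℕ.< 2 ℕ.* k
      lt = ℕ.s≤s (ℕ.s≤s (ℕ.≤-trans (ℕ.≤-reflexive (ℕ.+-comm 2 m)) (ℕ.+-monoʳ-≤ m (ℕ.s≤s (ℕ.s≤s ℕ.z≤n)))))
      re : ∀ n k → n - (+ 1 + k) ≡ n - k - + 1
      re = solve-∀

    absurd : ⊥
    absurd = Ar.Contradiction.contradictory
      (diff-pos (+<+ 5≤n)) (+≤+ ℕ.z≤n) a>1 N>0 B₀>0 spectral nx
      (p1-norm (suc m) w w W) (y-norm m)
      (trans (binom-3-ratio n m (ℕ.≤-trans (ℕ.m≤m+n 3 2) 5≤n)) (cong (Ar.q₃ *_) (sym (size-count n k))))
      (subst (_≤ N) (ℤ.pos-* 36 (binom-3 n k)) (+≤+ large))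
      nz (weighted (w · w)) cauchy cubic (discr-pos n m 2k≤n big)

-- Small k and the conclusion

open Spectral using (module LowDegree)
open import Data.Nat using (_*_; _+_; _≤_; _<_; z≤n; s≤s; _<?_)

Conclusion : ℕ → ℕ → Set
Conclusion n k = (𝓕 : Family n) → Unique 𝓕 → Uniform k 𝓕 → Intersecting 𝓕 →
  0 < length 𝓕 → 36 * binom-3 n k ≤ length 𝓕 → ∃ λ (i : Fin n) → length 𝓕 < 2 * length (link 𝓕 i)

spread : ∀ n m → 2 * suc (suc m) ≤ n → 33 ≤ n ⊎ 2 ≤ m → Conclusion n (suc (suc m))
spread n m 2k≤n big 𝓕 unique uniform inter nonempty large
  with any? (λ i → length 𝓕 <? 2 * length (link 𝓕 i))
... | yes found = found
... | no  none  = ⊥-elim (LowDegree.absurd n m 2k≤n big 𝓕 unique uniform inter nonempty large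
                    (λ i → ℕ.≮⇒≥ (λ lt → none (i , lt))))

extend : ∀ {n} → Family n → Family (suc n)
extend = map (outside ∷_)

link-length : ∀ {n} (𝓕 : Family n) i → length (link 𝓕 i) ≡ length (filter (i ∈?_) 𝓕)
link-length 𝓕 i = length-map (_∖ i) (filter (i ∈?_) 𝓕)

extend-degree-zero : ∀ {n} (𝓕 : Family n) → length (filter (zero ∈?_) (extend 𝓕)) ≡ 0
extend-degree-zero []      = refl
extend-degree-zero (F ∷ 𝓕) = extend-degree-zero 𝓕

extend-degree-suc : ∀ {n} (𝓕 : Family n) i → length (filter (suc i ∈?_) (extend 𝓕)) ≡ length (filter (i ∈?_) 𝓕)
extend-degree-suc []      i = refl
extend-degree-suc (F ∷ 𝓕) i with does (i ∈? F)
... | true  = cong suc (extend-degree-suc 𝓕 i)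
... | false = extend-degree-suc 𝓕 i

-- For k ≤ 3 the bound 36 C(n−3, k−3) does not grow with n, so new points may be added for free.
restrict : ∀ {n k} → binom-3 (suc n) k ≤ binom-3 n k → Conclusion (suc n) k → Conclusion n k
restrict {n} {k} mono thm 𝓕 unique uniform inter nonempty large =
  back (thm (extend 𝓕) (map⁺ ∷-injectiveʳ unique) uniform′ inter′
    (subst (0 <_) (sym len) nonempty)
    (subst (36 * binom-3 (suc n) k ≤_) (sym len) (ℕ.≤-trans (ℕ.*-monoʳ-≤ 36 mono) large)))
  where
  len : length (extend 𝓕) ≡ length 𝓕
  len = length-map (outside ∷_) 𝓕
  uniform′ : Uniform k (extend 𝓕)
  uniform′ _ p with ∈-map⁻ (outside ∷_) p
  ... | F , F∈ , refl = uniform F F∈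
  inter′ : Intersecting (extend 𝓕)
  inter′ _ _ p q with ∈-map⁻ (outside ∷_) p | ∈-map⁻ (outside ∷_) q
  ... | F , F∈ , refl | G , G∈ , refl with inter F G F∈ G∈
  ...   | i , i∈ = suc i , there i∈
  back : (∃ λ i → length (extend 𝓕) < 2 * length (link (extend 𝓕) i)) → ∃ λ i → length 𝓕 < 2 * length (link 𝓕 i)
  back (zero , lt) = contradiction
    (subst (λ t → length (extend 𝓕) < 2 * t) (trans (link-length (extend 𝓕) zero) (extend-degree-zero 𝓕)) lt) λ ()
  back (suc i , lt) = i , subst₂ (λ s t → s < 2 * t) len
    (trans (link-length (extend 𝓕) (suc i)) (trans (extend-degree-suc 𝓕 i) (sym (link-length 𝓕 i)))) lt

restrict^ : ∀ {k} j n → (∀ n′ → n ≤ n′ → binom-3 (suc n′) k ≤ binom-3 n′ k) → Conclusion (j + n) k → Conclusion n k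
restrict^ zero    n mono thm = thm
restrict^ {k} (suc j) n mono thm = restrict^ j n mono (restrict (mono (j + n) (ℕ.m≤n+m n j)) thm)

binom-3-2 : ∀ n → binom-3 n 2 ≡ 0
binom-3-2 zero = refl
binom-3-2 (suc zero) = refl
binom-3-2 (suc (suc zero)) = refl
binom-3-2 (suc (suc (suc n))) = refl

binom-3-3 : ∀ n → 3 ≤ n → binom-3 n 3 ≡ 1
binom-3-3 (suc zero) (s≤s ())
binom-3-3 (suc (suc zero)) (s≤s (s≤s ()))
binom-3-3 (suc (suc (suc n))) _ = trans (nCk≡nC[n∸k] {0} {n} z≤n) (nCn≡1 n)

-- If i ≠ j, then i survives the removal of j, so the size can drop twice and is at least 2.
size-one : ∀ {n} (F : Subset n) → ∣ F ∣ ≡ 1 → ∀ {i j} → i ∈ F → j ∈ F → i ≡ j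
size-one F e {i} {j} i∈ j∈ with i ≟ᶠ j
... | yes p = p
... | no i≢j = contradiction
  (ℕ.≤-trans (s≤s (ℕ.≤-trans (s≤s z≤n) (x∈p⇒∣p-x∣<∣p∣ (x∈p∧x≢y⇒x∈p-y i∈ i≢j)))) (subst (suc ∣ F ∖ j ∣ ≤_) e (x∈p⇒∣p-x∣<∣p∣ j∈)))
  λ { (s≤s ()) }

-- Every member meets the first one, hence contains its only point, whose degree is therefore the
-- full |𝓕|.
singletons : ∀ n → Conclusion n 1
singletons n (F ∷ 𝓕) unique uniform inter nonempty large with inter F F (here refl) (here refl)
... | i , i∈ = i , subst (λ t → length (F ∷ 𝓕) < 2 * t) (sym full) (ℕ.m<m+n (length (F ∷ 𝓕)) (s≤s z≤n))
  where
  all : All.All (i ∈_) (F ∷ 𝓕)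
  all = All.tabulate λ {G} G∈ → let (j , j∈) = inter F G (here refl) G∈ ; (j∈F , j∈G) = x∈p∩q⁻ F G j∈ in
    subst (_∈ G) (size-one F (uniform F (here refl)) j∈F (proj₁ (x∈p∩q⁻ F F i∈))) j∈G
  full : length (link (F ∷ 𝓕) i) ≡ length (F ∷ 𝓕)
  full = trans (link-length (F ∷ 𝓕) i) (cong length (filter-all (i ∈?_) all))

theorem1p7 : ∀ (n k : ℕ) → 1 ≤ k → 2 * k ≤ n →
    (𝓕 : Family n) → Unique 𝓕 → Uniform k 𝓕 → Intersecting 𝓕 →
    0 < length 𝓕 →
    36 * binom-3 n k ≤ length 𝓕 →
    ∃ λ (i : Fin n) → length 𝓕 < 2 * length (link 𝓕 i)
theorem1p7 n 1 _ _ = singletons n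
-- Adding 33 points reaches the range of `discr-pos` whatever n is.
theorem1p7 n 2 _ 2k≤n = restrict^ 33 n
  (λ n′ _ → ℕ.≤-reflexive (trans (binom-3-2 (suc n′)) (sym (binom-3-2 n′))))
  (spread (33 + n) 0 (ℕ.≤-trans 2k≤n (ℕ.m≤n+m n 33)) (inj₁ (ℕ.m≤m+n 33 n)))
theorem1p7 n 3 _ 2k≤n = restrict^ 33 n
  (λ n′ n≤n′ → ℕ.≤-reflexive (trans (binom-3-3 (suc n′) (ℕ.m≤n⇒m≤1+n (3≤ n≤n′))) (sym (binom-3-3 n′ (3≤ n≤n′)))))
  (spread (33 + n) 1 (ℕ.≤-trans 2k≤n (ℕ.m≤n+m n 33)) (inj₁ (ℕ.m≤m+n 33 n)))
  where
  3≤ : ∀ {n′} → n ≤ n′ → 3 ≤ n′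
  3≤ = ℕ.≤-trans (ℕ.≤-trans (ℕ.m≤m+n 3 3) 2k≤n)
theorem1p7 n (suc (suc (suc (suc m)))) _ 2k≤n = spread n (suc (suc m)) 2k≤n (inj₂ (s≤s (s≤s z≤n)))
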